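{- Let $q,k\in\mathbb{N}$ with $q$ prime and $k<q$, and let $\varepsilon,\delta\in(0,1)$. There exist constants $c>0$ and $r_0$, depending only on $k,q,\delta,\varepsilon$, such that the following holds. Let $n,d,r,\Delta,e\in\mathbb{N}$ be such that $r\ge r_0$, $r=(q-1)n-d$, $q^{\varepsilon r}\le\Delta\le q^{\frac{r}{4(q-1)}-2}$, and $\delta r\le e\le\frac{r}{4k}$. Let $h$ be a univariate polynomial over $\mathbb{F}_q$ of degree exactly $k$. Then, given any $f:\mathbb{F}_q^n\to\mathbb{F}_q$ that is $\Delta$-far from $\mathcal{P}_q(n,d)$, and for $P$ chosen uniformly at random from $\mathcal{P}_q(n,e)$, we have \[ \Pr_{P}\left[f\cdot h(P)\in\mathcal{P}_q(n,d+ek)\right]\le \frac{1}{q^{\,q^{cr}/2^k}}. \]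
   Context: $\mathbb{N}=\{1,2,3,\ldots\}$. $\mathbb{F}_q$ is the finite field with $q$ elements. $\mathcal{P}_q(n,d)$ (the Reed-Muller code) is the set of functions $\mathbb{F}_q^n\to\mathbb{F}_q$ that are evaluations of polynomials in $n$ variables over $\mathbb{F}_q$ of total degree at most $d$. Products of functions are pointwise, and $h(P)$ is the function $x\mapsto h(P(x))$. For $f,g:\mathbb{F}_q^n\to\mathbb{F}_q$ the (absolute) Hamming distance is $\Delta(f,g)=\#\{x\in\mathbb{F}_q^n: f(x)\ne g(x)\}$, and for a set $\mathcal{G}$ of functions $\Delta(f,\mathcal{G})=\min_{g\in\mathcal{G}}\Delta(f,g)$. For a number $\Delta$, $f$ is $\Delta$-far from $\mathcal{G}$ if $\Delta(f,\mathcal{G})>\Delta$. -}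

module Defs where

open import Algebra.Bundles.Raw using (RawSemiring)
import Algebra.Definitions.RawSemiring as RawSemiringDefs
open import Data.Empty using (⊥-elim)
open import Data.Fin.Base using (Fin; toℕ)
import Data.Fin.Properties as Fin
open import Data.Integer.Base as ℤ using (ℤ; +_; -[1+_])
import Data.Integer.Properties as ℤ
open import Data.List.Base as List using (List; []; _∷_; length; filter; upTo; allFin; cartesianProductWith)
open import Data.List.Extrema.Nat using (min)
open import Data.Nat.Base as ℕ using (ℕ; zero; suc; NonZero)
open import Data.Nat.DivMod using (_mod_)
import Data.Nat.Properties as ℕ
open import Data.Nat.Primality using (Prime; prime⇒nonTrivial)
open import Data.Product.Base using (∃; _×_; _,_)
open import Data.Rational.Unnormalised.Base as ℚ using (ℚᵘ; 0ℚᵘ; 1ℚᵘ; _<_; _≤_; _*_; _/_; ↥_; ↧ₙ_; *≡*; *≤*; *<*)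
open import Data.Rational.Unnormalised.Properties as ℚ
  using (<-trans; <-≤-trans; ≤-<-trans; ≤-trans; <⇒≤; <-irrefl; <-dense)
open import Data.Vec.Base as Vec using (Vec; []; _∷_; foldr′; zipWith; lookup; head; tail; fromList)
open import Level using (0ℓ)
open import Relation.Binary.PropositionalEquality using (_≡_; sym; trans; cong; subst)
open import Relation.Nullary using (¬_; Dec; ¬?)
open import Relation.Nullary.Decidable using (map′)
open import Relation.Unary using (Pred; Decidable)

------------------------------------------------------------------------
-- Real numbers as Dedekind cuts in Rudin's one-sided sense: a real number
-- is identified with the set of rationals strictly below it.

record ℝ : Set₁ where
  field
    lower     : ℚᵘ → Set
    inhabited : ∃ λ p → lower p
    proper    : ∃ λ p → ¬ lower p
    closed    : ∀ {p q} → p < q → lower q → lower p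
    rounded   : ∀ {p} → lower p → ∃ λ q → p < q × lower q

open ℝ

infix 4 _∈_ _∉_ _≤ᴿ_ _<ᴿ_

_∈_ _∉_ : ℚᵘ → ℝ → Set
p ∈ x = lower x p
p ∉ x = ¬ (p ∈ x)

_≤ᴿ_ : ℝ → ℝ → Set
x ≤ᴿ y = ∀ p → p ∈ x → p ∈ y

_<ᴿ_ : ℝ → ℝ → Set
x <ᴿ y = ∃ λ p → p ∈ y × p ∉ x

module _ (x : ℝ) where

  ∈∧∉⇒< : ∀ {p u} → p ∈ x → u ∉ x → p < u
  ∈∧∉⇒< p∈x u∉x = ℚ.≰⇒> λ u≤p →
    let (_ , p<q , q∈x) = rounded x p∈x in u∉x (closed x (≤-<-trans u≤p p<q) q∈x)

  ∈-resp-≃ : ∀ {p p′} → p ℚ.≃ p′ → p ∈ x → p′ ∈ x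
  ∈-resp-≃ p≃p′ p∈x =
    let (_ , p<q , q∈x) = rounded x p∈x
    in closed x (≤-<-trans (ℚ.≤-reflexive (ℚ.≃-sym p≃p′)) p<q) q∈x

private
  -1ℚᵘ<0 : ℚ.- 1ℚᵘ < 0ℚᵘ
  -1ℚᵘ<0 = *<* ℤ.-<+

  p-1<p : ∀ p → p ℚ.- 1ℚᵘ < p
  p-1<p p = <-≤-trans (ℚ.+-monoʳ-< p -1ℚᵘ<0) (ℚ.≤-reflexive (ℚ.+-identityʳ p))

fromℚ : ℚᵘ → ℝ
fromℚ p = record
  { lower     = _< p
  ; inhabited = p ℚ.- 1ℚᵘ , p-1<p p
  ; proper    = p , <-irrefl ℚ.≃-refl
  ; closed    = <-trans
  ; rounded   = λ q<p → let (m , q<m , m<p) = <-dense q<p in m , q<m , m<p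
  }

fromℕ : ℕ → ℝ
fromℕ n = fromℚ (+ n / 1)

0ᴿ 1ᴿ : ℝ
0ᴿ = fromℕ 0
1ᴿ = fromℕ 1

infixl 7 _·_ _∕_

_·_ : ℕ → ℝ → ℝ
n · x = record
  { lower     = λ y → ∃ λ p → p ∈ x × y < (+ n / 1) * p
  ; inhabited = let (p , p∈x) = inhabited x in _ , p , p∈x , p-1<p _
  ; proper    = let (u , u∉x) = proper x in (+ n / 1) * u , λ (p , p∈x , nu<np) →
                  u∉x (closed x (ℚ.*-cancelˡ-<-nonNeg (+ n / 1) nu<np) p∈x)
  ; closed    = λ y<z (p , p∈x , z<np) → p , p∈x , <-trans y<z z<np
  ; rounded   = λ (p , p∈x , y<np) →
                  let (z , y<z , z<np) = <-dense y<np in z , y<z , p , p∈x , z<np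
  }

private
  m/1>0 : ∀ m .{{_ : NonZero m}} → ℚ.Positive (+ m / 1)
  m/1>0 (suc m) = _

  m*[1/m*p]≃p : ∀ m .{{_ : NonZero m}} p → (+ m / 1) * ((+ 1 / m) * p) ℚ.≃ p
  m*[1/m*p]≃p m@(suc _) p = ℚ.≃-trans (ℚ.≃-sym (ℚ.*-assoc (+ m / 1) (+ 1 / m) p))
    (ℚ.≃-trans (ℚ.*-congʳ {p} {(+ m / 1) * (+ 1 / m)} {1ℚᵘ} (*≡* m*1≡1*m)) (ℚ.*-identityˡ p))
    where
    m*1≡1*m : + m ℤ.* + 1 ℤ.* + 1 ≡ + 1 ℤ.* + (1 ℕ.* m)
    m*1≡1*m = trans (ℤ.*-identityʳ _) (trans (ℤ.*-comm (+ m) (+ 1))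
                (cong (λ k → + 1 ℤ.* + k) (sym (ℕ.*-identityˡ m))))

_∕_ : ℝ → (m : ℕ) → .{{_ : NonZero m}} → ℝ
x ∕ m = record
  { lower     = λ y → (+ m / 1) * y ∈ x
  ; inhabited = let (p , p∈x) = inhabited x in
                  (+ 1 / m) * p , ∈-resp-≃ x (ℚ.≃-sym (m*[1/m*p]≃p m p)) p∈x
  ; proper    = let (u , u∉x) = proper x in
                  (+ 1 / m) * u , λ mu∈x → u∉x (∈-resp-≃ x (m*[1/m*p]≃p m u) mu∈x)
  ; closed    = λ y<z → closed x (ℚ.*-monoʳ-<-pos (+ m / 1) {{m/1>0 m}} y<z)
  ; rounded   = λ my∈x → let (p , my<p , p∈x) = rounded x my∈x in
                  (+ 1 / m) * p
                  , ℚ.*-cancelˡ-<-nonNeg (+ m / 1)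
                      (<-≤-trans my<p (ℚ.≤-reflexive (ℚ.≃-sym (m*[1/m*p]≃p m p))))
                  , ∈-resp-≃ x (ℚ.≃-sym (m*[1/m*p]≃p m p)) p∈x
  }

-- The rationals below 1/x are those below 1/u for some rational upper
-- bound u of x.
recip : (x : ℝ) → 0ᴿ <ᴿ x → ℝ
recip x (p₀ , p₀∈x , p₀≮0) = record
  { lower     = λ y → ∃ λ u → 0ℚᵘ < u × u ∉ x × y * u < 1ℚᵘ
  ; inhabited = let (u , u∉x) = proper x in
                  0ℚᵘ , u , ≤-<-trans 0≤p₀ (∈∧∉⇒< x p₀∈x u∉x) , u∉x
                  , ≤-<-trans (ℚ.≤-reflexive (ℚ.*-zeroˡ u)) 0<1
  ; proper    = ℚ.1/_ p {{p≠0}} , λ (u , 0<u , u∉x , y*u<1) →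
                  u∉x (closed x (u<p u y*u<1) p∈x)
  ; closed    = λ y<z (u , 0<u , u∉x , zu<1) → u , 0<u , u∉x ,
                  <-trans (ℚ.*-monoˡ-<-pos u {{ℚ.positive 0<u}} y<z) zu<1
  ; rounded   = λ {y} (u , 0<u , u∉x , yu<1) →
                  let (z , yu<z , z<1) = <-dense yu<1
                      instance u≠0 = ℚ.>-nonZero 0<u
                      z/u*u≃z = ℚ.≃-trans (ℚ.*-assoc z (ℚ.1/ u) u)
                                  (ℚ.≃-trans (ℚ.*-congˡ {z} (ℚ.*-inverseˡ u)) (ℚ.*-identityʳ z))
                  in z * ℚ.1/ u
                     , ℚ.*-cancelʳ-<-nonNeg u {{ℚ.nonNegative (<⇒≤ 0<u)}}
                         (<-≤-trans yu<z (ℚ.≤-reflexive (ℚ.≃-sym z/u*u≃z)))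
                     , u , 0<u , u∉x , ≤-<-trans (ℚ.≤-reflexive z/u*u≃z) z<1
  }
  where
  0<1 : 0ℚᵘ < 1ℚᵘ
  0<1 = *<* (ℤ.+<+ (ℕ.s≤s ℕ.z≤n))

  0≤p₀ : 0ℚᵘ ≤ p₀
  0≤p₀ = ℚ.≮⇒≥ p₀≮0

  p = let (q , _) = rounded x p₀∈x in q

  p∈x : p ∈ x
  p∈x = let (_ , _ , q∈x) = rounded x p₀∈x in q∈x

  0<p : 0ℚᵘ < p
  0<p = let (_ , p₀<q , _) = rounded x p₀∈x in ≤-<-trans 0≤p₀ p₀<q

  p≠0 : ℚ.NonZero p
  p≠0 = ℚ.>-nonZero 0<p

  u<p : ∀ u → ℚ.1/_ p {{p≠0}} * u < 1ℚᵘ → u < p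
  u<p u u/p<1 = ≤-<-trans (ℚ.≤-reflexive (ℚ.≃-sym e)) (<-≤-trans
      (ℚ.*-monoʳ-<-pos p {{ℚ.positive 0<p}} u/p<1) (ℚ.≤-reflexive (ℚ.*-identityʳ p)))
    where
    instance _ = p≠0
    e : p * (ℚ.1/ p * u) ℚ.≃ u
    e = ℚ.≃-trans (ℚ.≃-sym (ℚ.*-assoc p (ℚ.1/ p) u))
          (ℚ.≃-trans (ℚ.*-congʳ (ℚ.*-inverseʳ p)) (ℚ.*-identityˡ u))

open RawSemiringDefs ℚ.+-*-rawSemiring using () renaming (_^_ to _^ℚ_) public

_^ℤ_ : (q : ℕ) .{{_ : NonZero q}} → ℤ → ℚᵘ
q ^ℤ (+ n)    = + (q ℕ.^ n) / 1
q ^ℤ -[1+ n ] = _/_ (+ 1) (q ℕ.^ suc n) {{ℕ.m^n≢0 q (suc n)}}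

private
  1≤q^n : ∀ q .{{_ : NonZero q}} n → 1 ℕ.≤ q ℕ.^ n
  1≤q^n q n = ℕ.>-nonZero⁻¹ (q ℕ.^ n) {{ℕ.m^n≢0 q n}}

  n/1-mono : ∀ {m n} → m ℕ.≤ n → + m / 1 ≤ + n / 1
  n/1-mono m≤n = *≤* (ℤ.*-monoʳ-≤-nonNeg (+ 1) (ℤ.+≤+ m≤n))

  1/m>0 : ∀ m .{{_ : NonZero m}} → ℚ.Positive (+ 1 / m)
  1/m>0 (suc m) = _

  1/m≤1 : ∀ m .{{_ : NonZero m}} → + 1 / m ≤ 1ℚᵘ
  1/m≤1 (suc m) = *≤* (ℤ.*-monoˡ-≤-nonNeg (+ 1) (ℤ.+≤+ (ℕ.s≤s ℕ.z≤n)))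

  archimedean : ∀ u → ∃ λ N → u < + N / 1
  archimedean u = suc (ℤ.∣ ↥ u ∣) , bound u
    where
    bound : ∀ u → u < + suc ℤ.∣ ↥ u ∣ / 1
    bound (ℚ.mkℚᵘ (+ n) b) = *<* (subst (ℤ._< + suc n ℤ.* + suc b) (sym (ℤ.*-identityʳ (+ n)))
      (ℤ.+<+ (ℕ.m≤m*n (suc n) (suc b))))
    bound (ℚ.mkℚᵘ -[1+ n ] b) = *<* ℤ.-<+

  ^ℚ-nonNeg : ∀ {z} → 0ℚᵘ ≤ z → ∀ n → 0ℚᵘ ≤ z ^ℚ n
  ^ℚ-nonNeg 0≤z zero = *≤* (ℤ.+≤+ ℕ.z≤n)
  ^ℚ-nonNeg {z} 0≤z (suc n) = ℚ.nonNegative⁻¹ (z * z ^ℚ n)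
    {{ℚ.nonNeg*nonNeg⇒nonNeg z {{ℚ.nonNegative 0≤z}} (z ^ℚ n) {{ℚ.nonNegative (^ℚ-nonNeg 0≤z n)}}}}

  ^ℚ-mono : ∀ {w z} → 0ℚᵘ ≤ w → w ≤ z → ∀ n → w ^ℚ n ≤ z ^ℚ n
  ^ℚ-mono 0≤w w≤z zero = ℚ.≤-refl
  ^ℚ-mono {w} {z} 0≤w w≤z (suc n) =
    ℚ.*-mono-≤-nonNeg {{ℚ.nonNegative 0≤w}} {{ℚ.nonNegative (^ℚ-nonNeg 0≤w n)}} w≤z (^ℚ-mono 0≤w w≤z n)

  ^ℚ-mono-< : ∀ {w z} → 0ℚᵘ ≤ w → w < z → ∀ n → w ^ℚ suc n < z ^ℚ suc n
  ^ℚ-mono-< {w} {z} 0≤w w<z zero = ℚ.*-monoˡ-<-pos 1ℚᵘ w<z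
  ^ℚ-mono-< {w} {z} 0≤w w<z (suc n) =
    ℚ.*-mono-<-nonNeg {{ℚ.nonNegative 0≤w}} {{ℚ.nonNegative (^ℚ-nonNeg 0≤w (suc n))}} w<z (^ℚ-mono-< 0≤w w<z n)

  fromℕ-^ : ∀ m n → (+ m / 1) ^ℚ n ℚ.≃ + (m ℕ.^ n) / 1
  fromℕ-^ m zero    = ℚ.≃-refl
  fromℕ-^ m (suc n) = ℚ.≃-trans (ℚ.*-congˡ {+ m / 1} (fromℕ-^ m n))
    (*≡* (cong (ℤ._* + 1) (sym (ℤ.pos-* m (m ℕ.^ n)))))

  1^ℚ : ∀ n → 1ℚᵘ ^ℚ n ≤ 1ℚᵘ
  1^ℚ zero = ℚ.≤-refl
  1^ℚ (suc n) = ≤-trans (ℚ.≤-reflexive (ℚ.*-identityˡ (1ℚᵘ ^ℚ n))) (1^ℚ n)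

  ^ℚ-≤ : ∀ {z} → 0ℚᵘ ≤ z → z ≤ 1ℚᵘ → ∀ n → z ^ℚ suc n ≤ z
  ^ℚ-≤ {z} 0≤z z≤1 n = ≤-trans
    (ℚ.*-monoʳ-≤-nonNeg z {{ℚ.nonNegative 0≤z}} (≤-trans (^ℚ-mono 0≤z z≤1 n) (1^ℚ n)))
    (ℚ.≤-reflexive (ℚ.*-identityʳ z))

  -- q^(-n) and 1 give positive rationals z with z ≤ q^(a/b) for negative
  -- and nonnegative a respectively.
  ^-witness : ∀ q .{{_ : NonZero q}} a → ∃ λ z → 0ℚᵘ < z × z ^ℚ (↧ₙ a) ≤ q ^ℤ (↥ a)
  ^-witness q (ℚ.mkℚᵘ (+ n) b) = 1ℚᵘ , *<* (ℤ.+<+ (ℕ.s≤s ℕ.z≤n)) ,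
    ≤-trans (1^ℚ (suc b)) (n/1-mono (1≤q^n q n))
  ^-witness q (ℚ.mkℚᵘ -[1+ n ] b) = q⁻ⁿ , ℚ.positive⁻¹ q⁻ⁿ {{q⁻ⁿ>0}} ,
    ^ℚ-≤ (<⇒≤ (ℚ.positive⁻¹ q⁻ⁿ {{q⁻ⁿ>0}})) q⁻ⁿ≤1 b
    where
    q⁻ⁿ = q ^ℤ -[1+ n ]
    q⁻ⁿ>0 : ℚ.Positive q⁻ⁿ
    q⁻ⁿ>0 = 1/m>0 (q ℕ.^ suc n) {{ℕ.m^n≢0 q (suc n)}}
    q⁻ⁿ≤1 : q⁻ⁿ ≤ 1ℚᵘ
    q⁻ⁿ≤1 = 1/m≤1 (q ℕ.^ suc n) {{ℕ.m^n≢0 q (suc n)}}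

  ^ℤ-bound : ∀ q .{{_ : NonZero q}} a {N} → a < + N / 1 → q ^ℤ (↥ a) ≤ (+ (q ℕ.^ N) / 1) ^ℚ (↧ₙ a)
  ^ℤ-bound q (ℚ.mkℚᵘ a b) {N} (*<* a<N) = ≤-trans (bound a a<N) (ℚ.≤-reflexive (ℚ.≃-sym (ℚ.≃-trans
      (fromℕ-^ (q ℕ.^ N) (suc b)) (ℚ.≃-reflexive (cong (λ k → + k / 1) (ℕ.^-*-assoc q N (suc b)))))))
    where
    bound : ∀ a → a ℤ.* + 1 ℤ.< + N ℤ.* + suc b → q ^ℤ a ≤ + (q ℕ.^ (N ℕ.* suc b)) / 1
    bound (+ n) n<Nb = n/1-mono (ℕ.^-monoʳ-≤ q (ℤ.drop‿+≤+ (ℤ.<⇒≤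
      (subst (+ n ℤ.<_) (sym (ℤ.pos-* N (suc b))) (subst (ℤ._< + N ℤ.* + suc b) (ℤ.*-identityʳ (+ n)) n<Nb)))))
    bound -[1+ n ] _ = ≤-trans (1/m≤1 (q ℕ.^ suc n) {{ℕ.m^n≢0 q (suc n)}}) (n/1-mono (1≤q^n q (N ℕ.* suc b)))

-- For q ≥ 1, q^x is the supremum of q^(a/b) over the rationals a/b < x,
-- and a rational z ≥ 0 satisfies z ≤ q^(a/b) exactly when z^b ≤ q^a.
infixr 8 _^ᴿ_

_^ᴿ_ : (q : ℕ) .{{_ : NonZero q}} → ℝ → ℝ
q ^ᴿ x = record
  { lower     = λ y → ∃ λ a → a ∈ x × ∃ λ z → 0ℚᵘ ≤ z × y < z × z ^ℚ (↧ₙ a) ≤ q ^ℤ (↥ a)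
  ; inhabited = let (a , a∈x) = inhabited x
                    (z , 0<z , z≤q^a) = ^-witness q a
                in 0ℚᵘ , a , a∈x , z , <⇒≤ 0<z , 0<z , z≤q^a
  ; proper    = let (u , u∉x) = proper x
                    (N , u<N) = archimedean u
                in + (q ℕ.^ N) / 1 , λ (a , a∈x , z , _ , q^N<z , z≤q^a) →
                     <-irrefl ℚ.≃-refl (<-≤-trans
                       (^ℚ-mono-< (n/1-mono {0} {q ℕ.^ N} ℕ.z≤n) q^N<z (ℚᵘ.denominator-1 a))
                       (≤-trans z≤q^a (^ℤ-bound q a (<-trans (∈∧∉⇒< x a∈x u∉x) u<N))))
  ; closed    = λ y<y′ (a , a∈x , z , 0≤z , y′<z , z≤q^a) →
                  a , a∈x , z , 0≤z , <-trans y<y′ y′<z , z≤q^a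
  ; rounded   = λ (a , a∈x , z , 0≤z , y<z , z≤q^a) →
                  let (w , y<w , w<z) = <-dense y<z
                  in w , y<w , a , a∈x , z , 0≤z , w<z , z≤q^a
  }

^ᴿ-positive : (q : ℕ) .{{_ : NonZero q}} (x : ℝ) → 0ᴿ <ᴿ q ^ᴿ x
^ᴿ-positive q x = let (a , a∈x) = inhabited x
                      (z , 0<z , z≤q^a) = ^-witness q a
                  in 0ℚᵘ , (a , a∈x , z , <⇒≤ 0<z , 0<z , z≤q^a) , <-irrefl ℚ.≃-refl

------------------------------------------------------------------------
-- Exhaustive enumeration: each element of the type is listed exactly once
-- (for functions, up to pointwise equality).

vectors : {A : Set} → List A → (n : ℕ) → List (Vec A n)
vectors as zero    = [] ∷ []
vectors as (suc n) = cartesianProductWith _∷_ as (vectors as n)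

functions : {q : ℕ} (n : ℕ) → List (Vec (Fin q) n → Fin q)
functions {q} zero    = List.map (λ a _ → a) (allFin q)
functions {q} (suc n) = List.map (λ fs x → lookup fs (head x) (tail x)) (vectors (functions n) q)

∃Vec? : {q : ℕ} (n : ℕ) {P : Pred (Vec (Fin q) n) 0ℓ} → Decidable P → Dec (∃ P)
∃Vec? zero    P? = map′ (λ p → [] , p) (λ { ([] , p) → p }) (P? [])
∃Vec? (suc n) P? = map′ (λ (a , v , p) → a ∷ v , p) (λ { (a ∷ v , p) → a , v , p })
                        (Fin.any? λ a → ∃Vec? n λ v → P? (a ∷ v))

∀Vec? : {q : ℕ} (n : ℕ) {P : Pred (Vec (Fin q) n) 0ℓ} → Decidable P → Dec (∀ v → P v)
∀Vec? zero    P? = map′ (λ { p [] → p }) (λ p → p []) (P? [])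
∀Vec? (suc n) P? = map′ (λ { p (a ∷ v) → p a v }) (λ p a v → p (a ∷ v))
                        (Fin.all? λ a → ∀Vec? n λ v → P? (a ∷ v))

count : {A : Set} {P : Pred A 0ℓ} → Decidable P → List A → ℕ
count P? xs = length (filter P? xs)

-- Probability of P under the uniform distribution on the entries of a
-- nonempty list.  The empty-list value 0 is a convention; it never arises
-- for the codes below, which contain the zero function.
Pr : {A : Set} {P : Pred A 0ℓ} → List A → Decidable P → ℚᵘ
Pr []         P? = 0ℚᵘ
Pr xs@(_ ∷ _) P? = + count P? xs / length xs

------------------------------------------------------------------------
-- Reed–Muller codes over ℤ/q, which is the field with q elements for q prime

module ReedMuller (q : ℕ) .{{_ : NonZero q}} where

  𝔽 : Set
  𝔽 = Fin q

  𝔽-rawSemiring : RawSemiring 0ℓ 0ℓ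
  𝔽-rawSemiring = record
    { Carrier = 𝔽
    ; _≈_     = _≡_
    ; _+_     = λ a b → (toℕ a ℕ.+ toℕ b) mod q
    ; _*_     = λ a b → (toℕ a ℕ.* toℕ b) mod q
    ; 0#      = 0 mod q
    ; 1#      = 1 mod q
    }

  open RawSemiring 𝔽-rawSemiring public using ()
    renaming (_+_ to _+𝔽_; _*_ to _*𝔽_; 0# to 0𝔽; 1# to 1𝔽)
  open RawSemiringDefs 𝔽-rawSemiring public using () renaming (_^_ to _^𝔽_)

  Function : ℕ → Set
  Function n = Vec 𝔽 n → 𝔽

  -- Exponent vectors of the monomials of total degree at most d.
  monomials : (n d : ℕ) → List (Vec ℕ n)
  monomials n d = filter (λ α → Vec.sum α ℕ.≤? d) (vectors (upTo (suc d)) n)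

  -- A polynomial in n variables of total degree at most d, given by the
  -- coefficients of those monomials.
  Polynomial : (n d : ℕ) → Set
  Polynomial n d = Vec 𝔽 (length (monomials n d))

  _^^_ : ∀ {n} → Vec 𝔽 n → Vec ℕ n → 𝔽
  x ^^ α = foldr′ _*𝔽_ 1𝔽 (zipWith _^𝔽_ x α)

  eval : ∀ n d → Polynomial n d → Function n
  eval n d p x = foldr′ _+𝔽_ 0𝔽 (zipWith (λ c α → c *𝔽 (x ^^ α)) p (fromList (monomials n d)))

  _∈𝒫_ : ∀ {n} → Function n → ℕ → Set
  _∈𝒫_ {n} f d = ∃ λ (p : Polynomial n d) → ∀ x → eval n d p x ≡ f x

  _∈𝒫?_ : ∀ {n} (f : Function n) d → Dec (f ∈𝒫 d)
  _∈𝒫?_ {n} f d = ∃Vec? _ λ p → ∀Vec? n λ x → eval n d p x Fin.≟ f x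

  𝒫 : (n d : ℕ) → List (Function n)
  𝒫 n d = filter (_∈𝒫? d) (functions n)

  -- The univariate polynomial h₀ + h₁ t + h₂ t² + ⋯ , by Horner's rule.
  eval₁ : ∀ {m} → Vec 𝔽 m → 𝔽 → 𝔽
  eval₁ h t = foldr′ (λ a s → a +𝔽 (t *𝔽 s)) 0𝔽 h

  distance : ∀ {n} → Function n → Function n → ℕ
  distance {n} f g = count (λ x → ¬? (f x Fin.≟ g x)) (vectors (allFin q) n)

  -- The zero function lies in 𝒫 n d, so starting the minimum from its
  -- distance does not change the value.
  distanceTo𝒫 : ∀ {n} → Function n → ℕ → ℕ
  distanceTo𝒫 {n} f d = min (distance f (λ _ → 0𝔽)) (List.map (distance f) (𝒫 n d))

  _-FarFrom𝒫_ : ∀ {n} → ℕ → ℕ → Function n → Set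
  (Δ -FarFrom𝒫 d) f = Δ ℕ.< distanceTo𝒫 f d

4[q-1]≢0 : ∀ {q} → Prime q → NonZero (4 ℕ.* (q ℕ.∸ 1))
4[q-1]≢0 {q} q-prime = ℕ.m*n≢0 4 (q ℕ.∸ 1) {{_}} {{q-1≢0 q (prime⇒nonTrivial q-prime)}}
  where
  q-1≢0 : ∀ q → ℕ.NonTrivial q → NonZero (q ℕ.∸ 1)
  q-1≢0 (suc (suc _)) _ = _

{-# OPTIONS --safe #-}
module Submission where

-- Write L(R) = Σₓ f(x) R(x).  Then f has degree ≤ d iff L vanishes in degree
-- < r, and f·h(P) has degree ≤ d + ek iff L(h(P) R) = 0 for deg R < r − ek.
--
-- Suppose first that, modulo polynomials R with L(R S) = 0 for all S of degree
-- ≤ m, some monomial μ of a small degree i is not a combination of monomials of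
-- lower degree or of equal degree and lower order.  Then no polynomial with
-- leading monomial μ is null.  Choosing k families of 2^v monomials such that
-- every product of k of them divides μ, every product of nonzero combinations
-- of the families is non-null.  Taking k finite differences of P ↦ f·h(P) along
-- these directions, Cauchy–Schwarz bounds Pr^(2^k) by O(q^(−2^v)).
--
-- Otherwise multiplication by the variables acts on the polynomials of degree
-- < i modulo null ones; since xᵠ = x the joint eigenspaces give a finite set Z
-- of points, weights w and polynomials dual to evaluation on Z, with
-- L(R) = Σ_{z ∈ Z} w(z) R(z) in degree about r/2.
-- If Z is large, f·h(P) can have low degree only if h ∘ P vanishes on Z, while
-- P is uniformly distributed on Z.  If Z is small, f − w is not of degree ≤ d by
-- the distance hypothesis, so some minimal monomial μ pairs nontrivially with
-- it, and the first argument applies with directions vanishing on Z; these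
-- exist by the pigeonhole principle.

open import Defs
open import Algebra.Bundles using (CommutativeSemiring)
import Algebra.Definitions.RawSemiring as RawSemiringDefinitions
import Algebra.Solver.Ring.NaturalCoefficients.Default as SemiringSolver
open import Algebra.Structures using (IsCommutativeSemiring)
open import Data.Bool.Base using (if_then_else_)
open import Data.Empty using (⊥)
open import Data.Fin.Base as Fin using (Fin; zero; suc; toℕ)
import Data.Fin.Properties as Fin
open import Data.Integer.Base as ℤ using (ℤ; +_; -[1+_])
import Data.Integer.Properties as ℤ
open import Data.List.Base as List using (List; []; _∷_; _++_; length; filter; upTo; allFin; cartesianProductWith)
open import Data.List.Extrema.Nat using (min≤v⁺)
open import Data.List.Membership.Propositional using () renaming (_∈_ to _∈ₗ_)
open import Data.List.Membership.Propositional.Properties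
  using (∈-filter⁺; ∈-filter⁻; ∈-cartesianProductWith⁺; ∈-cartesianProductWith⁻; ∈-upTo⁺; ∈-allFin; ∈-map⁺; ∈-map⁻; ∈-lookup)
import Data.List.Properties as List
open import Data.List.Relation.Unary.All as All using (All; []; _∷_)
import Data.List.Relation.Unary.All.Properties as All
open import Data.List.Relation.Unary.Any as Any using (Any; here; there)
open import Data.List.Relation.Unary.Unique.Propositional using (Unique; []; _∷_)
import Data.List.Relation.Unary.Unique.Propositional.Properties as Unique
open import Data.Nat.Base using (ℕ; zero; suc; _⊓_; NonZero; nonTrivial⇒n>1; _+_; _∸_; _*_; _^_; _≤_; _<_; z≤n; s≤s; s<s⁻¹; s≤s⁻¹; >-nonZero; >-nonZero⁻¹; ≢-nonZero⁻¹)
import Data.Nat.Coprimality as Coprime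
open import Data.Nat.DivMod using (_mod_; _%_; _div_; m≡m%n+[m/n]*n; m/n*n≤m; m%n<n; %-distribˡ-+; %-distribˡ-*; m<n⇒m%n≡m; n%n≡0; [m+kn]%n≡m%n)
open import Data.Nat.GCD using (module Bézout)
open import Data.Nat.Induction using (<-rec)
open import Data.Nat.Primality using (Prime; ¬prime[0]; prime⇒nonTrivial)
open import Data.Nat.Properties as ℕ
  using ( m*n≢0; m^n≢0; ≤-trans; ≤-reflexive; ≤-refl; ≤-<-trans; <-≤-trans; <-trans; n≤1+n; n<1+n; m≤m+n; m≤n+m; m≤m*n; m≤n*m; *-monoʳ-≤; *-monoˡ-≤
        ; *-mono-≤; +-mono-≤; +-monoˡ-≤; +-monoʳ-≤; <⇒≤; ^-monoˡ-≤; ^-monoʳ-≤; ^-*-assoc; ^-distribˡ-+-*; ≰⇒>; ≮⇒≥; <⇒≱)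
open import Data.Nat.Solver using (module +-*-Solver)
open import Data.Product.Base using (∃; _×_; _,_; proj₁; proj₂)
open import Data.Rational.Unnormalised.Base as ℚ using (ℚᵘ; 0ℚᵘ; 1ℚᵘ; _/_)
import Data.Rational.Unnormalised.Properties as ℚ
open import Data.Sum.Base using (_⊎_; inj₁; inj₂)
open import Data.Unit.Base using (tt)
open import Data.Vec.Base as Vec using (Vec; []; _∷_; last; lookup; head; tail; fromList)
import Data.Vec.Properties as Vec
open import Function.Base using (_∘_; id)
open import Level using (0ℓ)
open import Relation.Binary.Definitions using (tri<; tri≈; tri>)
open import Relation.Binary.PropositionalEquality
  using (_≡_; _≢_; _≗_; refl; sym; trans; cong; cong₂; subst; subst₂; isEquivalence; module ≡-Reasoning)
open import Relation.Nullary using (¬_; Dec; yes; no; does; contradiction; ¬?)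
open import Relation.Nullary.Decidable using (decidable-stable; map′; dec-false)
open import Relation.Unary using (Pred; Decidable)

-- A k-fold difference of `P ↦ f·h(P)` no longer depends on `P`: it is k! times `last h` times f
-- times the product of the k directions, and k < q makes k! invertible. So it is enough that this
-- one function has degree above d + ek for all directions in use, and a single test function
-- pairing nontrivially with it shows that. Each difference costs one squaring, whence the exponent
-- 2^k.
--
-- The directions have degree v in the first argument and e in the last. A monomial that resists
-- reduction has the small degree kv + v(q - 1). The monomial found when Z is small may have any
-- degree below r, and only k directions of full degree e make up for the ek by which the target
-- degree exceeds d. The spare v(q - 1) is the price of a family of 2^v divisors: each variable in
-- which a choice is made gives up at most q - 1.
--
-- Z counts as small below half of 2^v, so that prescribing values on Z leaves at least half of the
-- coefficients of a family free.
--
-- Reducibility is never decided. It is derived, doubly negated, from the negation of the goal,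
-- which is a decidable inequality of natural numbers.

^-distribʳ-* : ∀ a b k → (a * b) ^ k ≡ a ^ k * b ^ k
^-distribʳ-* a b zero    = refl
^-distribʳ-* a b (suc k) = trans (cong (a * b *_) (^-distribʳ-* a b k)) (ℕ.[m*n]*[o*p]≡[m*o]*[n*p] a b (a ^ k) (b ^ k))

_≟ᵛ_ : ∀ {q n} (u v : Vec (Fin q) n) → Dec (u ≡ v)
_≟ᵛ_ = Vec.≡-dec Fin._≟_

_≗?_ : ∀ {q n} (f g : Vec (Fin q) n → Fin q) → Dec (f ≗ g)
_≗?_ {n = n} f g = ∀Vec? n λ x → f x Fin.≟ g x

-- Finite sums and products over a semiring, used both in the field and for counting.

module Sums (S : CommutativeSemiring 0ℓ 0ℓ) where

  open CommutativeSemiring S renaming (Carrier to C; _+_ to _⊕_; _*_ to _⊗_; refl to ≈-refl; sym to ≈-sym; trans to ≈-trans; zero to ⊗-zero)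
  open import Relation.Binary.Reasoning.Setoid setoid

  private variable A B : Set

  ∑ : List A → (A → C) → C
  ∑ []       φ = 0#
  ∑ (x ∷ xs) φ = φ x ⊕ ∑ xs φ

  ∏ : ∀ n → (Fin n → C) → C
  ∏ zero    φ = 1#
  ∏ (suc n) φ = φ zero ⊗ ∏ n (φ ∘ suc)

  ⟦_⟧ : {P : Set} → Dec P → C
  ⟦ d ⟧ = if does d then 1# else 0#

  ⟦⟧-cong : {P Q : Set} {d : Dec P} {d′ : Dec Q} → (P → Q) → (Q → P) → ⟦ d ⟧ ≈ ⟦ d′ ⟧
  ⟦⟧-cong {d = yes _} {yes _} f g = ≈-refl
  ⟦⟧-cong {d = yes p} {no ¬q} f g = contradiction (f p) ¬q
  ⟦⟧-cong {d = no ¬p} {yes q} f g = contradiction (g q) ¬p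
  ⟦⟧-cong {d = no _}  {no _}  f g = ≈-refl

  ⟦⟧-*-cong : {P : Set} (d : Dec P) {a b : C} → (P → a ≈ b) → ⟦ d ⟧ ⊗ a ≈ ⟦ d ⟧ ⊗ b
  ⟦⟧-*-cong (yes p) a≈b = *-congˡ (a≈b p)
  ⟦⟧-*-cong (no _)  a≈b = ≈-trans (zeroˡ _) (≈-sym (zeroˡ _))

  ⟦⟧-* : {P Q R : Set} (d : Dec P) (d₁ : Dec Q) (d₂ : Dec R) →
         (P → Q × R) → (Q → R → P) → ⟦ d ⟧ ≈ ⟦ d₁ ⟧ ⊗ ⟦ d₂ ⟧
  ⟦⟧-* d (yes q) (yes r) f g = ≈-trans (⟦⟧-cong {d = d} {d′ = yes q} (λ _ → q) (λ _ → g q r)) (≈-sym (*-identityˡ _))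
  ⟦⟧-* d (yes q) (no ¬r) f g = ≈-trans (⟦⟧-cong {d = d} {d′ = no ¬r} (proj₂ ∘ f) (λ r → g q r)) (≈-sym (zeroʳ _))
  ⟦⟧-* d (no ¬q) d₂      f g = ≈-trans (⟦⟧-cong {d = d} {d′ = no ¬q} (proj₁ ∘ f) (λ q → contradiction q ¬q)) (≈-sym (zeroˡ _))

  ∑-cong : ∀ (xs : List A) {φ ψ} → (∀ x → φ x ≈ ψ x) → ∑ xs φ ≈ ∑ xs ψ
  ∑-cong []       φ≈ψ = ≈-refl
  ∑-cong (x ∷ xs) φ≈ψ = +-cong (φ≈ψ x) (∑-cong xs φ≈ψ)

  ∏-cong : ∀ n {φ ψ : Fin n → C} → (∀ i → φ i ≈ ψ i) → ∏ n φ ≈ ∏ n ψ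
  ∏-cong zero    φ≈ψ = ≈-refl
  ∏-cong (suc n) φ≈ψ = *-cong (φ≈ψ zero) (∏-cong n (φ≈ψ ∘ suc))

  ∏-1 : ∀ n {φ : Fin n → C} → (∀ i → φ i ≈ 1#) → ∏ n φ ≈ 1#
  ∏-1 zero    φ≈1 = ≈-refl
  ∏-1 (suc n) φ≈1 = ≈-trans (*-cong (φ≈1 zero) (∏-1 n (φ≈1 ∘ suc))) (*-identityˡ 1#)

  ∏-0 : ∀ n {φ : Fin n → C} i → φ i ≈ 0# → ∏ n φ ≈ 0#
  ∏-0 (suc n) zero    φ≈0 = ≈-trans (*-congʳ φ≈0) (zeroˡ _)
  ∏-0 (suc n) (suc i) φ≈0 = ≈-trans (*-congˡ (∏-0 n i φ≈0)) (zeroʳ _)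

  ∑-0 : ∀ (xs : List A) {φ} → (∀ x → φ x ≈ 0#) → ∑ xs φ ≈ 0#
  ∑-0 []       φ≈0 = ≈-refl
  ∑-0 (x ∷ xs) φ≈0 = ≈-trans (+-cong (φ≈0 x) (∑-0 xs φ≈0)) (+-identityˡ 0#)

  interchange : ∀ a b c d → (a ⊕ b) ⊕ (c ⊕ d) ≈ (a ⊕ c) ⊕ (b ⊕ d)
  interchange a b c d = begin
    (a ⊕ b) ⊕ (c ⊕ d) ≈⟨ +-assoc a b (c ⊕ d) ⟩
    a ⊕ (b ⊕ (c ⊕ d)) ≈⟨ +-congˡ (≈-trans (≈-sym (+-assoc b c d)) (≈-trans (+-congʳ (+-comm b c)) (+-assoc c b d))) ⟩
    a ⊕ (c ⊕ (b ⊕ d)) ≈⟨ +-assoc a c (b ⊕ d) ⟨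
    (a ⊕ c) ⊕ (b ⊕ d) ∎

  ∑-+ : ∀ (xs : List A) {φ ψ} → ∑ xs (λ x → φ x ⊕ ψ x) ≈ ∑ xs φ ⊕ ∑ xs ψ
  ∑-+ []       = ≈-sym (+-identityˡ 0#)
  ∑-+ (x ∷ xs) = ≈-trans (+-congˡ (∑-+ xs)) (interchange _ _ _ _)

  ∑-*ˡ : ∀ (xs : List A) c {φ} → ∑ xs (λ x → c ⊗ φ x) ≈ c ⊗ ∑ xs φ
  ∑-*ˡ []       c = ≈-sym (zeroʳ c)
  ∑-*ˡ (x ∷ xs) c = ≈-trans (+-congˡ (∑-*ˡ xs c)) (≈-sym (distribˡ c _ _))

  ∑-*ʳ : ∀ (xs : List A) c {φ} → ∑ xs (λ x → φ x ⊗ c) ≈ ∑ xs φ ⊗ c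
  ∑-*ʳ []       c = ≈-sym (zeroˡ c)
  ∑-*ʳ (x ∷ xs) c = ≈-trans (+-congˡ (∑-*ʳ xs c)) (≈-sym (distribʳ c _ _))

  ∑-swap : ∀ (xs : List A) (ys : List B) {φ : A → B → C} →
           ∑ xs (λ x → ∑ ys (φ x)) ≈ ∑ ys (λ y → ∑ xs (λ x → φ x y))
  ∑-swap []       ys = ≈-sym (∑-0 ys (λ _ → ≈-refl))
  ∑-swap (x ∷ xs) ys = ≈-trans (+-congˡ (∑-swap xs ys)) (≈-sym (∑-+ ys))

  ∑-++ : ∀ (xs ys : List A) {φ} → ∑ (xs ++ ys) φ ≈ ∑ xs φ ⊕ ∑ ys φ
  ∑-++ []       ys = ≈-sym (+-identityˡ _)
  ∑-++ (x ∷ xs) ys = ≈-trans (+-congˡ (∑-++ xs ys)) (≈-sym (+-assoc _ _ _))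

  ∑-map : ∀ (g : A → B) xs {φ} → ∑ (List.map g xs) φ ≈ ∑ xs (φ ∘ g)
  ∑-map g []       = ≈-refl
  ∑-map g (x ∷ xs) = +-congˡ (∑-map g xs)

  ∑-filter : {P : Pred A 0ℓ} (P? : Decidable P) → ∀ xs {φ} → ∑ (filter P? xs) φ ≈ ∑ xs (λ x → ⟦ P? x ⟧ ⊗ φ x)
  ∑-filter P? []       = ≈-refl
  ∑-filter P? (x ∷ xs) with P? x
  ... | yes _ = +-cong (≈-sym (*-identityˡ _)) (∑-filter P? xs)
  ... | no  _ = ≈-trans (∑-filter P? xs) (≈-sym (≈-trans (+-congʳ (zeroˡ _)) (+-identityˡ _)))

  ∑-cartesianProductWith : ∀ {D : Set} (g : A → B → D) xs ys {φ} →
    ∑ (cartesianProductWith g xs ys) φ ≈ ∑ xs (λ x → ∑ ys (λ y → φ (g x y)))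
  ∑-cartesianProductWith g []       ys = ≈-refl
  ∑-cartesianProductWith g (x ∷ xs) ys = ≈-trans (∑-++ (List.map (g x) ys) _)
    (+-cong (∑-map (g x) ys) (∑-cartesianProductWith g xs ys))

  -- Expanding a product of sums picks one entry of `as` for each index, and `vectors as n` lists
  -- these choices.
  ∑-vectors-∏ : ∀ (as : List A) n (φ : Fin n → A → C) →
    ∑ (vectors as n) (λ v → ∏ n (λ j → φ j (lookup v j))) ≈ ∏ n (λ j → ∑ as (φ j))
  ∑-vectors-∏ as zero    φ = +-identityʳ 1#
  ∑-vectors-∏ as (suc n) φ = begin
    ∑ (vectors as (suc n)) (λ v → ∏ (suc n) (λ j → φ j (lookup v j)))
      ≈⟨ ∑-cartesianProductWith _∷_ as (vectors as n) ⟩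
    ∑ as (λ a → ∑ (vectors as n) (λ v → φ zero a ⊗ ∏ n (λ j → φ (suc j) (lookup v j))))
      ≈⟨ ∑-cong as (λ a → ≈-trans (∑-*ˡ (vectors as n) (φ zero a)) (*-congˡ (∑-vectors-∏ as n (φ ∘ suc)))) ⟩
    ∑ as (λ a → φ zero a ⊗ ∏ n (λ j → ∑ as (φ (suc j))))
      ≈⟨ ∑-*ʳ as _ ⟩
    ∑ as (φ zero) ⊗ ∏ n (λ j → ∑ as (φ (suc j))) ∎

  ∑-allFin-suc : ∀ n {φ : Fin (suc n) → C} → ∑ (allFin (suc n)) φ ≈ φ zero ⊕ ∑ (allFin n) (φ ∘ suc)
  ∑-allFin-suc n {φ} = +-congˡ (≈-trans (reflexive (cong (λ xs → ∑ xs φ) (sym (List.map-tabulate {n = n} id suc))))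
                                        (∑-map suc (allFin n)))

  ∑-allFin-δ : ∀ {n} (b : Fin n) (φ : Fin n → C) → ∑ (allFin n) (λ a → ⟦ a Fin.≟ b ⟧ ⊗ φ a) ≈ φ b
  ∑-allFin-δ {suc n} zero φ = begin
    ∑ (allFin (suc n)) (λ a → ⟦ a Fin.≟ zero ⟧ ⊗ φ a)   ≈⟨ ∑-allFin-suc n ⟩
    1# ⊗ φ zero ⊕ ∑ (allFin n) (λ a → 0# ⊗ φ (suc a))  ≈⟨ +-cong (*-identityˡ _) (∑-0 (allFin n) (λ a → zeroˡ _)) ⟩
    φ zero ⊕ 0#                                          ≈⟨ +-identityʳ _ ⟩
    φ zero                                               ∎
  ∑-allFin-δ {suc n} (suc b) φ = begin
    ∑ (allFin (suc n)) (λ a → ⟦ a Fin.≟ suc b ⟧ ⊗ φ a)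
      ≈⟨ ∑-allFin-suc n ⟩
    0# ⊗ φ zero ⊕ ∑ (allFin n) (λ a → ⟦ suc a Fin.≟ suc b ⟧ ⊗ φ (suc a))
      ≈⟨ +-cong (zeroˡ _) (∑-cong (allFin n) (λ a → *-congʳ
           (⟦⟧-cong {d = suc a Fin.≟ suc b} {d′ = a Fin.≟ b} Fin.suc-injective (cong suc)))) ⟩
    0# ⊕ ∑ (allFin n) (λ a → ⟦ a Fin.≟ b ⟧ ⊗ φ (suc a))
      ≈⟨ ≈-trans (+-identityˡ _) (∑-allFin-δ b (φ ∘ suc)) ⟩
    φ (suc b) ∎

  ∑-vectors-δ : ∀ {q n} (u : Vec (Fin q) n) (φ : Vec (Fin q) n → C) →
                ∑ (vectors (allFin q) n) (λ v → ⟦ v ≟ᵛ u ⟧ ⊗ φ v) ≈ φ u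
  ∑-vectors-δ         []      φ = ≈-trans (+-identityʳ _) (*-identityˡ _)
  ∑-vectors-δ {q} {suc n} (b ∷ u) φ = begin
    ∑ (vectors (allFin q) (suc n)) (λ v → ⟦ v ≟ᵛ (b ∷ u) ⟧ ⊗ φ v)
      ≈⟨ ∑-cartesianProductWith _∷_ (allFin q) (vectors (allFin q) n) ⟩
    ∑ (allFin q) (λ a → ∑ (vectors (allFin q) n) (λ v → ⟦ (a ∷ v) ≟ᵛ (b ∷ u) ⟧ ⊗ φ (a ∷ v)))
      ≈⟨ ∑-cong (allFin q) (λ a → ≈-trans
           (∑-cong (vectors (allFin q) n) λ v → ≈-trans
             (*-congʳ (⟦⟧-* ((a ∷ v) ≟ᵛ (b ∷ u)) (a Fin.≟ b) (v ≟ᵛ u) Vec.∷-injective (cong₂ _∷_)))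
             (*-assoc _ _ _))
           (≈-trans (∑-*ˡ (vectors (allFin q) n) ⟦ a Fin.≟ b ⟧) (*-congˡ (∑-vectors-δ u (φ ∘ (a ∷_)))))) ⟩
    ∑ (allFin q) (λ a → ⟦ a Fin.≟ b ⟧ ⊗ φ (a ∷ u))
      ≈⟨ ∑-allFin-δ b (λ a → φ (a ∷ u)) ⟩
    φ (b ∷ u) ∎

  ⟦⟧-∏ : ∀ n {P : Fin n → Set} {Q : Set} (d : Dec Q) (P? : ∀ i → Dec (P i)) →
         (Q → ∀ i → P i) → ((∀ i → P i) → Q) → ⟦ d ⟧ ≈ ∏ n (λ i → ⟦ P? i ⟧)
  ⟦⟧-∏ zero    d P? f g = ⟦⟧-cong {d = d} {d′ = yes tt} (λ _ → tt) (λ _ → g λ ())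
  ⟦⟧-∏ (suc n) d P? f g = ≈-trans
    (⟦⟧-* d (P? zero) (Fin.all? (P? ∘ suc)) (λ q → f q zero , f q ∘ suc) (λ p ps → g λ { zero → p ; (suc i) → ps i }))
    (*-congˡ (⟦⟧-∏ n (Fin.all? (P? ∘ suc)) (P? ∘ suc) id id))

  -- A function of n + 1 variables is listed as the vector of its q restrictions to a fixed first
  -- coordinate, so the bracket factors over that coordinate.
  ∑-functions-once : ∀ {q} n (f : Vec (Fin q) n → Fin q) → ∑ (functions n) (λ g → ⟦ g ≗? f ⟧) ≈ 1#
  ∑-functions-once {q} zero f = begin
    ∑ (functions 0) (λ g → ⟦ g ≗? f ⟧)
      ≈⟨ ∑-map (λ a _ → a) (allFin q) ⟩
    ∑ (allFin q) (λ a → ⟦ (λ _ → a) ≗? f ⟧)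
      ≈⟨ ∑-cong (allFin q) (λ a → ≈-trans (⟦⟧-cong {d = (λ _ → a) ≗? f} {d′ = a Fin.≟ f []} (λ p → p []) (λ { p [] → p }))
                                          (≈-sym (*-identityʳ _))) ⟩
    ∑ (allFin q) (λ a → ⟦ a Fin.≟ f [] ⟧ ⊗ 1#)
      ≈⟨ ∑-allFin-δ (f []) (λ _ → 1#) ⟩
    1# ∎
  ∑-functions-once {q} (suc n) f = begin
    ∑ (functions (suc n)) (λ g → ⟦ g ≗? f ⟧)
      ≈⟨ ∑-map _ (vectors (functions n) q) ⟩
    ∑ (vectors (functions n) q) (λ v → ⟦ (λ x → lookup v (head x) (tail x)) ≗? f ⟧)
      ≈⟨ ∑-cong (vectors (functions n) q) (λ v → ⟦⟧-∏ q ((λ x → lookup v (head x) (tail x)) ≗? f)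
           (λ a → lookup v a ≗? (λ x → f (a ∷ x))) (λ p a x → p (a ∷ x)) (λ { p (a ∷ x) → p a x })) ⟩
    ∑ (vectors (functions n) q) (λ v → ∏ q (λ a → ⟦ lookup v a ≗? (λ x → f (a ∷ x)) ⟧))
      ≈⟨ ∑-vectors-∏ (functions n) q (λ a g → ⟦ g ≗? (λ x → f (a ∷ x)) ⟧) ⟩
    ∏ q (λ a → ∑ (functions n) (λ g → ⟦ g ≗? (λ x → f (a ∷ x)) ⟧))
      ≈⟨ ∏-1 q (λ a → ∑-functions-once n (λ x → f (a ∷ x))) ⟩
    1# ∎

-- The prime field.

-- The algebra is developed over a variable of this type, so that arithmetic modulo q stays abstract
-- and does not unfold. The field `[m]≢0` makes the factors of k! invertible.
record FiniteField (p : ℕ) : Set where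
  infixl 6 _⊕_
  infixl 7 _⊗_
  field
    _⊕_ _⊗_             : Fin (suc p) → Fin (suc p) → Fin (suc p)
    0# 1# -1#             : Fin (suc p)
    isCommutativeSemiring : IsCommutativeSemiring _≡_ _⊕_ _⊗_ 0# 1#
    1+-1≡0                : 1# ⊕ -1# ≡ 0#
    inverse               : ∀ a → a ≢ 0# → ∃ λ b → b ⊗ a ≡ 1#
    [_]                   : ℕ → Fin (suc p)
    [0]≡0                 : [ 0 ] ≡ 0#
    [suc]                 : ∀ m → [ suc m ] ≡ 1# ⊕ [ m ]
    [m]≢0                 : ∀ {m} → 0 < m → m < suc p → [ m ] ≢ 0#
    1<q                   : 1 < suc p

module PrimeField (p : ℕ) (q-prime : Prime (suc p)) where

  q : ℕ
  q = suc p

  open ReedMuller q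
  open ≡-Reasoning
  open +-*-Solver using (con; _:=_; _:+_; _:*_) renaming (solve to solveℕ)

  private variable n : ℕ

  [_] : ℕ → 𝔽
  [ m ] = m mod q

  toℕ-[] : ∀ m → toℕ [ m ] ≡ m % q
  toℕ-[] m = Fin.toℕ-fromℕ< (m%n<n m q)

  []-cong : ∀ m n → m % q ≡ n % q → [ m ] ≡ [ n ]
  []-cong m n eq = Fin.toℕ-injective (trans (toℕ-[] m) (trans eq (sym (toℕ-[] n))))

  [toℕ] : ∀ a → [ toℕ a ] ≡ a
  [toℕ] a = Fin.toℕ-injective (trans (toℕ-[] (toℕ a)) (m<n⇒m%n≡m (Fin.toℕ<n a)))

  []-+ : ∀ m n → [ m ] +𝔽 [ n ] ≡ [ m + n ]
  []-+ m n = []-cong (toℕ [ m ] + toℕ [ n ]) (m + n)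
    (trans (cong₂ (λ a b → (a + b) % q) (toℕ-[] m) (toℕ-[] n)) (sym (%-distribˡ-+ m n q)))

  []-* : ∀ m n → [ m ] *𝔽 [ n ] ≡ [ m * n ]
  []-* m n = []-cong (toℕ [ m ] * toℕ [ n ]) (m * n)
    (trans (cong₂ (λ a b → (a * b) % q) (toℕ-[] m) (toℕ-[] n)) (sym (%-distribˡ-* m n q)))

  private
    -- `[_]` is a surjective homomorphism from the natural numbers, so associativity is inherited;
    -- one proof serves both operations.
    assoc′ : ∀ {_∙_ : 𝔽 → 𝔽 → 𝔽} {_·_ : ℕ → ℕ → ℕ} → (∀ m n → [ m ] ∙ [ n ] ≡ [ m · n ]) →
             (∀ l m n → (l · m) · n ≡ l · (m · n)) → ∀ a b c → (a ∙ b) ∙ c ≡ a ∙ (b ∙ c)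
    assoc′ {_∙_} {_·_} hom ass a b c = begin
      (a ∙ b) ∙ c  ≡⟨ cong₂ (λ a b → (a ∙ b) ∙ c) ([toℕ] a) ([toℕ] b) ⟨
      ([ toℕ a ] ∙ [ toℕ b ]) ∙ c                  ≡⟨ cong₂ _∙_ (sym (hom _ _)) ([toℕ] c) ⟨
      [ toℕ a · toℕ b ] ∙ [ toℕ c ]                ≡⟨ hom _ _ ⟩
      [ (toℕ a · toℕ b) · toℕ c ]                  ≡⟨ cong [_] (ass _ _ _) ⟩
      [ toℕ a · (toℕ b · toℕ c) ]                  ≡⟨ hom _ _ ⟨
      [ toℕ a ] ∙ [ toℕ b · toℕ c ]                ≡⟨ cong₂ _∙_ ([toℕ] a) (sym (hom _ _)) ⟩
      a ∙ ([ toℕ b ] ∙ [ toℕ c ])  ≡⟨ cong₂ (λ b c → a ∙ (b ∙ c)) ([toℕ] b) ([toℕ] c) ⟩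
      a ∙ (b ∙ c)                                  ∎

  +𝔽-comm : ∀ a b → a +𝔽 b ≡ b +𝔽 a
  +𝔽-comm a b = cong [_] (ℕ.+-comm (toℕ a) (toℕ b))

  *𝔽-comm : ∀ a b → a *𝔽 b ≡ b *𝔽 a
  *𝔽-comm a b = cong [_] (ℕ.*-comm (toℕ a) (toℕ b))

  +𝔽-identityˡ : ∀ a → 0𝔽 +𝔽 a ≡ a
  +𝔽-identityˡ a = [toℕ] a

  *𝔽-identityˡ : ∀ a → 1𝔽 *𝔽 a ≡ a
  *𝔽-identityˡ a = begin
    [ 1 ] *𝔽 a           ≡⟨ cong ([ 1 ] *𝔽_) ([toℕ] a) ⟨
    [ 1 ] *𝔽 [ toℕ a ]   ≡⟨ []-* 1 (toℕ a) ⟩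
    [ 1 * toℕ a ]        ≡⟨ cong [_] (ℕ.*-identityˡ (toℕ a)) ⟩
    [ toℕ a ]            ≡⟨ [toℕ] a ⟩
    a                    ∎

  *𝔽-zeroˡ : ∀ a → 0𝔽 *𝔽 a ≡ 0𝔽
  *𝔽-zeroˡ a = refl

  *𝔽-distribʳ : ∀ c a b → (a +𝔽 b) *𝔽 c ≡ a *𝔽 c +𝔽 b *𝔽 c
  *𝔽-distribʳ c a b = begin
    (a +𝔽 b) *𝔽 c                                  ≡⟨ cong ([ toℕ a + toℕ b ] *𝔽_) ([toℕ] c) ⟨
    [ toℕ a + toℕ b ] *𝔽 [ toℕ c ]                 ≡⟨ []-* (toℕ a + toℕ b) (toℕ c) ⟩
    [ (toℕ a + toℕ b) * toℕ c ]  ≡⟨ cong [_] (ℕ.*-distribʳ-+ (toℕ c) (toℕ a) (toℕ b)) ⟩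
    [ toℕ a * toℕ c + toℕ b * toℕ c ]              ≡⟨ []-+ (toℕ a * toℕ c) (toℕ b * toℕ c) ⟨
    a *𝔽 c +𝔽 b *𝔽 c                               ∎

  𝔽-isCommutativeSemiring : IsCommutativeSemiring _≡_ _+𝔽_ _*𝔽_ 0𝔽 1𝔽
  𝔽-isCommutativeSemiring = record
    { isSemiring = record
      { isSemiringWithoutAnnihilatingZero = record
        { +-isCommutativeMonoid = record
          { isMonoid = record
            { isSemigroup = record
              { isMagma = record { isEquivalence = isEquivalence ; ∙-cong = cong₂ _+𝔽_ }
              ; assoc = assoc′ {_+𝔽_} {_+_} []-+ ℕ.+-assoc }
            ; identity = +𝔽-identityˡ , λ a → trans (+𝔽-comm a 0𝔽) (+𝔽-identityˡ a) }
          ; comm = +𝔽-comm }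
        ; *-cong = cong₂ _*𝔽_
        ; *-assoc = assoc′ {_*𝔽_} {_*_} []-* ℕ.*-assoc
        ; *-identity = *𝔽-identityˡ , λ a → trans (*𝔽-comm a 1𝔽) (*𝔽-identityˡ a)
        ; distrib = (λ c a b → trans (*𝔽-comm c _) (trans (*𝔽-distribʳ c a b) (cong₂ _+𝔽_ (*𝔽-comm a c) (*𝔽-comm b c))))
                  , *𝔽-distribʳ }
      ; zero = *𝔽-zeroˡ , λ a → trans (*𝔽-comm a 0𝔽) (*𝔽-zeroˡ a) }
    ; *-comm = *𝔽-comm }

  -1𝔽 : 𝔽
  -1𝔽 = [ p ]

  1+-1≡0 : 1𝔽 +𝔽 -1𝔽 ≡ 0𝔽
  1+-1≡0 = trans ([]-+ 1 p) ([]-cong q 0 (n%n≡0 q))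

  [m]≢0 : ∀ {m} → 0 < m → m < q → [ m ] ≢ 0𝔽
  [m]≢0 {m} 0<m m<q eq = ℕ.<⇒≢ 0<m (sym (trans (sym (m<n⇒m%n≡m m<q)) (trans (sym (toℕ-[] m)) (cong toℕ eq))))

  1<q : 1 < q
  1<q = nonTrivial⇒n>1 q {{prime⇒nonTrivial q-prime}}

  private
    [m+kq] : ∀ m k → [ m + k * q ] ≡ [ m ]
    [m+kq] m k = []-cong (m + k * q) m ([m+kn]%n≡m%n m k q)

    [y]*a : ∀ y {a} → [ y ] *𝔽 a ≡ [ y * toℕ a ]
    [y]*a y {a} = trans (cong ([ y ] *𝔽_) (sym ([toℕ] a))) ([]-* y (toℕ a))

  inverse : ∀ a → a ≢ 0𝔽 → ∃ λ b → b *𝔽 a ≡ 1𝔽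
  inverse zero    a≢0 = contradiction refl a≢0
  inverse a@(suc a′) a≢0 with Coprime.coprime-Bézout (Coprime.prime⇒coprime q-prime (Fin.toℕ<n a))
  -- Here 1 + ya = xq, so ya is -1 and the inverse is -y.
  ... | Bézout.+- x y eq = -1𝔽 *𝔽 [ y ] , (begin
    -1𝔽 *𝔽 [ y ] *𝔽 a              ≡⟨ assoc′ {_*𝔽_} {_*_} []-* ℕ.*-assoc -1𝔽 [ y ] a ⟩
    -1𝔽 *𝔽 ([ y ] *𝔽 a)            ≡⟨ cong (-1𝔽 *𝔽_) ([y]*a y) ⟩
    -1𝔽 *𝔽 [ y * toℕ a ]           ≡⟨ []-* p (y * toℕ a) ⟩
    -- Adding q once turns p·ya into 1 + p(1 + ya), without subtraction.
    [ p * (y * toℕ a) ]            ≡⟨ sym ([m+kq] (p * (y * toℕ a)) 1) ⟩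
    [ p * (y * toℕ a) + 1 * q ]  ≡⟨ cong [_] (solveℕ 2 (λ p y → p :* y :+ con 1 :* (con 1 :+ p) := con 1 :+ p :* (con 1 :+ y)) refl p (y * toℕ a)) ⟩
    [ 1 + p * (1 + y * toℕ a) ]    ≡⟨ cong (λ z → [ 1 + p * z ]) eq ⟩
    [ 1 + p * (x * q) ]            ≡⟨ cong (λ z → [ 1 + z ]) (ℕ.*-assoc p x q) ⟨
    [ 1 + p * x * q ]              ≡⟨ [m+kq] 1 (p * x) ⟩
    1𝔽                             ∎)
  ... | Bézout.-+ x y eq = [ y ] , (begin
    [ y ] *𝔽 a             ≡⟨ [y]*a y ⟩
    [ y * toℕ a ]          ≡⟨ cong [_] eq ⟨
    [ 1 + x * q ]          ≡⟨ [m+kq] 1 x ⟩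
    1𝔽                     ∎)

  field-structure : FiniteField p
  field-structure = record
    { _⊕_ = _+𝔽_ ; _⊗_ = _*𝔽_ ; 0# = 0𝔽 ; 1# = 1𝔽 ; -1# = -1𝔽
    ; isCommutativeSemiring = 𝔽-isCommutativeSemiring
    ; 1+-1≡0 = 1+-1≡0
    ; inverse = inverse
    ; [_] = [_]
    ; [0]≡0 = refl
    ; [suc] = λ m → sym ([]-+ 1 m)
    ; [m]≢0 = [m]≢0
    ; 1<q = 1<q
    }

-- Univariate polynomials: differences, vanishing and power sums.

module FieldTheory {p : ℕ} (K : FiniteField p) where

  open FiniteField K
  open ≡-Reasoning

  q : ℕ
  q = suc p

  𝔽 : Set
  𝔽 = Fin q

  𝔽-commutativeSemiring : CommutativeSemiring 0ℓ 0ℓ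
  𝔽-commutativeSemiring = record { isCommutativeSemiring = isCommutativeSemiring }

  open RawSemiringDefinitions (CommutativeSemiring.rawSemiring 𝔽-commutativeSemiring) public using () renaming (_^_ to _^𝔽_)

  eval₁ : ∀ {m} → Vec 𝔽 m → 𝔽 → 𝔽
  eval₁ h t = Vec.foldr′ (λ a s → a ⊕ (t ⊗ s)) 0# h

  [1]≡1 : [ 1 ] ≡ 1#
  [1]≡1 = trans ([suc] 0) (trans (cong (1# ⊕_) [0]≡0) (CommutativeSemiring.+-identityʳ 𝔽-commutativeSemiring 1#))

  1≢0 : 1# ≢ 0#
  1≢0 eq = [m]≢0 (s≤s z≤n) 1<q (trans [1]≡1 eq)

  open CommutativeSemiring 𝔽-commutativeSemiring public
    using ()
    renaming ( +-assoc to ⊕-assoc; +-comm to ⊕-comm; +-identityˡ to ⊕-identityˡ; *-comm to ⊗-comm; *-identityˡ to ⊗-identityˡ; zeroˡ to ⊗-zeroˡ; distribʳ to ⊗-distribʳ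
             ; *-assoc to ⊗-assoc; +-identityʳ to ⊕-identityʳ; *-identityʳ to ⊗-identityʳ
             ; zeroʳ to ⊗-zeroʳ; distribˡ to ⊗-distribˡ )

  module 𝔽-Solver = SemiringSolver 𝔽-commutativeSemiring
  open 𝔽-Solver using (solve; _:=_; _:+_; _:*_)

  module ∑𝔽 = Sums 𝔽-commutativeSemiring

  infixl 6 _⊖_
  _⊖_ : 𝔽 → 𝔽 → 𝔽
  a ⊖ b = a ⊕ -1# ⊗ b

  a-a≡0 : ∀ a → a ⊖ a ≡ 0#
  a-a≡0 a = begin
    a ⊕ -1# ⊗ a         ≡⟨ cong (_⊕ -1# ⊗ a) (⊗-identityˡ a) ⟨
    1# ⊗ a ⊕ -1# ⊗ a   ≡⟨ ⊗-distribʳ a 1# -1# ⟨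
    (1# ⊕ -1#) ⊗ a      ≡⟨ cong (_⊗ a) 1+-1≡0 ⟩
    0# ⊗ a               ≡⟨ ⊗-zeroˡ a ⟩
    0#                    ∎

  [a+b]-b≡a : ∀ a b → (a ⊕ b) ⊖ b ≡ a
  [a+b]-b≡a a b = trans (⊕-assoc a b _) (trans (cong (a ⊕_) (a-a≡0 b)) (⊕-identityʳ a))

  [a-b]+b≡a : ∀ a b → (a ⊖ b) ⊕ b ≡ a
  [a-b]+b≡a a b = begin
    (a ⊕ -1# ⊗ b) ⊕ b  ≡⟨ solve 3 (λ a b c → (a :+ c) :+ b := a :+ (b :+ c)) refl a b (-1# ⊗ b) ⟩
    a ⊕ (b ⊕ -1# ⊗ b)   ≡⟨ cong (a ⊕_) (a-a≡0 b) ⟩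
    a ⊕ 0#                ≡⟨ ⊕-identityʳ a ⟩
    a                      ∎

  a-b≡0⇒a≡b : ∀ a b → a ⊖ b ≡ 0# → a ≡ b
  a-b≡0⇒a≡b a b eq = trans (sym ([a-b]+b≡a a b)) (trans (cong (_⊕ b) eq) (⊕-identityˡ b))

  ⊕-cancelʳ : ∀ a b c → a ⊕ c ≡ b ⊕ c → a ≡ b
  ⊕-cancelʳ a b c eq = trans (sym ([a+b]-b≡a a c)) (trans (cong (_⊖ c) eq) ([a+b]-b≡a b c))

  ⊗-cancelˡ : ∀ a {b c} → a ≢ 0# → a ⊗ b ≡ a ⊗ c → b ≡ c
  ⊗-cancelˡ a {b} {c} a≢0 eq with a⁻¹ , inv ← inverse a a≢0 = begin
    b                   ≡⟨ ⊗-identityˡ b ⟨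
    1# ⊗ b             ≡⟨ cong (_⊗ b) inv ⟨
    a⁻¹ ⊗ a ⊗ b  ≡⟨ trans (⊗-assoc a⁻¹ a b) (trans (cong (a⁻¹ ⊗_) eq) (sym (⊗-assoc a⁻¹ a c))) ⟩
    a⁻¹ ⊗ a ⊗ c       ≡⟨ cong (_⊗ c) inv ⟩
    1# ⊗ c             ≡⟨ ⊗-identityˡ c ⟩
    c                   ∎

  ab≡0⇒b≡0 : ∀ a {b} → a ≢ 0# → a ⊗ b ≡ 0# → b ≡ 0#
  ab≡0⇒b≡0 a a≢0 eq = ⊗-cancelˡ a a≢0 (trans eq (sym (⊗-zeroʳ a)))

  ⊗-≢0 : ∀ {a b} → a ≢ 0# → b ≢ 0# → a ⊗ b ≢ 0#
  ⊗-≢0 {a} a≢0 b≢0 = b≢0 ∘ ab≡0⇒b≡0 a a≢0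

  ∏-≢0 : ∀ m {φ : Fin m → 𝔽} → (∀ i → φ i ≢ 0#) → ∑𝔽.∏ m φ ≢ 0#
  ∏-≢0 zero    φ≢0 = 1≢0
  ∏-≢0 (suc m) φ≢0 = ⊗-≢0 (φ≢0 zero) (∏-≢0 m (φ≢0 ∘ suc))

  -- The coefficients of h(t + u) − h(t) as a polynomial in t.
  diff : ∀ {m} → Vec 𝔽 (suc m) → 𝔽 → Vec 𝔽 m
  diff {zero}  _       u = []
  diff {suc m} (_ ∷ g) u = Vec.zipWith _⊕_ (0# ∷ diff g u)
    (Vec.map (u ⊗_) (Vec.zipWith _⊕_ g (diff g u Vec.∷ʳ 0#)))

  eval₁-+ : ∀ {m} (g h : Vec 𝔽 m) t → eval₁ (Vec.zipWith _⊕_ g h) t ≡ eval₁ g t ⊕ eval₁ h t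
  eval₁-+ []      []      t = sym (⊕-identityˡ 0#)
  eval₁-+ (a ∷ g) (b ∷ h) t = trans (cong (λ s → a ⊕ b ⊕ t ⊗ s) (eval₁-+ g h t))
    (solve 5 (λ a b t x y → a :+ b :+ t :* (x :+ y) := (a :+ t :* x) :+ (b :+ t :* y)) refl a b t (eval₁ g t) (eval₁ h t))

  eval₁-* : ∀ {m} c (h : Vec 𝔽 m) t → eval₁ (Vec.map (c ⊗_) h) t ≡ c ⊗ eval₁ h t
  eval₁-* c []      t = sym (⊗-zeroʳ c)
  eval₁-* c (a ∷ h) t = trans (cong (λ s → c ⊗ a ⊕ t ⊗ s) (eval₁-* c h t))
    (solve 4 (λ c a t x → c :* a :+ t :* (c :* x) := c :* (a :+ t :* x)) refl c a t (eval₁ h t))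

  eval₁-∷ʳ0 : ∀ {m} (h : Vec 𝔽 m) t → eval₁ (h Vec.∷ʳ 0#) t ≡ eval₁ h t
  eval₁-∷ʳ0 []      t = trans (⊕-identityˡ _) (⊗-zeroʳ t)
  eval₁-∷ʳ0 (a ∷ h) t = cong (λ s → a ⊕ t ⊗ s) (eval₁-∷ʳ0 h t)

  eval₁-diff : ∀ {m} (h : Vec 𝔽 (suc m)) u t → eval₁ h (t ⊕ u) ≡ eval₁ h t ⊕ eval₁ (diff h u) t
  eval₁-diff {zero} (a ∷ []) u t = trans (cong (a ⊕_) (trans (⊗-zeroʳ (t ⊕ u)) (sym (⊗-zeroʳ t)))) (sym (⊕-identityʳ _))
  eval₁-diff {suc m} (a ∷ g) u t = begin
    a ⊕ (t ⊕ u) ⊗ eval₁ g (t ⊕ u)   ≡⟨ cong (λ s → a ⊕ (t ⊕ u) ⊗ s) (eval₁-diff g u t) ⟩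
    a ⊕ (t ⊕ u) ⊗ (G ⊕ D)           ≡⟨ solve 5 (λ a t u G D → a :+ (t :+ u) :* (G :+ D)
                                                   := a :+ t :* G :+ (t :* D :+ u :* (G :+ D))) refl a t u G D ⟩
    a ⊕ t ⊗ G ⊕ (t ⊗ D ⊕ u ⊗ (G ⊕ D))
      ≡⟨ cong (a ⊕ t ⊗ G ⊕_) (sym (begin
           eval₁ (diff (a ∷ g) u) t ≡⟨ eval₁-+ (0# ∷ diff g u) (Vec.map (u ⊗_) (Vec.zipWith _⊕_ g (diff g u Vec.∷ʳ 0#))) t ⟩
           0# ⊕ t ⊗ D ⊕ eval₁ (Vec.map (u ⊗_) (Vec.zipWith _⊕_ g (diff g u Vec.∷ʳ 0#))) t
             ≡⟨ cong₂ _⊕_ (⊕-identityˡ _) (trans (eval₁-* u (Vec.zipWith _⊕_ g (diff g u Vec.∷ʳ 0#)) t)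
                  (cong (u ⊗_) (trans (eval₁-+ g (diff g u Vec.∷ʳ 0#) t) (cong (G ⊕_) (eval₁-∷ʳ0 (diff g u) t))))) ⟩
           t ⊗ D ⊕ u ⊗ (G ⊕ D) ∎)) ⟩
    a ⊕ t ⊗ G ⊕ eval₁ (diff (a ∷ g) u) t ∎
    where
    G = eval₁ g t
    D = eval₁ (diff g u) t

  last-zipWith : ∀ {m} (g h : Vec 𝔽 (suc m)) → last (Vec.zipWith _⊕_ g h) ≡ last g ⊕ last h
  last-zipWith {zero}  (a ∷ []) (b ∷ []) = refl
  last-zipWith {suc m} (a ∷ g)  (b ∷ h)  = last-zipWith g h

  last-map : ∀ {m} c (h : Vec 𝔽 (suc m)) → last (Vec.map (c ⊗_) h) ≡ c ⊗ last h
  last-map {zero}  c (a ∷ []) = refl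
  last-map {suc m} c (a ∷ h)  = last-map c h

  -- Each level of Horner's scheme contributes one more `u ⊗ last h`, as in the leading term (m +
  -- 1)ut^m of (t + u)^(m+1) - t^(m+1).
  last-diff : ∀ {m} (h : Vec 𝔽 (suc (suc m))) u → last (diff h u) ≡ [ suc m ] ⊗ (u ⊗ last h)
  last-diff {zero} (a ∷ b ∷ []) u = trans (⊕-identityˡ _) (trans (cong (u ⊗_) (⊕-identityʳ b)) (sym (trans (cong (_⊗ _) [1]≡1) (⊗-identityˡ _))))
  last-diff {suc m} (a ∷ g) u = begin
    last (diff (a ∷ g) u)
      ≡⟨ last-zipWith (0# ∷ diff g u) (Vec.map (u ⊗_) (Vec.zipWith _⊕_ g (diff g u Vec.∷ʳ 0#))) ⟩
    last (diff g u) ⊕ last (Vec.map (u ⊗_) (Vec.zipWith _⊕_ g (diff g u Vec.∷ʳ 0#)))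
      ≡⟨ cong₂ _⊕_ (last-diff g u) (trans (last-map u (Vec.zipWith _⊕_ g (diff g u Vec.∷ʳ 0#)))
           (cong (u ⊗_) (trans (last-zipWith g (diff g u Vec.∷ʳ 0#)) (trans (cong (last g ⊕_) (Vec.last-∷ʳ 0# (diff g u))) (⊕-identityʳ _))))) ⟩
    [ suc m ] ⊗ (u ⊗ last g) ⊕ u ⊗ last g
      ≡⟨ cong ([ suc m ] ⊗ (u ⊗ last g) ⊕_) (⊗-identityˡ _) ⟨
    [ suc m ] ⊗ (u ⊗ last g) ⊕ 1# ⊗ (u ⊗ last g)
      ≡⟨ ⊗-distribʳ (u ⊗ last g) [ suc m ] 1# ⟨
    ([ suc m ] ⊕ 1#) ⊗ (u ⊗ last g)
      ≡⟨ cong (_⊗ (u ⊗ last g)) (trans (⊕-comm _ 1#) (sym ([suc] (suc m)))) ⟩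
    [ suc (suc m) ] ⊗ (u ⊗ last g) ∎

  -- A difference with step 1 again vanishes everywhere and has lower degree, and by `last-diff` it
  -- multiplies the leading coefficient by a positive number below q.
  eval₁≗0⇒last≡0 : ∀ {m} (h : Vec 𝔽 (suc m)) → m < q → (∀ t → eval₁ h t ≡ 0#) → last h ≡ 0#
  eval₁≗0⇒last≡0 {zero}  (a ∷ []) _   h≗0 = trans (sym (trans (cong (a ⊕_) (⊗-zeroʳ 0#)) (⊕-identityʳ a))) (h≗0 0#)
  eval₁≗0⇒last≡0 {suc m} h        m<q h≗0 = trans (sym (⊗-identityˡ (last h))) (ab≡0⇒b≡0 [ suc m ] ([m]≢0 (s≤s z≤n) m<q)
    (trans (sym (last-diff h 1#)) (eval₁≗0⇒last≡0 (diff h 1#) (<-trans (n<1+n m) m<q)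
      (λ t → trans (sym (⊕-identityˡ _)) (trans (cong (_⊕ eval₁ (diff h 1#) t) (sym (h≗0 t)))
        (trans (sym (eval₁-diff h 1# t)) (h≗0 (t ⊕ 1#))))))))

  module Shift (S : CommutativeSemiring 0ℓ 0ℓ) where
    open CommutativeSemiring S using (_≈_) renaming (Carrier to C)
    open Sums S

    -- Translation permutes the field; the permutation is expressed by inserting Kronecker deltas
    -- and exchanging the two sums.
    ∑-shift : ∀ (φ : 𝔽 → C) u → ∑ (allFin q) (λ a → φ (a ⊕ u)) ≈ ∑ (allFin q) φ
    ∑-shift φ u = S.sym (S.trans
      (∑-cong (allFin q) λ b → S.trans (S.sym (∑-allFin-δ (b ⊖ u) (λ _ → φ b)))
        (∑-cong (allFin q) λ a → S.*-congʳ (⟦⟧-cong {d = a Fin.≟ (b ⊖ u)} {d′ = b Fin.≟ (a ⊕ u)}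
           (λ eq → sym (trans (cong (_⊕ u) eq) ([a-b]+b≡a b u)))
           (λ eq → sym (trans (cong (_⊖ u) eq) ([a+b]-b≡a a u))))))
      (S.trans (∑-swap (allFin q) (allFin q))
        (∑-cong (allFin q) λ a → ∑-allFin-δ (a ⊕ u) φ)))
      where module S = CommutativeSemiring S

  open ∑𝔽
  open Shift 𝔽-commutativeSemiring

  private
    monomial : 𝔽 → ∀ m → Vec 𝔽 (suc m)
    monomial c zero    = c ∷ []
    monomial c (suc m) = 0# ∷ monomial c m

    last-monomial : ∀ c m → last (monomial c m) ≡ c
    last-monomial c zero    = refl
    last-monomial c (suc m) = last-monomial c m

    eval₁-monomial : ∀ m t → eval₁ (monomial 1# m) t ≡ t ^𝔽 m
    eval₁-monomial zero    t = trans (cong (1# ⊕_) (⊗-zeroʳ t)) (⊕-identityʳ 1#)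
    eval₁-monomial (suc m) t = trans (⊕-identityˡ _) (cong (t ⊗_) (eval₁-monomial m t))

    dropLast0 : ∀ {m} (h : Vec 𝔽 (suc m)) → last h ≡ 0# → ∃ λ g → ∀ t → eval₁ h t ≡ eval₁ {m} g t
    dropLast0 {zero}  (a ∷ []) refl = [] , λ t → trans (⊕-identityˡ _) (⊗-zeroʳ t)
    dropLast0 {suc m} (a ∷ h)  eq with g , g≗h ← dropLast0 h eq = a ∷ g , λ t → cong (λ s → a ⊕ t ⊗ s) (g≗h t)

  -- Up to lower degree, a polynomial of degree m < q − 1 is a difference
  -- H(t + 1) − H(t) with deg H = m + 1.
  ∑-eval₁ : ∀ {m} (h : Vec 𝔽 m) → m ≤ p → ∑ (allFin q) (eval₁ h) ≡ 0#
  ∑-eval₁ {zero}  []  _   = ∑-0 (allFin q) (λ _ → refl)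
  ∑-eval₁ {suc m} h  m<p = begin
    ∑ (allFin q) (eval₁ h)
      ≡⟨ ∑-cong (allFin q) (λ t → trans (sym ([a-b]+b≡a _ (eval₁ D t)))
           (cong (_⊕ eval₁ D t) (trans (cong (eval₁ h t ⊕_) (sym (eval₁-* -1# D t))) (trans (sym (eval₁-+ h (Vec.map (-1# ⊗_) D) t)) (proj₂ rest t))))) ⟩
    ∑ (allFin q) (λ t → eval₁ (proj₁ rest) t ⊕ eval₁ D t)
      ≡⟨ ∑-+ (allFin q) ⟩
    ∑ (allFin q) (eval₁ (proj₁ rest)) ⊕ ∑ (allFin q) (eval₁ D)
      ≡⟨ cong₂ _⊕_ (∑-eval₁ (proj₁ rest) (<⇒≤ m<p)) ∑D ⟩
    0# ⊕ 0#
      ≡⟨ ⊕-identityˡ 0# ⟩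
    0# ∎
    where
    -- The degree m is at most q - 2, so m + 1 is invertible; the power t^(q-1) sums to -1.
    m+1⁻¹ = inverse [ suc m ] ([m]≢0 (s≤s z≤n) (s≤s m<p))
    H = monomial (proj₁ m+1⁻¹ ⊗ last h) (suc m)
    D = diff H 1#
    last-D : last D ≡ last h
    last-D = begin
      last D                                                 ≡⟨ last-diff H 1# ⟩
      [ suc m ] ⊗ (1# ⊗ last H)  ≡⟨ cong ([ suc m ] ⊗_) (trans (⊗-identityˡ _) (last-monomial _ (suc m))) ⟩
      [ suc m ] ⊗ (proj₁ m+1⁻¹ ⊗ last h)  ≡⟨ ⊗-assoc [ suc m ] (proj₁ m+1⁻¹) (last h) ⟨
      [ suc m ] ⊗ proj₁ m+1⁻¹ ⊗ last h  ≡⟨ cong (_⊗ last h) (trans (⊗-comm [ suc m ] _) (proj₂ m+1⁻¹)) ⟩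
      1# ⊗ last h                                           ≡⟨ ⊗-identityˡ _ ⟩
      last h                                                 ∎
    rest : ∃ λ (g : Vec 𝔽 m) → ∀ t → eval₁ (Vec.zipWith _⊕_ h (Vec.map (-1# ⊗_) D)) t ≡ eval₁ g t
    rest = dropLast0 _ (trans (last-zipWith h (Vec.map (-1# ⊗_) D)) (trans (cong (last h ⊕_) (trans (last-map -1# D) (cong (-1# ⊗_) last-D))) (a-a≡0 (last h))))
    ∑D : ∑ (allFin q) (eval₁ D) ≡ 0#
    ∑D = ⊕-cancelʳ _ _ (∑ (allFin q) (eval₁ H)) (begin
      ∑ (allFin q) (eval₁ D) ⊕ ∑ (allFin q) (eval₁ H)   ≡⟨ ∑-+ (allFin q) ⟨
      ∑ (allFin q) (λ t → eval₁ D t ⊕ eval₁ H t)  ≡⟨ ∑-cong (allFin q) (λ t → trans (⊕-comm _ (eval₁ H t)) (sym (eval₁-diff H 1# t))) ⟩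
      ∑ (allFin q) (λ t → eval₁ H (t ⊕ 1#))             ≡⟨ ∑-shift (eval₁ H) 1# ⟩
      ∑ (allFin q) (eval₁ H)                             ≡⟨ ⊕-identityˡ _ ⟨
      0# ⊕ ∑ (allFin q) (eval₁ H)                       ∎)

  ∑-power : ∀ {m} → m < p → ∑ (allFin q) (_^𝔽 m) ≡ 0#
  ∑-power {m} m<p = trans (∑-cong (allFin q) (λ t → sym (eval₁-monomial m t))) (∑-eval₁ (monomial 1# m) m<p)

-- Degree of functions, spans of monomials and duality of Reed-Muller codes.

module Polynomials {p : ℕ} (K : FiniteField p) where

  open FiniteField K
  open FieldTheory K
  open ∑𝔽
  open ≡-Reasoning
  open 𝔽-Solver using (solve; _:=_; _:+_; _:*_)
  open +-*-Solver using () renaming (solve to solveℕ; _:=_ to _≐_; _:+_ to _∔_; _:*_ to _∙_)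

  Function : ℕ → Set
  Function n = Vec 𝔽 n → 𝔽

  infix 8 _^^_
  _^^_ : ∀ {n} → Vec 𝔽 n → Vec ℕ n → 𝔽
  x ^^ α = Vec.foldr′ _⊗_ 1# (Vec.zipWith _^𝔽_ x α)

  private variable
    n s t : ℕ
    F G H : Function n

  -- Degree belongs to the function, with no chosen formal polynomial. The pointwise equation in
  -- each constructor makes it invariant under `≗`, and derivations serve as an induction principle.
  data Deg {n} : ℕ → Function n → Set where
    const : ∀ c → (∀ x → F x ≡ c) → Deg t F
    var·  : ∀ l → Deg t F → (∀ x → G x ≡ lookup x l ⊗ F x) → Deg (suc t) G
    sum   : Deg t F → Deg t G → (∀ x → H x ≡ F x ⊕ G x) → Deg t H

  Deg< : ℕ → Function n → Set
  Deg< zero    F = ∀ x → F x ≡ 0#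
  Deg< (suc t) F = Deg t F

  Deg-cong : F ≗ G → Deg t F → Deg t G
  Deg-cong F≗G (const c F≡c)   = const c λ x → trans (sym (F≗G x)) (F≡c x)
  Deg-cong F≗G (var· l dF F≡)  = var· l dF λ x → trans (sym (F≗G x)) (F≡ x)
  Deg-cong F≗G (sum dF dG F≡)  = sum dF dG λ x → trans (sym (F≗G x)) (F≡ x)

  Deg-≤ : s ≤ t → Deg s F → Deg t F
  Deg-≤ s≤t       (const c F≡c)  = const c F≡c
  Deg-≤ (s≤s s≤t) (var· l dF F≡) = var· l (Deg-≤ s≤t dF) F≡
  Deg-≤ s≤t       (sum dF dG F≡) = sum (Deg-≤ s≤t dF) (Deg-≤ s≤t dG) F≡

  Deg-scale : ∀ c → Deg t F → Deg t (λ x → c ⊗ F x)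
  Deg-scale c (const c′ F≡c)  = const (c ⊗ c′) λ x → cong (c ⊗_) (F≡c x)
  Deg-scale c (var· {F = F} l dF F≡) = var· l (Deg-scale c dF) λ x → trans (cong (c ⊗_) (F≡ x))
    (solve 3 (λ c y F → c :* (y :* F) := y :* (c :* F)) refl c (lookup x l) (F x))
  Deg-scale c (sum dF dG F≡)  = sum (Deg-scale c dF) (Deg-scale c dG) λ x → trans (cong (c ⊗_) (F≡ x)) (⊗-distribˡ c _ _)

  Deg-* : Deg s F → Deg t G → Deg (s + t) (λ x → F x ⊗ G x)
  Deg-* {s = s} {G = G} (const c F≡c) dG = Deg-≤ (m≤n+m _ s) (Deg-cong (λ x → cong (_⊗ G x) (sym (F≡c x))) (Deg-scale c dG))
  Deg-* {G = G} (var· l dF F≡)  dG = var· l (Deg-* dF dG) λ x → trans (cong (_⊗ G x) (F≡ x)) (⊗-assoc (lookup x l) _ (G x))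
  Deg-* {G = G} (sum dF dF′ F≡) dG = sum (Deg-* dF dG) (Deg-* dF′ dG) λ x → trans (cong (_⊗ G x) (F≡ x)) (⊗-distribʳ (G x) _ _)

  Deg-var : ∀ {n} (l : Fin n) → Deg 1 (λ x → lookup x l)
  Deg-var l = var· l (const {t = 0} 1# (λ _ → refl)) λ x → sym (⊗-identityʳ _)

  Deg-+ : Deg t F → Deg t G → Deg t (λ x → F x ⊕ G x)
  Deg-+ dF dG = sum dF dG λ _ → refl

  Deg-- : Deg t F → Deg t G → Deg t (λ x → F x ⊖ G x)
  Deg-- dF dG = Deg-+ dF (Deg-scale -1# dG)

  Deg-const : ∀ {n t} c → Deg {n} t (λ _ → c)
  Deg-const c = const c λ _ → refl

  Deg-∑ : ∀ {A : Set} (as : List A) {φ : A → Function n} → (∀ a → Deg t (φ a)) → Deg t (λ x → ∑ as (λ a → φ a x))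
  Deg-∑ []       dφ = Deg-const 0#
  Deg-∑ (a ∷ as) dφ = Deg-+ (dφ a) (Deg-∑ as dφ)

  Deg-∏ : ∀ m {φ : Fin m → Function n} → (∀ i → Deg 1 (φ i)) → Deg m (λ x → ∏ m (λ i → φ i x))
  Deg-∏ zero    dφ = Deg-const 1#
  Deg-∏ (suc m) dφ = Deg-* (dφ zero) (Deg-∏ m (dφ ∘ suc))

  Deg-^ : ∀ k → Deg t F → Deg (k * t) (λ x → F x ^𝔽 k)
  Deg-^ zero    dF = Deg-const 1#
  Deg-^ (suc k) dF = Deg-* dF (Deg-^ k dF)

  Deg-∘tail : Deg {n} t F → Deg {suc n} t (F ∘ tail)
  Deg-∘tail (const c F≡c)  = const c (F≡c ∘ tail)
  Deg-∘tail (var· l dF F≡) = var· (suc l) (Deg-∘tail dF) λ { (a ∷ x) → F≡ x }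
  Deg-∘tail (sum dF dG F≡) = sum (Deg-∘tail dF) (Deg-∘tail dG) (F≡ ∘ tail)

  Deg-head^ : ∀ {n} k → Deg {suc n} k (λ x → head x ^𝔽 k)
  Deg-head^ k = Deg-≤ (≤-reflexive (ℕ.*-identityʳ k)) (Deg-^ k (Deg-cong (λ { (a ∷ x) → refl }) (Deg-var zero)))

  Deg-^^ : ∀ {n} (α : Vec ℕ n) → Deg (Vec.sum α) (_^^ α)
  Deg-^^ []      = const 1# λ { [] → refl }
  Deg-^^ (k ∷ α) = Deg-cong (λ { (a ∷ x) → refl }) (Deg-* (Deg-head^ k) (Deg-∘tail (Deg-^^ α)))

  Deg<-cong : ∀ t → F ≗ G → Deg< t F → Deg< t G
  Deg<-cong zero    F≗G F≡0 x = trans (sym (F≗G x)) (F≡0 x)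
  Deg<-cong (suc t) F≗G dF    = Deg-cong F≗G dF

  Deg<-0 : ∀ {n} t → Deg< {n} t (λ _ → 0#)
  Deg<-0 zero    = λ _ → refl
  Deg<-0 (suc t) = Deg-const 0#

  Deg<-+ : ∀ t → Deg< t F → Deg< t G → Deg< t (λ x → F x ⊕ G x)
  Deg<-+ zero    F≡0 G≡0 x = trans (cong₂ _⊕_ (F≡0 x) (G≡0 x)) (⊕-identityˡ 0#)
  Deg<-+ (suc t) dF dG     = Deg-+ dF dG

  Deg<-scale : ∀ t c → Deg< t F → Deg< t (λ x → c ⊗ F x)
  Deg<-scale zero    c F≡0 x = trans (cong (c ⊗_) (F≡0 x)) (⊗-zeroʳ c)
  Deg<-scale (suc t) c dF    = Deg-scale c dF

  Deg<-var : ∀ t (l : Fin n) → Deg< t F → Deg< (suc t) (λ x → lookup x l ⊗ F x)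
  Deg<-var zero    l F≡0 = const 0# λ x → trans (cong (lookup x l ⊗_) (F≡0 x)) (⊗-zeroʳ _)
  Deg<-var (suc t) l dF  = var· l dF λ _ → refl

  Deg<-suc : ∀ t → Deg< t F → Deg< (suc t) F
  Deg<-suc zero    F≡0 = const 0# F≡0
  Deg<-suc (suc t) dF  = Deg-≤ (n≤1+n t) dF

  ∏-monic : ∀ {n} (l : Fin n) m (φ : Fin m → 𝔽) →
            ∃ λ ρ → Deg< m ρ × (∀ x → ∏ m (λ b → lookup x l ⊖ φ b) ≡ lookup x l ^𝔽 m ⊕ ρ x)
  ∏-monic l zero    φ = (λ _ → 0#) , (λ _ → refl) , λ x → sym (⊕-identityʳ 1#)
  ∏-monic l (suc m) φ with ρ , dρ , eq ← ∏-monic l m (φ ∘ suc) =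
    (λ x → c ⊗ lookup x l ^𝔽 m ⊕ (lookup x l ⊗ ρ x ⊕ c ⊗ ρ x)) ,
    Deg-+ (Deg-≤ (≤-reflexive (ℕ.*-identityʳ m)) (Deg-scale c (Deg-^ m (Deg-var l))))
          (Deg-+ (Deg<-var m l dρ) (Deg<-suc m (Deg<-scale m c dρ))) ,
    λ x → trans (cong ((lookup x l ⊖ φ zero) ⊗_) (eq x))
      (solve 4 (λ y c P ρ → (y :+ c) :* (P :+ ρ) := y :* P :+ (c :* P :+ (y :* ρ :+ c :* ρ))) refl
        (lookup x l) c (lookup x l ^𝔽 m) (ρ x))
    where c = -1# ⊗ φ zero

  ∏-all≡0 : ∀ a → ∏ q (λ b → a ⊖ b) ≡ 0#
  ∏-all≡0 a = ∏-0 q {a ⊖_} a (a-a≡0 a)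

  -- The product of x_l - b over all b in the field vanishes as a function and is monic of degree q
  -- in x_l, so x_l^q is minus its lower terms.
  Deg-^q : ∀ {n} (l : Fin n) → Deg p (λ x → lookup x l ^𝔽 q)
  Deg-^q l with ρ , dρ , eq ← ∏-monic l q id = Deg-cong
    (λ x → sym (trans (sym ([a+b]-b≡a (lookup x l ^𝔽 q) (ρ x)))
      (trans (cong (_⊖ ρ x) (trans (sym (eq x)) (∏-all≡0 (lookup x l)))) (⊕-identityˡ _))))
    (Deg-scale -1# dρ)

  Reduced : Vec ℕ n → Set
  Reduced α = ∀ l → lookup α l < q

  ^𝔽-+ : ∀ a i j → a ^𝔽 (i + j) ≡ a ^𝔽 i ⊗ a ^𝔽 j
  ^𝔽-+ a zero    j = sym (⊗-identityˡ _)
  ^𝔽-+ a (suc i) j = trans (cong (a ⊗_) (^𝔽-+ a i j)) (sym (⊗-assoc a _ _))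

  Deg<-^^ : ∀ {n} (α : Vec ℕ n) → ¬ Reduced α → Deg< (Vec.sum α) (_^^ α)
  Deg<-^^ []      ¬red = contradiction (λ ()) ¬red
  Deg<-^^ (k ∷ α) ¬red with k ℕ.<? q
  ... | yes k<q = Deg<-cong (k + Vec.sum α) (λ { (a ∷ x) → refl }) (dist (Vec.sum α) (Deg<-^^ α ¬red′))
    where
    ¬red′ : ¬ Reduced α
    ¬red′ red = ¬red λ { zero → k<q ; (suc l) → red l }
    dist : ∀ s {F} → Deg< s F → Deg< (k + s) (λ x → head x ^𝔽 k ⊗ F (tail x))
    dist zero    F≡0 = Deg<-cong (k + 0) (λ x → sym (trans (cong (head x ^𝔽 k ⊗_) (F≡0 (tail x))) (⊗-zeroʳ _))) (Deg<-0 (k + 0))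
    dist (suc s) {F} dF rewrite ℕ.+-suc k s = Deg-* (Deg-head^ k) (Deg-∘tail dF)
  -- The factor a^q has degree p as a function, which lowers the total by one.
  ... | no k≮q with k′ , refl ← ℕ.m≤n⇒∃[o]m+o≡n (≮⇒≥ k≮q) =
    Deg-≤ (≤-reflexive (sym (ℕ.+-assoc p k′ (Vec.sum α))))
    (Deg-cong (λ { (a ∷ x) → trans (sym (⊗-assoc (a ^𝔽 q) (a ^𝔽 k′) (x ^^ α))) (cong (_⊗ x ^^ α) (sym (^𝔽-+ a q k′))) })
      (Deg-* (Deg-cong {G = λ x → head x ^𝔽 q} (λ { (a ∷ x) → refl }) (Deg-^q zero)) (Deg-* (Deg-head^ k′) (Deg-∘tail (Deg-^^ α)))))

  infixl 6 _⊞_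
  _⊞_ : Vec ℕ n → Vec ℕ n → Vec ℕ n
  _⊞_ = Vec.zipWith _+_

  ^^-⊞ : ∀ (x : Vec 𝔽 n) α β → x ^^ (α ⊞ β) ≡ x ^^ α ⊗ x ^^ β
  ^^-⊞ []      []      []      = sym (⊗-identityˡ 1#)
  ^^-⊞ (a ∷ x) (i ∷ α) (j ∷ β) = trans (cong₂ _⊗_ (^𝔽-+ a i j) (^^-⊞ x α β))
    (solve 4 (λ a b c d → (a :* b) :* (c :* d) := (a :* c) :* (b :* d)) refl (a ^𝔽 i) (a ^𝔽 j) (x ^^ α) (x ^^ β))

  sum-⊞ : ∀ (α β : Vec ℕ n) → Vec.sum (α ⊞ β) ≡ Vec.sum α + Vec.sum β
  sum-⊞ []      []      = refl
  sum-⊞ (i ∷ α) (j ∷ β) = trans (cong (λ s → i + j + s) (sum-⊞ α β))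
    (solveℕ 4 (λ i j a b → i ∔ j ∔ (a ∔ b)
       ≐ i ∔ a ∔ (j ∔ b)) refl i j (Vec.sum α) (Vec.sum β))

  unit : Fin n → Vec ℕ n
  unit zero    = 1 ∷ Vec.replicate _ 0
  unit (suc l) = 0 ∷ unit l

  ^^-0 : ∀ (x : Vec 𝔽 n) → x ^^ Vec.replicate n 0 ≡ 1#
  ^^-0 []      = refl
  ^^-0 (a ∷ x) = trans (⊗-identityˡ _) (^^-0 x)

  sum-0 : ∀ n → Vec.sum (Vec.replicate n 0) ≡ 0
  sum-0 zero    = refl
  sum-0 (suc n) = sum-0 n

  ^^-unit : ∀ (x : Vec 𝔽 n) l → x ^^ unit l ≡ lookup x l
  ^^-unit (a ∷ x) zero    = trans (cong₂ _⊗_ (⊗-identityʳ a) (^^-0 x)) (⊗-identityʳ a)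
  ^^-unit (a ∷ x) (suc l) = trans (⊗-identityˡ _) (^^-unit x l)

  sum-unit : ∀ (l : Fin n) → Vec.sum (unit l) ≡ 1
  sum-unit {suc n} zero = cong suc (sum-0 n)
  sum-unit (suc l)      = sum-unit l

  -- Unlike `Deg`, it keeps the exponents visible, so that S can also express a monomial order.
  data Span {n} (S : Vec ℕ n → Set) : Function n → Set where
    nil  : (∀ x → F x ≡ 0#) → Span S F
    cons : ∀ c {α} → S α → Span S F → (∀ x → G x ≡ c ⊗ x ^^ α ⊕ F x) → Span S G

  private variable S T U : Vec ℕ n → Set

  Span-cong : F ≗ G → Span S F → Span S G
  Span-cong F≗G (nil F≡0)         = nil λ x → trans (sym (F≗G x)) (F≡0 x)
  Span-cong F≗G (cons c Sα dF F≡) = cons c Sα dF λ x → trans (sym (F≗G x)) (F≡ x)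

  Span-⊆ : (∀ {α} → S α → T α) → Span S F → Span T F
  Span-⊆ S⊆T (nil F≡0)        = nil F≡0
  Span-⊆ S⊆T (cons c Sα dF F≡) = cons c (S⊆T Sα) (Span-⊆ S⊆T dF) F≡

  Span-+ : Span S F → Span S G → Span S (λ x → F x ⊕ G x)
  Span-+ {G = G} (nil F≡0)         sG = Span-cong (λ x → sym (trans (cong (_⊕ G x) (F≡0 x)) (⊕-identityˡ _))) sG
  Span-+ {G = G} (cons c Sα sF F≡) sG = cons c Sα (Span-+ sF sG) λ x → trans (cong (_⊕ G x) (F≡ x)) (⊕-assoc _ _ _)

  Span-scale-shift : ∀ c α → (∀ {β} → S β → T (α ⊞ β)) → Span S F → Span T (λ x → c ⊗ x ^^ α ⊗ F x)
  Span-scale-shift c α S⊆T (nil F≡0) = nil λ x → trans (cong (c ⊗ x ^^ α ⊗_) (F≡0 x)) (⊗-zeroʳ _)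
  Span-scale-shift c α S⊆T (cons {F = F} c′ {β} Sβ sF F≡) = cons (c ⊗ c′) (S⊆T Sβ) (Span-scale-shift c α S⊆T sF) λ x →
    trans (cong (c ⊗ x ^^ α ⊗_) (F≡ x)) (trans
      (solve 5 (λ c y d z f → c :* y :* (d :* z :+ f) := c :* d :* (y :* z) :+ c :* y :* f) refl c (x ^^ α) c′ (x ^^ β) (F x))
      (cong (λ z → c ⊗ c′ ⊗ z ⊕ c ⊗ x ^^ α ⊗ F x) (sym (^^-⊞ x α β))))

  Span-* : (∀ {α β} → S α → T β → U (α ⊞ β)) → Span S F → Span T G → Span U (λ x → F x ⊗ G x)
  Span-* {G = G} S·T⊆U (nil F≡0) sG = nil λ x → trans (cong (_⊗ G x) (F≡0 x)) (⊗-zeroˡ _)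
  Span-* {G = G} S·T⊆U (cons c {α} Sα sF F≡) sG = Span-cong
    (λ x → sym (trans (cong (_⊗ G x) (F≡ x)) (⊗-distribʳ (G x) _ _)))
    (Span-+ (Span-scale-shift c α (S·T⊆U Sα) sG) (Span-* S·T⊆U sF sG))

  Deg⇒Span : ∀ {n t} {F : Function n} → Deg t F → Span (λ α → Vec.sum α ≤ t) F
  Deg⇒Span {n} {t} (const c F≡c) = cons c (≤-trans (≤-reflexive (sum-0 n)) z≤n) (nil (λ _ → refl))
    λ x → trans (F≡c x) (sym (trans (⊕-identityʳ _) (trans (cong (c ⊗_) (^^-0 x)) (⊗-identityʳ c))))
  Deg⇒Span (var· {F = F} l dF G≡) = Span-cong
    (λ x → trans (cong (_⊗ F x) (trans (⊗-identityˡ _) (^^-unit x l))) (sym (G≡ x)))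
    (Span-scale-shift 1# (unit l) (λ {β} |β|≤t → ≤-trans (≤-reflexive (trans (sum-⊞ (unit l) β) (cong (_+ Vec.sum β) (sum-unit l)))) (s≤s |β|≤t))
      (Deg⇒Span dF))
  Deg⇒Span (sum dF dG H≡) = Span-cong (λ x → sym (H≡ x)) (Span-+ (Deg⇒Span dF) (Deg⇒Span dG))

  Span⇒Deg : (∀ {α} → S α → Deg t (_^^ α)) → Span S F → Deg t F
  Span⇒Deg S⊆Deg (nil F≡0)         = const 0# F≡0
  Span⇒Deg S⊆Deg (cons c Sα sF F≡) = sum (Deg-scale c (S⊆Deg Sα)) (Span⇒Deg S⊆Deg sF) F≡

  combination : (ms : List (Vec ℕ n)) → Vec 𝔽 (length ms) → Function n
  combination ms cs x = Vec.foldr′ _⊕_ 0# (Vec.zipWith (λ c α → c ⊗ (x ^^ α)) cs (fromList ms))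

  combination⇒Deg : ∀ (ms : List (Vec ℕ n)) cs → All (λ α → Vec.sum α ≤ t) ms → Deg t (combination ms cs)
  combination⇒Deg []       []       []         = Deg-const _
  combination⇒Deg (α ∷ ms) (c ∷ cs) (α≤t ∷ ≤t) = Deg-+ (Deg-scale c (Deg-≤ α≤t (Deg-^^ α))) (combination⇒Deg ms cs ≤t)

  private
    addTerm : ∀ c {α} {ms : List (Vec ℕ n)} → α ∈ₗ ms → (cs : Vec 𝔽 (length ms)) →
              ∃ λ cs′ → ∀ x → combination ms cs′ x ≡ c ⊗ x ^^ α ⊕ combination ms cs x
    addTerm c {α} {ms = _ ∷ ms} (here refl) (d ∷ cs) = c ⊕ d ∷ cs , λ x →
      trans (cong (_⊕ combination ms cs x) (⊗-distribʳ (x ^^ α) c d)) (⊕-assoc _ _ _)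
    addTerm c {α} {ms = β ∷ ms} (there α∈ms) (d ∷ cs) with cs′ , eq ← addTerm c α∈ms cs = d ∷ cs′ , λ x →
      trans (cong (d ⊗ x ^^ β ⊕_) (eq x))
        (solve 3 (λ a b c → a :+ (b :+ c) := b :+ (a :+ c)) refl (d ⊗ x ^^ β) (c ⊗ x ^^ α) (combination ms cs x))

    zeroCombination : ∀ (ms : List (Vec ℕ n)) x → combination ms (Vec.replicate _ 0#) x ≡ 0#
    zeroCombination []       x = refl
    zeroCombination (α ∷ ms) x = trans (cong₂ _⊕_ (⊗-zeroˡ _) (zeroCombination ms x)) (⊕-identityˡ 0#)

  Span⇒combination : ∀ (ms : List (Vec ℕ n)) → (∀ {α} → S α → α ∈ₗ ms) → Span S F → ∃ λ cs → ∀ x → combination ms cs x ≡ F x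
  Span⇒combination ms S⊆ms (nil F≡0) = Vec.replicate _ 0# , λ x → trans (zeroCombination ms x) (sym (F≡0 x))
  Span⇒combination ms S⊆ms (cons c Sα sF F≡) with cs , eq ← Span⇒combination ms S⊆ms sF
    with cs′ , eq′ ← addTerm c (S⊆ms Sα) cs = cs′ , λ x → trans (eq′ x) (trans (cong (c ⊗ x ^^ _ ⊕_) (eq x)) (sym (F≡ x)))

  points : ∀ n → List (Vec 𝔽 n)
  points n = vectors (allFin q) n

  ⟪_⟫ : Function n → 𝔽
  ⟪_⟫ {n} F = ∑ (points n) F

  -- The sum factors over the coordinates. Exponents that are all at least p would give degree at
  -- least np, so one factor is a power sum with exponent below q - 1.
  ∑-^^≡0 : ∀ {n} (α : Vec ℕ n) → Vec.sum α < n * p → ⟪ (_^^ α) ⟫ ≡ 0#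
  ∑-^^≡0 {suc n} (k ∷ α) |α|<np = begin
    ⟪ (_^^ (k ∷ α)) ⟫
      ≡⟨ ∑-cartesianProductWith _∷_ (allFin q) (points n) ⟩
    ∑ (allFin q) (λ a → ∑ (points n) (λ x → a ^𝔽 k ⊗ x ^^ α))
      ≡⟨ ∑-cong (allFin q) (λ a → ∑-*ˡ (points n) (a ^𝔽 k)) ⟩
    ∑ (allFin q) (λ a → a ^𝔽 k ⊗ ⟪ (_^^ α) ⟫)
      ≡⟨ ∑-*ʳ (allFin q) ⟪ (_^^ α) ⟫ ⟩
    ∑ (allFin q) (_^𝔽 k) ⊗ ⟪ (_^^ α) ⟫
      ≡⟨ factor≡0 ⟩
    0# ∎
    where
    factor≡0 : ∑ (allFin q) (_^𝔽 k) ⊗ ⟪ (_^^ α) ⟫ ≡ 0#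
    factor≡0 with k ℕ.<? p
    ... | yes k<p = trans (cong (_⊗ ⟪ (_^^ α) ⟫) (∑-power k<p)) (⊗-zeroˡ _)
    ... | no  k≮p = trans (cong (∑ (allFin q) (_^𝔽 k) ⊗_) (∑-^^≡0 α (ℕ.+-cancelˡ-< p _ _
                      (≤-<-trans (+-monoˡ-≤ (Vec.sum α) (≮⇒≥ k≮p)) |α|<np)))) (⊗-zeroʳ _)

  ∑-Deg≡0 : ∀ {n} {F : Function n} → Deg t F → t < n * p → ⟪ F ⟫ ≡ 0#
  ∑-Deg≡0 {t} {n} dF t<np = go (Deg⇒Span dF)
    where
    go : ∀ {F : Function n} → Span (λ α → Vec.sum α ≤ t) F → ⟪ F ⟫ ≡ 0#
    go (nil F≡0) = ∑-0 (points n) F≡0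
    go (cons {F = F} {G} c {α} |α|≤t sF F≡) = begin
      ⟪ G ⟫                                ≡⟨ ∑-cong (points n) F≡ ⟩
      ∑ (points n) (λ x → c ⊗ x ^^ α ⊕ F x)  ≡⟨ ∑-+ (points n) ⟩
      ∑ (points n) (λ x → c ⊗ x ^^ α) ⊕ ⟪ F ⟫  ≡⟨ cong₂ _⊕_ (trans (∑-*ˡ (points n) c) (trans (cong (c ⊗_) (∑-^^≡0 α (≤-<-trans |α|≤t t<np))) (⊗-zeroʳ c))) (go sF) ⟩
      0# ⊕ 0#                             ≡⟨ ⊕-identityˡ 0# ⟩
      0#                                   ∎

  private
    -- The normalising constant of Lagrange interpolation; `Fin.punchIn 0#` enumerates the p nonzero
    -- field elements.
    κ⁻¹ : ∃ λ κ → κ ⊗ ∏ p (λ b → -1# ⊗ Fin.punchIn 0# b) ≡ 1#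
    κ⁻¹ = inverse _ (∏-≢0 p λ b → ⊗-≢0
      (λ -1≡0 → 1≢0 (trans (sym (⊕-identityʳ 1#)) (trans (cong (1# ⊕_) (sym -1≡0)) 1+-1≡0)))
      (Fin.punchInᵢ≢i 0# b))

  κ : 𝔽
  κ = proj₁ κ⁻¹

  indicator : 𝔽 → 𝔽 → 𝔽
  indicator a s = κ ⊗ ∏ p (λ b → s ⊖ (a ⊕ Fin.punchIn 0# b))

  indicator-≡ : ∀ a → indicator a a ≡ 1#
  indicator-≡ a = trans (cong (κ ⊗_) (∏-cong p λ b → let c = Fin.punchIn 0# b in begin
    a ⊕ -1# ⊗ (a ⊕ c)  ≡⟨ solve 3 (λ a m c → a :+ m :* (a :+ c) := (a :+ m :* a) :+ m :* c) refl a -1# c ⟩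
    (a ⊖ a) ⊕ -1# ⊗ c          ≡⟨ trans (cong (_⊕ -1# ⊗ c) (a-a≡0 a)) (⊕-identityˡ _) ⟩
    -1# ⊗ c                      ∎)) (proj₂ κ⁻¹)

  indicator-≢ : ∀ {a s} → s ≢ a → indicator a s ≡ 0#
  indicator-≢ {a} {s} s≢a = trans (cong (κ ⊗_) (∏-0 p (Fin.punchOut 0≢s-a) (begin
    s ⊖ (a ⊕ Fin.punchIn 0# (Fin.punchOut 0≢s-a))  ≡⟨ cong (λ c → s ⊖ (a ⊕ c)) (Fin.punchIn-punchOut 0≢s-a) ⟩
    s ⊖ (a ⊕ (s ⊖ a))  ≡⟨ cong (s ⊖_) (trans (⊕-comm a _) ([a-b]+b≡a s a)) ⟩
    s ⊖ s                                             ≡⟨ a-a≡0 s ⟩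
    0#                                                 ∎))) (⊗-zeroʳ κ)
    where
    0≢s-a : 0# ≢ s ⊖ a
    0≢s-a eq = s≢a (a-b≡0⇒a≡b s a (sym eq))

  indicator-⟦⟧ : ∀ a s → indicator a s ≡ ⟦ a Fin.≟ s ⟧
  indicator-⟦⟧ a s with a Fin.≟ s
  ... | yes refl = indicator-≡ a
  ... | no  a≢s  = indicator-≢ (a≢s ∘ sym)

  Deg-indicator : ∀ {n} a (l : Fin n) → Deg p (λ x → indicator a (lookup x l))
  Deg-indicator a l = Deg-scale κ (Deg-∏ p λ b → Deg-- (Deg-var l) (Deg-const _))

  private
    Kernel : ℕ → Set
    Kernel n = Vec 𝔽 n → Vec 𝔽 n → 𝔽

    -- A kernel is recorded by its linear factors because `⊥-kernel` splits each of them between x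
    -- and y.
    data Factors {n} : ℕ → Kernel n → Set where
      const  : ∀ {N Φ} c → (∀ x y → Φ x y ≡ c) → Factors N Φ
      factor : ∀ {N Φ Ψ} l b → Factors N Φ → (∀ x y → Ψ x y ≡ (lookup x l ⊖ (lookup y l ⊕ b)) ⊗ Φ x y) →
               Factors (suc N) Ψ

    Factors-scale : ∀ {N} {Φ : Kernel n} c → Factors N Φ → Factors N (λ x y → c ⊗ Φ x y)
    Factors-scale c (const c′ Φ≡) = const (c ⊗ c′) λ x y → cong (c ⊗_) (Φ≡ x y)
    Factors-scale c (factor {Φ = Φ} l b fΦ Ψ≡) = factor l b (Factors-scale c fΦ) λ x y → trans (cong (c ⊗_) (Ψ≡ x y))
      (solve 3 (λ c y F → c :* (y :* F) := y :* (c :* F)) refl c (lookup x l ⊖ (lookup y l ⊕ b)) (Φ x y))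

    Factors-≤ : ∀ {M N} {Φ : Kernel n} → M ≤ N → Factors M Φ → Factors N Φ
    Factors-≤ M≤N       (const c Φ≡)       = const c Φ≡
    Factors-≤ (s≤s M≤N) (factor l b fΦ Ψ≡) = factor l b (Factors-≤ M≤N fΦ) Ψ≡

    Factors-cong : ∀ {N} {Φ Ψ : Kernel n} → (∀ x y → Φ x y ≡ Ψ x y) → Factors N Φ → Factors N Ψ
    Factors-cong Φ≗Ψ (const c Φ≡)       = const c λ x y → trans (sym (Φ≗Ψ x y)) (Φ≡ x y)
    Factors-cong Φ≗Ψ (factor l b fΦ Φ≡) = factor l b fΦ λ x y → trans (sym (Φ≗Ψ x y)) (Φ≡ x y)

    Factors-* : ∀ {M N} {Φ Ψ : Kernel n} → Factors M Φ → Factors N Ψ → Factors (M + N) (λ x y → Φ x y ⊗ Ψ x y)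
    Factors-* {M = M} {Ψ = Ψ} (const c Φ≡) fΨ = Factors-≤ (m≤n+m _ M)
      (Factors-cong (λ x y → cong (_⊗ Ψ x y) (sym (Φ≡ x y))) (Factors-scale c fΨ))
    Factors-* {Ψ = Ψ} (factor l b fΦ Φ≡) fΨ = factor l b (Factors-* fΦ fΨ) λ x y →
      trans (cong (_⊗ Ψ x y) (Φ≡ x y)) (⊗-assoc _ _ _)

    Factors-∏ : ∀ m N {Φ : Fin m → Kernel n} → (∀ i → Factors N (Φ i)) → Factors (m * N) (λ x y → ∏ m (λ i → Φ i x y))
    Factors-∏ zero    N fΦ = const 1# λ _ _ → refl
    Factors-∏ (suc m) N fΦ = Factors-* (fΦ zero) (Factors-∏ m N (fΦ ∘ suc))

    Factors-indicator : ∀ (l : Fin n) → Factors p (λ x y → indicator (lookup y l) (lookup x l))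
    Factors-indicator l = Factors-scale κ (Factors-≤ (≤-reflexive (ℕ.*-identityʳ p))
      (Factors-∏ p 1 λ b → factor l (Fin.punchIn 0# b) (const {N = 0} 1# (λ _ _ → refl)) λ x y → sym (⊗-identityʳ _)))

    -- Expand one factor x_l - (y_l + b). The term x_l raises the degree in x by one; the term y_l +
    -- b moves into g, which loses one degree of orthogonality. Either way one factor uses up one
    -- unit of r + t, and fewer than r + t factors are present.
    ⊥-kernel : ∀ {N} {Φ : Kernel n} r t (g : Function n) → Factors N Φ → N < r + t →
               (∀ {R} → Deg< r R → ⟪ (λ y → g y ⊗ R y) ⟫ ≡ 0#) → Deg< t (λ x → ∑ (points n) (λ y → g y ⊗ Φ x y))
    ⊥-kernel zero (suc t) g (const c Φ≡) _ g⊥ =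
      const (∑ (points _) (λ y → g y ⊗ c)) λ x → ∑-cong (points _) λ y → cong (g y ⊗_) (Φ≡ x y)
    ⊥-kernel (suc r) t g (const c Φ≡) _ g⊥ = Deg<-cong t (λ x → sym (trans (∑-cong (points _) λ y → cong (g y ⊗_) (Φ≡ x y))
      (g⊥ (Deg-const c)))) (Deg<-0 t)
    ⊥-kernel {n} r t g (factor {N} {Φ} l b fΦ Ψ≡) N<r+t g⊥ = Deg<-cong t (λ x → sym (begin
        ∑ (points n) (λ y → g y ⊗ _)
          ≡⟨ ∑-cong (points n) (λ y → trans (cong (g y ⊗_) (Ψ≡ x y))
               (solve 5 (λ g x m z Φ → g :* ((x :+ m :* z) :* Φ) := x :* (g :* Φ) :+ m :* (g :* z :* Φ)) refl
                 (g y) (lookup x l) -1# (lookup y l ⊕ b) (Φ x y))) ⟩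
        ∑ (points n) (λ y → lookup x l ⊗ (g y ⊗ Φ x y) ⊕ -1# ⊗ (g y ⊗ (lookup y l ⊕ b) ⊗ Φ x y))
          ≡⟨ ∑-+ (points n) ⟩
        ∑ (points n) (λ y → lookup x l ⊗ (g y ⊗ Φ x y)) ⊕ ∑ (points n) (λ y → -1# ⊗ (g y ⊗ (lookup y l ⊕ b) ⊗ Φ x y))
          ≡⟨ cong₂ _⊕_ (∑-*ˡ (points n) (lookup x l)) (∑-*ˡ (points n) -1#) ⟩
        lookup x l ⊗ ∑ (points n) (λ y → g y ⊗ Φ x y) ⊕ -1# ⊗ ∑ (points n) (λ y → g y ⊗ (lookup y l ⊕ b) ⊗ Φ x y) ∎))
      (Deg<-+ t (first t N<r+t) (Deg<-scale t -1# (second r N<r+t g⊥)))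
      where
      first : ∀ t → suc N < r + t → Deg< t (λ x → lookup x l ⊗ ∑ (points n) (λ y → g y ⊗ Φ x y))
      first zero    N<r   x = trans (cong (lookup x l ⊗_) (⊥-kernel r 0 g fΦ (<-trans (n<1+n N) N<r) g⊥ x)) (⊗-zeroʳ _)
      first (suc t) N<r+t = Deg<-var t l (⊥-kernel r t g fΦ (s<s⁻¹ (<-≤-trans N<r+t (≤-reflexive (ℕ.+-suc r t)))) g⊥)
      second : ∀ r → suc N < r + t → (∀ {R} → Deg< r R → ⟪ (λ y → g y ⊗ R y) ⟫ ≡ 0#) →
               Deg< t (λ x → ∑ (points n) (λ y → g y ⊗ (lookup y l ⊕ b) ⊗ Φ x y))
      second zero    N<t   g⊥ = ⊥-kernel 0 t _ fΦ (<-trans (n<1+n N) N<t)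
        λ R≡0 → ∑-0 (points n) λ y → trans (cong (g y ⊗ (lookup y l ⊕ b) ⊗_) (R≡0 y)) (⊗-zeroʳ _)
      second (suc r) N<r+t g⊥ = ⊥-kernel r t _ fΦ (s<s⁻¹ N<r+t) λ {R} dR →
        trans (∑-cong (points n) λ y → ⊗-assoc (g y) _ (R y))
          (g⊥ (Deg-cong (λ y → sym (⊗-distribʳ (R y) (lookup y l) b))
            (Deg<-+ (suc r) (Deg<-var r l dR) (Deg<-suc r (Deg<-scale r b dR)))))

  -- The product of the coordinate indicators is a reproducing kernel with np = r + d linear
  -- factors, one fewer than r + (d + 1).
  ⊥⇒Deg : ∀ r d {n} (g : Function n) → r + d ≡ n * p → (∀ {R} → Deg< r R → ⟪ (λ y → g y ⊗ R y) ⟫ ≡ 0#) → Deg d g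
  ⊥⇒Deg r d {n} g r+d≡np g⊥ = Deg-cong eq
    (⊥-kernel r (suc d) g (Factors-∏ n p Factors-indicator)
      (≤-reflexive (trans (cong suc (sym r+d≡np)) (sym (ℕ.+-suc r d)))) g⊥)
    where
    eq : ∀ x → ∑ (points n) (λ y → g y ⊗ ∏ n (λ l → indicator (lookup y l) (lookup x l))) ≡ g x
    eq x = trans (∑-cong (points n) λ y → trans (⊗-comm (g y) _) (cong (_⊗ g y)
        (trans (∏-cong n λ l → indicator-⟦⟧ (lookup y l) (lookup x l))
          (sym (⟦⟧-∏ n (y ≟ᵛ x) (λ l → lookup y l Fin.≟ lookup x l) (λ { refl l → refl })
            (λ ps → trans (sym (Vec.tabulate∘lookup y)) (trans (Vec.tabulate-cong ps) (Vec.tabulate∘lookup x))))))))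
      (∑-vectors-δ x g)

-- Pairing with f and its decomposition into point evaluations.

module Pairing {p : ℕ} (K : FiniteField p) where

  open FiniteField K
  open FieldTheory K
  open Polynomials K
  open ∑𝔽
  open ≡-Reasoning
  open 𝔽-Solver using (solve; _:=_; _:+_; _:*_)

  private variable
    n s t : ℕ
    f F G Q R : Function n

  infixl 7 _·ᶠ_
  _·ᶠ_ : Function n → Function n → Function n
  (F ·ᶠ G) x = F x ⊗ G x

  ⟪⟫-cong : {F G : Function n} → F ≗ G → ⟪ F ⟫ ≡ ⟪ G ⟫
  ⟪⟫-cong {n} = ∑-cong (points n)

  ⟪⟫-+ : (F G : Function n) → ⟪ (λ x → F x ⊕ G x) ⟫ ≡ ⟪ F ⟫ ⊕ ⟪ G ⟫
  ⟪⟫-+ {n} F G = ∑-+ (points n)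

  ⟪⟫-scale : ∀ c (F : Function n) → ⟪ (λ x → c ⊗ F x) ⟫ ≡ c ⊗ ⟪ F ⟫
  ⟪⟫-scale {n} c F = ∑-*ˡ (points n) c

  Orth : ∀ {n} → ℕ → Function n → Set
  Orth t F = ∀ {R} → Deg t R → ⟪ F ·ᶠ R ⟫ ≡ 0#

  Orth-cong : {F G : Function n} → F ≗ G → Orth t F → Orth t G
  Orth-cong F≗G oF {R} dR = trans (⟪⟫-cong λ x → cong (_⊗ R x) (sym (F≗G x))) (oF dR)

  Deg⇒Orth : ∀ {n} {F : Function n} → Deg s F → s + t < n * p → Orth t F
  Deg⇒Orth dF s+t<np dR = ∑-Deg≡0 (Deg-* dF dR) s+t<np

  infix 4 _≈[_,_]_
  _≈[_,_]_ : Function n → Function n → ℕ → Function n → Set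
  Q ≈[ f , t ] Q′ = ∀ {R} → Deg t R → ⟪ f ·ᶠ (Q ·ᶠ R) ⟫ ≡ ⟪ f ·ᶠ (Q′ ·ᶠ R) ⟫

  -- The functional ⟪ f ·ᶠ _ ⟫ on degree at most M is a combination of
  -- evaluations at the points u with weight u ≢ 0#, and atom u is dual to
  -- evaluation at u.
  record Decomposition {n} (f : Function n) (j M : ℕ) : Set where
    field
      atom     : Vec 𝔽 n → Function n
      Deg-atom : ∀ u → Deg j (atom u)
      weight   : Function n
      evaluate : ∀ {F} → Deg (suc M) F → ∀ u → ⟪ f ·ᶠ (F ·ᶠ atom u) ⟫ ≡ F u ⊗ weight u
      expand   : ∀ {F} → Deg M F → ⟪ f ·ᶠ F ⟫ ≡ ⟪ F ·ᶠ weight ⟫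

  module Flat {n : ℕ} (f : Function n) (j m M : ℕ) (small : suc j + p + M ≤ m)
              (flat : ∀ {Q} → Deg (suc j) Q → ∃ λ Q′ → Deg j Q′ × (Q ≈[ f , m ] Q′)) where

    L : Function n → 𝔽
    L F = ⟪ f ·ᶠ F ⟫

    private
      L-cong : {F G : Function n} → F ≗ G → L F ≡ L G
      L-cong F≗G = ⟪⟫-cong λ x → cong (f x ⊗_) (F≗G x)

      L-+ : (F G : Function n) → L (λ x → F x ⊕ G x) ≡ L F ⊕ L G
      L-+ F G = trans (⟪⟫-cong λ x → ⊗-distribˡ (f x) (F x) (G x)) (⟪⟫-+ (f ·ᶠ F) (f ·ᶠ G))

      L-scale : ∀ c (F : Function n) → L (λ x → c ⊗ F x) ≡ c ⊗ L F
      L-scale c F = trans (⟪⟫-cong λ x → solve 3 (λ f c F → f :* (c :* F) := c :* (f :* F)) refl (f x) c (F x)) (⟪⟫-scale c (f ·ᶠ F))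

      L-0 : {F : Function n} → (∀ x → F x ≡ 0#) → L F ≡ 0#
      L-0 F≡0 = ∑-0 (points n) λ x → trans (cong (f x ⊗_) (F≡0 x)) (⊗-zeroʳ (f x))

      L-swap : (F G : Function n) → L (F ·ᶠ G) ≡ L (G ·ᶠ F)
      L-swap F G = L-cong λ x → ⊗-comm (F x) (G x)

      -- Here t is the loss of precision; s + t ≤ m states without subtraction that test polynomials
      -- have degree at most m - t.
      Lowers : ℕ → Function n → Set
      Lowers t Q = ∃ λ Q′ → Deg j Q′ × (∀ {s R} → s + t ≤ m → Deg s R → L (Q ·ᶠ R) ≡ L (Q′ ·ᶠ R))

      -- For x_l F, the variable joins the test polynomial while F is reduced, and returns for one
      -- use of `flat`. The detour costs one unit of precision.
      lower-step : ∀ {t d} → (∀ {F} → Deg d F → Lowers t F) → ∀ {Q} → Deg (suc d) Q → Lowers (suc t) Q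
      lower-step ih {Q} (const c Q≡c) = Q , const c Q≡c , λ _ _ → refl
      lower-step {t} ih {Q} (var· l dF Q≡) with ih dF
      ... | F′ , dF′ , F≈F′ with flat (var· l dF′ λ _ → refl)
      ...   | F″ , dF″ , xF′≈F″ = F″ , dF″ , λ {s} {R} s+t<m dR → begin
        L (Q ·ᶠ R)  ≡⟨ L-cong (λ x → trans (cong (_⊗ R x) (Q≡ x)) (solve 3 (λ y F R → y :* F :* R := F :* (y :* R)) refl (lookup x l) _ (R x))) ⟩
        L (_ ·ᶠ (λ x → lookup x l ⊗ R x))  ≡⟨ F≈F′ (≤-trans (≤-reflexive (sym (ℕ.+-suc s t))) s+t<m) (var· l dR λ _ → refl) ⟩
        L (F′ ·ᶠ (λ x → lookup x l ⊗ R x))  ≡⟨ L-cong (λ x → solve 3 (λ y F R → F :* (y :* R) := y :* F :* R) refl (lookup x l) (F′ x) (R x)) ⟩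
        L ((λ x → lookup x l ⊗ F′ x) ·ᶠ R)     ≡⟨ xF′≈F″ (Deg-≤ (ℕ.m+n≤o⇒m≤o s s+t<m) dR) ⟩
        L (F″ ·ᶠ R)                             ∎
      lower-step {t} ih {Q} (sum {F = F} {G} dF dG Q≡) with lower-step ih dF | lower-step ih dG
      ... | F′ , dF′ , F≈F′ | G′ , dG′ , G≈G′ = (λ x → F′ x ⊕ G′ x) , Deg-+ dF′ dG′ , λ {s} {R} s+t≤m dR → begin
        L (Q ·ᶠ R)  ≡⟨ L-cong (λ x → trans (cong (_⊗ R x) (Q≡ x)) (⊗-distribʳ (R x) (F x) (G x))) ⟩
        L (λ x → F x ⊗ R x ⊕ G x ⊗ R x)      ≡⟨ L-+ (F ·ᶠ R) (G ·ᶠ R) ⟩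
        L (F ·ᶠ R) ⊕ L (G ·ᶠ R)                ≡⟨ cong₂ _⊕_ (F≈F′ s+t≤m dR) (G≈G′ s+t≤m dR) ⟩
        L (F′ ·ᶠ R) ⊕ L (G′ ·ᶠ R)              ≡⟨ L-+ (F′ ·ᶠ R) (G′ ·ᶠ R) ⟨
        L (λ x → F′ x ⊗ R x ⊕ G′ x ⊗ R x)    ≡⟨ L-cong (λ x → ⊗-distribʳ (R x) (F′ x) (G′ x)) ⟨
        L ((λ x → F′ x ⊕ G′ x) ·ᶠ R)           ∎

      lower : ∀ t {Q} → Deg (suc j + t) Q → Lowers t Q
      lower zero    {Q} dQ with Q′ , dQ′ , Q≈Q′ ← flat (Deg-≤ (≤-reflexive (ℕ.+-identityʳ (suc j))) dQ) =
        Q′ , dQ′ , λ {s} s≤m dR → Q≈Q′ (Deg-≤ (ℕ.m+n≤o⇒m≤o s s≤m) dR)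
      lower (suc t) dQ = lower-step (lower t) (Deg-≤ (≤-reflexive (ℕ.+-suc (suc j) t)) dQ)

      -- The pairing is symmetric in Q and R, so R can be reduced to degree j with Q as its test
      -- polynomial.
      extend : ∀ {d Q} t → d + t ≤ m → Deg d Q → (∀ {R} → Deg j R → L (Q ·ᶠ R) ≡ 0#) → ∀ {R} → Deg (suc j + t) R → L (Q ·ᶠ R) ≡ 0#
      extend {Q = Q} t d+t≤m dQ Q⊥ {R} dR with R′ , dR′ , R≈R′ ← lower t dR =
        trans (L-swap Q R) (trans (R≈R′ d+t≤m dQ) (trans (L-swap R′ Q) (Q⊥ dR′)))

      Low : Set
      Low = ∃ λ (Q : Function n) → Deg j Q

      -- Projection to the eigenvalue a of multiplication by x_l. The indicator raises the degree by
      -- p, and reducing back to degree j costs precision p.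
      step : 𝔽 → Fin n → Low → Low
      step a l (Q , dQ) with Q′ , dQ′ , _ ← lower p (Deg-≤ (≤-trans (≤-reflexive (ℕ.+-comm p j)) (n≤1+n _)) (Deg-* (Deg-indicator a l) dQ)) = Q′ , dQ′

      step-≈ : ∀ a l Q {s R} → s + p ≤ m → Deg s R →
               L (proj₁ (step a l Q) ·ᶠ R) ≡ L ((λ x → indicator a (lookup x l) ⊗ proj₁ Q x) ·ᶠ R)
      step-≈ a l (Q , dQ) s+p≤m dR = sym (proj₂ (proj₂ (lower p _)) s+p≤m dR)

      steps : ∀ {k} → Vec 𝔽 k → Vec (Fin n) k → Low → Low
      steps []      []      Q = Q
      steps (a ∷ u) (l ∷ v) Q = steps u v (step a l Q)

      ∑-indicator : ∀ s → ∑ (allFin q) (λ a → indicator a s) ≡ 1#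
      ∑-indicator s = trans (∑-cong (allFin q) λ a → trans (indicator-⟦⟧ a s) (sym (⊗-identityʳ _))) (∑-allFin-δ s (λ _ → 1#))

      L-∑ : ∀ {A : Set} (as : List A) (φ : A → Function n) → ∑ as (λ a → L (φ a)) ≡ L (λ x → ∑ as (λ a → φ a x))
      L-∑ as φ = trans (∑-swap as (points n)) (⟪⟫-cong λ x → ∑-*ˡ as (f x))

      -- For each coordinate the indicators of all values sum to 1, so the joint projections of Q
      -- add up to Q.
      ∑-steps : ∀ {k} (v : Vec (Fin n) k) Q {s R} → s + p ≤ m → Deg s R →
                ∑ (points k) (λ u → L (proj₁ (steps u v Q) ·ᶠ R)) ≡ L (proj₁ Q ·ᶠ R)
      ∑-steps []      Q         s+p≤m dR = ⊕-identityʳ _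
      ∑-steps {suc k} (l ∷ v) Q {R = R} s+p≤m dR = begin
        ∑ (points (suc k)) (λ u → L (proj₁ (steps u (l ∷ v) Q) ·ᶠ R))
          ≡⟨ ∑-cartesianProductWith _∷_ (allFin q) (points k) ⟩
        ∑ (allFin q) (λ a → ∑ (points k) (λ u → L (proj₁ (steps u v (step a l Q)) ·ᶠ R)))
          ≡⟨ ∑-cong (allFin q) (λ a → trans (∑-steps v (step a l Q) s+p≤m dR) (step-≈ a l Q s+p≤m dR)) ⟩
        ∑ (allFin q) (λ a → L (λ x → indicator a (lookup x l) ⊗ proj₁ Q x ⊗ R x))
          ≡⟨ L-∑ (allFin q) (λ a x → indicator a (lookup x l) ⊗ proj₁ Q x ⊗ R x) ⟩
        L (λ x → ∑ (allFin q) (λ a → indicator a (lookup x l) ⊗ proj₁ Q x ⊗ R x))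
          ≡⟨ L-cong (λ x → trans (∑-*ʳ (allFin q) (R x)) (cong (_⊗ R x) (trans (∑-*ʳ (allFin q) (proj₁ Q x))
               (trans (cong (_⊗ proj₁ Q x) (∑-indicator (lookup x l))) (⊗-identityˡ _))))) ⟩
        L (proj₁ Q ·ᶠ R) ∎

      Eigen : 𝔽 → Fin n → Function n → Set
      Eigen a l Q = ∀ {R} → Deg j R → L ((λ x → (lookup x l ⊖ a) ⊗ Q x) ·ᶠ R) ≡ 0#

      Deg-shift : ∀ a l {s} {R : Function n} → Deg s R → Deg (suc s) (λ x → (lookup x l ⊖ a) ⊗ R x)
      Deg-shift a l = Deg-* (Deg-- (Deg-var l) (Deg-const a))

      [1+j]+p≤m : suc j + p ≤ m
      [1+j]+p≤m = ℕ.m+n≤o⇒m≤o (suc j + p) small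

      shift-step : ∀ a b l l′ Q {R} → Deg j R → L ((λ x → (lookup x l ⊖ a) ⊗ proj₁ (step b l′ Q) x) ·ᶠ R)
                   ≡ L ((λ x → (lookup x l ⊖ a) ⊗ proj₁ Q x) ·ᶠ (λ x → indicator b (lookup x l′) ⊗ R x))
      shift-step a b l l′ Q {R} dR = begin
        L ((λ x → (lookup x l ⊖ a) ⊗ Q′ x) ·ᶠ R)
          ≡⟨ L-cong (λ x → solve 3 (λ y Q R → y :* Q :* R := Q :* (y :* R)) refl (lookup x l ⊖ a) (Q′ x) (R x)) ⟩
        L (Q′ ·ᶠ (λ x → (lookup x l ⊖ a) ⊗ R x))
          ≡⟨ step-≈ b l′ Q [1+j]+p≤m (Deg-shift a l dR) ⟩
        L ((λ x → indicator b (lookup x l′) ⊗ proj₁ Q x) ·ᶠ (λ x → (lookup x l ⊖ a) ⊗ R x))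
          ≡⟨ L-cong (λ x → solve 4 (λ i Q y R → i :* Q :* (y :* R) := y :* Q :* (i :* R)) refl
               (indicator b (lookup x l′)) (proj₁ Q x) (lookup x l ⊖ a) (R x)) ⟩
        L ((λ x → (lookup x l ⊖ a) ⊗ proj₁ Q x) ·ᶠ (λ x → indicator b (lookup x l′) ⊗ R x)) ∎
        where Q′ = proj₁ (step b l′ Q)

      Eigen-create : ∀ a l Q → Eigen a l (proj₁ (step a l Q))
      Eigen-create a l Q {R} dR = trans (shift-step a a l l Q dR) (L-0 λ x → vanish (lookup x l) (proj₁ Q x) (R x))
        where
        vanish : ∀ s b c → (s ⊖ a) ⊗ b ⊗ (indicator a s ⊗ c) ≡ 0#
        vanish s b c with s Fin.≟ a
        ... | yes refl = trans (cong (λ z → z ⊗ b ⊗ (indicator s s ⊗ c)) (a-a≡0 s))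
                           (trans (cong (_⊗ (indicator s s ⊗ c)) (⊗-zeroˡ b)) (⊗-zeroˡ _))
        ... | no  s≢a  = trans (cong ((s ⊖ a) ⊗ b ⊗_) (trans (cong (_⊗ c) (indicator-≢ s≢a)) (⊗-zeroˡ c))) (⊗-zeroʳ _)

      Eigen-extend : ∀ {a l} {Q : Function n} t → suc j + t ≤ m → Deg j Q → Eigen a l Q → ∀ {R} → Deg (suc j + t) R → L ((λ x → (lookup x l ⊖ a) ⊗ Q x) ·ᶠ R) ≡ 0#
      Eigen-extend {a} {l} t 1+j+t≤m dQ eig = extend t 1+j+t≤m (Deg-shift a l dQ) eig

      -- Multiplications by coordinates commute, so the indicator of x_l′ passes to the test
      -- polynomial. That polynomial then exceeds degree j by p, which `Eigen-extend` allows.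
      Eigen-step : ∀ a b l l′ Q → Eigen a l (proj₁ Q) → Eigen a l (proj₁ (step b l′ Q))
      Eigen-step a b l l′ Q eig {R} dR = trans (shift-step a b l l′ Q dR)
        (Eigen-extend {a} {l} {proj₁ Q} p [1+j]+p≤m (proj₂ Q) eig
          (Deg-≤ (≤-trans (≤-reflexive (ℕ.+-comm p j)) (n≤1+n _)) (Deg-* (Deg-indicator b l′) dR)))

      Eigen-steps : ∀ {k} a l (u : Vec 𝔽 k) v Q → Eigen a l (proj₁ Q) → Eigen a l (proj₁ (steps u v Q))
      Eigen-steps a l []      []       Q eig = eig
      Eigen-steps a l (b ∷ u) (l′ ∷ v) Q eig = Eigen-steps a l u v (step b l′ Q) (Eigen-step a b l l′ Q eig)

      Eigen-lookup : ∀ {k} (u : Vec 𝔽 k) v Q i → Eigen (lookup u i) (lookup v i) (proj₁ (steps u v Q))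
      Eigen-lookup (a ∷ u) (l ∷ v) Q zero    = Eigen-steps a l u v (step a l Q) (Eigen-create a l Q)
      Eigen-lookup (a ∷ u) (l ∷ v) Q (suc i) = Eigen-lookup u v (step a l Q) i

      one : Low
      one = (λ _ → 1#) , Deg-const 1#

      atoms : Vec 𝔽 n → Low
      atoms u = steps u (Vec.allFin n) one

      e : Vec 𝔽 n → Function n
      e u = proj₁ (atoms u)

      Eigen-e : ∀ u l → Eigen (lookup u l) l (e u)
      Eigen-e u l = subst (λ i → Eigen (lookup u l) i (e u)) (Vec.lookup-allFin l) (Eigen-lookup u (Vec.allFin n) one l)

      [1+j]+M≤m : suc j + M ≤ m
      [1+j]+M≤m = ≤-trans (+-monoˡ-≤ M (m≤m+n (suc j) p)) small

      -- Each variable of F is replaced by its value at u, because (x_l - u_l)`e u` is annihilated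
      -- by test polynomials of degree up to j + 1 + M.
      evaluate : ∀ {s F} → s ≤ suc M → Deg s F → ∀ u → L (F ·ᶠ e u) ≡ F u ⊗ L (e u)
      evaluate s≤M (const c F≡c) u = trans (L-cong λ x → cong (_⊗ e u x) (F≡c x))
        (trans (L-scale c (e u)) (cong (_⊗ L (e u)) (sym (F≡c u))))
      evaluate {F = G} (s≤s s≤M) (var· {F = F} l dF G≡) u = begin
        L (G ·ᶠ e u)
          ≡⟨ L-cong (λ x → trans (cong (_⊗ e u x) (trans (G≡ x) (cong (_⊗ F x) (sym ([a-b]+b≡a (lookup x l) (lookup u l))))))
               (solve 4 (λ y a F e → (y :+ a) :* F :* e := y :* e :* F :+ a :* (F :* e)) refl (lookup x l ⊖ lookup u l) (lookup u l) (F x) (e u x))) ⟩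
        L (λ x → (lookup x l ⊖ lookup u l) ⊗ e u x ⊗ F x ⊕ lookup u l ⊗ (F x ⊗ e u x))
          ≡⟨ L-+ (λ x → (lookup x l ⊖ lookup u l) ⊗ e u x ⊗ F x) (λ x → lookup u l ⊗ (F x ⊗ e u x)) ⟩
        L (λ x → (lookup x l ⊖ lookup u l) ⊗ e u x ⊗ F x) ⊕ L (λ x → lookup u l ⊗ (F x ⊗ e u x))
          ≡⟨ cong₂ _⊕_ (Eigen-extend {lookup u l} {l} {e u} M [1+j]+M≤m (proj₂ (atoms u)) (Eigen-e u l) (Deg-≤ (≤-trans s≤M (m≤n+m M (suc j))) dF))
               (trans (L-scale (lookup u l) (F ·ᶠ e u)) (cong (lookup u l ⊗_) (evaluate (≤-trans s≤M (n≤1+n M)) dF u))) ⟩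
        0# ⊕ lookup u l ⊗ (F u ⊗ L (e u))
          ≡⟨ trans (⊕-identityˡ _) (trans (sym (⊗-assoc _ _ _)) (cong (_⊗ L (e u)) (sym (G≡ u)))) ⟩
        G u ⊗ L (e u) ∎
      evaluate {F = H} s≤M (sum {F = F} {G} dF dG H≡) u = begin
        L (H ·ᶠ e u)  ≡⟨ L-cong (λ x → trans (cong (_⊗ e u x) (H≡ x)) (⊗-distribʳ (e u x) (F x) (G x))) ⟩
        L (λ x → F x ⊗ e u x ⊕ G x ⊗ e u x)           ≡⟨ L-+ (F ·ᶠ e u) (G ·ᶠ e u) ⟩
        L (F ·ᶠ e u) ⊕ L (G ·ᶠ e u)  ≡⟨ cong₂ _⊕_ (evaluate s≤M dF u) (evaluate s≤M dG u) ⟩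
        F u ⊗ L (e u) ⊕ G u ⊗ L (e u)                 ≡⟨ ⊗-distribʳ (L (e u)) (F u) (G u) ⟨
        (F u ⊕ G u) ⊗ L (e u)                          ≡⟨ cong (_⊗ L (e u)) (H≡ u) ⟨
        H u ⊗ L (e u)                                   ∎

      expand : ∀ {F} → Deg M F → L F ≡ ⟪ F ·ᶠ (λ u → L (e u)) ⟫
      expand {F} dF = begin
        L F                                       ≡⟨ L-cong (λ x → ⊗-identityˡ (F x)) ⟨
        L ((λ _ → 1#) ·ᶠ F)                       ≡⟨ ∑-steps (Vec.allFin n) one M+p≤m dF ⟨
        ∑ (points n) (λ u → L (e u ·ᶠ F))  ≡⟨ ⟪⟫-cong (λ u → trans (L-swap (e u) F) (evaluate (n≤1+n M) dF u)) ⟩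
        ⟪ F ·ᶠ (λ u → L (e u)) ⟫                  ∎
        where
        M+p≤m : M + p ≤ m
        M+p≤m = ≤-trans (≤-reflexive (ℕ.+-comm M p)) (≤-trans (+-monoˡ-≤ M (m≤n+m p (suc j))) small)

    decomposition : Decomposition f j M
    decomposition = record
      { atom = e ; Deg-atom = λ u → proj₂ (atoms u) ; weight = λ u → L (e u)
      ; evaluate = evaluate ≤-refl ; expand = expand }

  module _ {n : ℕ} {f : Function n} {j M : ℕ} (j≤M : j ≤ M) (D : Decomposition f j M) where
    open Decomposition D

    -- The product of x_l, `atom u` and `atom v` can be evaluated at u or at v, which gives
    -- `lookup u l ⊗ w ≡ lookup v l ⊗ w`. At a coordinate where u and v differ this forces w to be
    -- 0.
    atom-≢ : ∀ {u v} → weight u ≢ 0# → u ≢ v → atom v u ≡ 0#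
    atom-≢ {u} {v} wu≢0 u≢v with Fin.any? (λ l → ¬? (lookup u l Fin.≟ lookup v l))
    ... | no  u≗v = contradiction (trans (sym (Vec.tabulate∘lookup u)) (trans (Vec.tabulate-cong λ l →
                      decidable-stable (lookup u l Fin.≟ lookup v l) λ ul≢vl → u≗v (l , ul≢vl)) (Vec.tabulate∘lookup v))) u≢v
    ... | yes (l , ul≢vl) = ab≡0⇒b≡0 (weight u) wu≢0 (trans (⊗-comm (weight u) _) (decidable-stable (_ Fin.≟ _) λ w≢0 →
        ul≢vl (⊗-cancelˡ _ w≢0 (begin
          w ⊗ lookup u l  ≡⟨ solve 3 (λ a b c → a :* b :* c := c :* a :* b) refl (atom v u) (weight u) (lookup u l) ⟩
          lookup u l ⊗ atom v u ⊗ weight u  ≡⟨ evaluate (var· l (Deg-≤ j≤M (Deg-atom v)) λ _ → refl) u ⟨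
          ⟪ f ·ᶠ ((λ x → lookup x l ⊗ atom v x) ·ᶠ atom u) ⟫  ≡⟨ ⟪⟫-cong (λ x → cong (f x ⊗_) (solve 3 (λ a b c → c :* a :* b := c :* b :* a) refl (atom v x) (atom u x) (lookup x l))) ⟩
          ⟪ f ·ᶠ ((λ x → lookup x l ⊗ atom u x) ·ᶠ atom v) ⟫  ≡⟨ evaluate (var· l (Deg-≤ j≤M (Deg-atom u)) λ _ → refl) v ⟩
          lookup v l ⊗ atom u v ⊗ weight v                        ≡⟨ ⊗-assoc _ _ _ ⟩
          lookup v l ⊗ (atom u v ⊗ weight v)  ≡⟨ cong (lookup v l ⊗_) (evaluate (Deg-≤ (≤-trans j≤M (n≤1+n M)) (Deg-atom u)) v) ⟨
          lookup v l ⊗ ⟪ f ·ᶠ (atom u ·ᶠ atom v) ⟫  ≡⟨ cong (lookup v l ⊗_) (⟪⟫-cong λ x → cong (f x ⊗_) (⊗-comm (atom u x) (atom v x))) ⟩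
          lookup v l ⊗ ⟪ f ·ᶠ (atom v ·ᶠ atom u) ⟫  ≡⟨ cong (lookup v l ⊗_) (evaluate (Deg-≤ (≤-trans j≤M (n≤1+n M)) (Deg-atom v)) u) ⟩
          lookup v l ⊗ w                                           ≡⟨ ⊗-comm _ w ⟩
          w ⊗ lookup v l                                           ∎))))
      where w = atom v u ⊗ weight u

    ⟪f·atom⟫ : ∀ u → ⟪ f ·ᶠ atom u ⟫ ≡ weight u
    ⟪f·atom⟫ u = trans (⟪⟫-cong λ x → cong (f x ⊗_) (sym (⊗-identityˡ (atom u x)))) (trans (evaluate (Deg-const 1#) u) (⊗-identityˡ _))

    -- Expanding `⟪ f ·ᶠ atom u ⟫` over all points leaves only the diagonal term, while the same
    -- pairing is `weight u`.
    atom-≡ : ∀ {u} → weight u ≢ 0# → atom u u ≡ 1#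
    atom-≡ {u} wu≢0 = ⊗-cancelˡ (weight u) wu≢0 (begin
      weight u ⊗ atom u u                                   ≡⟨ ⊗-comm _ _ ⟩
      atom u u ⊗ weight u                                   ≡⟨ ∑-vectors-δ u (atom u ·ᶠ weight) ⟨
      ∑ (points n) (λ v → ⟦ v ≟ᵛ u ⟧ ⊗ (atom u v ⊗ weight v))  ≡⟨ ⟪⟫-cong offDiagonal ⟩
      ⟪ atom u ·ᶠ weight ⟫                                   ≡⟨ expand (Deg-≤ j≤M (Deg-atom u)) ⟨
      ⟪ f ·ᶠ atom u ⟫                                        ≡⟨ ⟪f·atom⟫ u ⟩
      weight u                                               ≡⟨ ⊗-identityʳ _ ⟨
      weight u ⊗ 1#                                         ∎)
      where
      offDiagonal : ∀ v → ⟦ v ≟ᵛ u ⟧ ⊗ (atom u v ⊗ weight v) ≡ atom u v ⊗ weight v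
      offDiagonal v with v ≟ᵛ u | weight v Fin.≟ 0#
      ... | yes _   | _        = ⊗-identityˡ _
      ... | no  _   | yes wv≡0 = trans (⊗-zeroˡ _) (sym (trans (cong (atom u v ⊗_) wv≡0) (⊗-zeroʳ _)))
      ... | no  v≢u | no  wv≢0 = trans (⊗-zeroˡ _) (sym (trans (cong (_⊗ weight v) (atom-≢ wv≢0 v≢u)) (⊗-zeroˡ _)))

-- Leading monomials, families of divisors and thick functions.

module LeadingTerms {p : ℕ} (K : FiniteField p) where

  open FiniteField K
  open FieldTheory K
  open Polynomials K
  open Pairing K
  open 𝔽-Solver using (solve; _:=_; _:+_; _:*_)
  open +-*-Solver using () renaming (solve to solveℕ; _:=_ to _≐_; _:+_ to _∔_; _:*_ to _∙_)

  private variable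
    n : ℕ
    F G : Function n
    μ ν : Vec ℕ n

  -- The exponents as digits in base q. Additivity and injectivity on reduced exponents make this
  -- number a monomial order that allows well-founded induction.
  weightℕ : Vec ℕ n → ℕ
  weightℕ []      = 0
  weightℕ (a ∷ α) = a + q * weightℕ α

  weightℕ-⊞ : ∀ (α β : Vec ℕ n) → weightℕ (α ⊞ β) ≡ weightℕ α + weightℕ β
  weightℕ-⊞ []      []      = refl
  weightℕ-⊞ (a ∷ α) (b ∷ β) = trans (cong (λ w → a + b + q * w) (weightℕ-⊞ α β))
    (solveℕ 5 (λ a b c q d → a ∔ b ∔ q ∙ (c ∔ d)
      ≐ (a ∔ q ∙ c) ∔ (b ∔ q ∙ d))
      refl a b (weightℕ α) q (weightℕ β))

  weightℕ-injective : ∀ (α β : Vec ℕ n) → Reduced α → Reduced β → weightℕ α ≡ weightℕ β → α ≡ β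
  weightℕ-injective []      []      _  _  _  = refl
  weightℕ-injective (a ∷ α) (b ∷ β) rα rβ eq = cong₂ _∷_ a≡b (weightℕ-injective α β (rα ∘ suc) (rβ ∘ suc)
      (ℕ.*-cancelˡ-≡ _ _ q (ℕ.+-cancelˡ-≡ b _ _ (trans (cong (_+ q * weightℕ α) (sym a≡b)) eq))))
    where
    a≡b : a ≡ b
    a≡b = let open ≡-Reasoning in begin
      a                          ≡⟨ digit (rα zero) (weightℕ α) ⟨
      (a + q * weightℕ α) % q    ≡⟨ cong (_% q) eq ⟩
      (b + q * weightℕ β) % q    ≡⟨ digit (rβ zero) (weightℕ β) ⟩
      b                          ∎
      where
      digit : ∀ {a} → a < q → ∀ w → (a + q * w) % q ≡ a
      digit {a} a<q w = trans (cong (λ z → (a + z) % q) (ℕ.*-comm q w)) (trans ([m+kn]%n≡m%n a w q) (m<n⇒m%n≡m a<q))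

  -- Leading terms are only taken among monomials of equal degree.
  Lower Lower= : Vec ℕ n → Vec ℕ n → Set
  Lower  μ α = Vec.sum α ≡ Vec.sum μ × weightℕ α < weightℕ μ
  Lower= μ α = Vec.sum α ≡ Vec.sum μ × weightℕ α ≤ weightℕ μ

  record Lead {n} (μ : Vec ℕ n) (F : Function n) : Set where
    constructor lead
    field
      {coeff}  : 𝔽
      coeff≢0  : coeff ≢ 0#
      {rest}   : Function n
      lower    : Span (Lower μ) rest
      equation : ∀ x → F x ≡ coeff ⊗ x ^^ μ ⊕ rest x

  Lead-cong : F ≗ G → Lead μ F → Lead μ G
  Lead-cong F≗G (lead c≢0 low eq) = lead c≢0 low λ x → trans (sym (F≗G x)) (eq x)

  Lead-^^ : (μ : Vec ℕ n) → Lead μ (_^^ μ)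
  Lead-^^ μ = lead 1≢0 (nil λ _ → refl) λ x → sym (trans (⊕-identityʳ _) (⊗-identityˡ _))

  Lead-scale : ∀ c → c ≢ 0# → Lead μ F → Lead μ (λ x → c ⊗ F x)
  Lead-scale {μ = μ} c c≢0 (lead {a} a≢0 {T} low eq) = lead (⊗-≢0 c≢0 a≢0)
    (Span-cong (λ x → cong (_⊗ T x) (trans (cong (c ⊗_) (^^-0 x)) (⊗-identityʳ c)))
      (Span-scale-shift c (Vec.replicate _ 0) (λ {β} (s , w) → subst (Lower μ) (sym (0⊞ β)) (s , w)) low))
    λ x → trans (cong (c ⊗_) (eq x)) (solve 4 (λ c a y t → c :* (a :* y :+ t) := c :* a :* y :+ c :* t) refl c a (x ^^ μ) (T x))
    where
    0⊞ : ∀ {n} (β : Vec ℕ n) → Vec.replicate n 0 ⊞ β ≡ β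
    0⊞ []      = refl
    0⊞ (b ∷ β) = cong (b ∷_) (0⊞ β)

  Lead⇒Span : Lead μ F → Span (Lower= μ) F
  Lead⇒Span (lead {a} a≢0 low eq) = cons a (refl , ≤-refl) (Span-⊆ (λ (s , w) → s , <⇒≤ w) low) eq

  -- Degrees and weights add, so every other product of terms is strictly lower; exponents are never
  -- reduced here, so the leading terms cannot cancel.
  Lead-* : Lead μ F → Lead ν G → Lead (μ ⊞ ν) (F ·ᶠ G)
  Lead-* {μ = μ} {F = F} {ν = ν} {G = G} (lead {a} a≢0 {S} lowS eqF) lG@(lead {b} b≢0 {T} lowT eqG) = lead (⊗-≢0 a≢0 b≢0)
    (Span-+ (Span-scale-shift a μ (λ {β} (s , w) → degree μ β refl s ,
                subst₂ _<_ (sym (weightℕ-⊞ μ β)) (sym (weightℕ-⊞ μ ν)) (ℕ.+-monoʳ-< (weightℕ μ) w)) lowT)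
            (Span-* (λ {α} {β} (s , w) (s′ , w′) → degree α β s s′ ,
                subst₂ _<_ (sym (weightℕ-⊞ α β)) (sym (weightℕ-⊞ μ ν)) (ℕ.+-mono-<-≤ w w′)) lowS (Lead⇒Span lG)))
    λ x → let open ≡-Reasoning in begin
      F x ⊗ G x
        ≡⟨ cong (_⊗ G x) (eqF x) ⟩
      (a ⊗ x ^^ μ ⊕ S x) ⊗ G x
        ≡⟨ ⊗-distribʳ (G x) _ _ ⟩
      a ⊗ x ^^ μ ⊗ G x ⊕ S x ⊗ G x
        ≡⟨ cong (λ g → a ⊗ x ^^ μ ⊗ g ⊕ S x ⊗ G x) (eqG x) ⟩
      a ⊗ x ^^ μ ⊗ (b ⊗ x ^^ ν ⊕ T x) ⊕ S x ⊗ G x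
        ≡⟨ solve 6 (λ a y b z t s → a :* y :* (b :* z :+ t) :+ s := a :* b :* (y :* z) :+ (a :* y :* t :+ s)) refl
             a (x ^^ μ) b (x ^^ ν) (T x) (S x ⊗ G x) ⟩
      a ⊗ b ⊗ (x ^^ μ ⊗ x ^^ ν) ⊕ (a ⊗ x ^^ μ ⊗ T x ⊕ S x ⊗ G x)
        ≡⟨ cong (λ z → a ⊗ b ⊗ z ⊕ (a ⊗ x ^^ μ ⊗ T x ⊕ S x ⊗ G x)) (^^-⊞ x μ ν) ⟨
      a ⊗ b ⊗ x ^^ (μ ⊞ ν) ⊕ (a ⊗ x ^^ μ ⊗ T x ⊕ S x ⊗ G x) ∎
    where
    degree : ∀ α β → Vec.sum α ≡ Vec.sum μ → Vec.sum β ≡ Vec.sum ν → Vec.sum (α ⊞ β) ≡ Vec.sum (μ ⊞ ν)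
    degree α β s s′ = trans (sum-⊞ α β) (trans (cong₂ _+_ s s′) (sym (sum-⊞ μ ν)))

  -- Distinct reduced exponents have distinct weights, so the heaviest one with nonzero coefficient
  -- leads.
  combination-0⊎Lead : ∀ d (ms : List (Vec ℕ n)) → All Reduced ms → All (λ α → Vec.sum α ≡ d) ms → Unique ms →
    (cs : Vec 𝔽 (length ms)) → cs ≡ Vec.replicate _ 0# × (∀ x → combination ms cs x ≡ 0#) ⊎ (∃ λ M → M ∈ₗ ms × Lead M (combination ms cs))
  combination-0⊎Lead d []       _ _ _ [] = inj₁ (refl , λ _ → refl)
  combination-0⊎Lead d (α ∷ ms) (rα ∷ rms) (sα ∷ sms) (α∉ms ∷ uniq) (c ∷ cs)
    with c Fin.≟ 0# | combination-0⊎Lead d ms rms sms uniq cs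
  ... | yes refl | inj₁ (cs≡0 , eq)    = inj₁ (cong (0# ∷_) cs≡0 , λ x → trans (cong₂ _⊕_ (⊗-zeroˡ _) (eq x)) (⊕-identityˡ 0#))
  ... | yes refl | inj₂ (M , M∈ , lM)  = inj₂ (M , there M∈ , Lead-cong (λ x → sym (trans (cong (_⊕ combination ms cs x) (⊗-zeroˡ _)) (⊕-identityˡ _))) lM)
  ... | no  c≢0  | inj₁ (_ , eq)       = inj₂ (α , here refl , lead c≢0 (nil eq) λ x → refl)
  ... | no  c≢0  | inj₂ (M , M∈ , lM@(lead {a} a≢0 {T} low eq)) with ℕ.<-cmp (weightℕ α) (weightℕ M)
  ...   | tri< α<M _ _ = inj₂ (M , there M∈ , lead a≢0
            (cons c (trans sα (sym (All.lookup sms M∈)) , α<M) low λ _ → refl)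
            λ x → trans (cong (c ⊗ x ^^ α ⊕_) (eq x))
              (solve 3 (λ a b c → a :+ (b :+ c) := b :+ (a :+ c)) refl (c ⊗ x ^^ α) (a ⊗ x ^^ M) (T x)))
  ...   | tri≈ _ α≡M _ = contradiction (weightℕ-injective α M rα (All.lookup rms M∈) α≡M) (All.lookup α∉ms M∈)
  ...   | tri> _ _ M<α = inj₂ (α , here refl , lead c≢0
            (Span-⊆ (λ (s , w) → trans s (trans (All.lookup sms M∈) (sym sα)) , ≤-<-trans w M<α) (Lead⇒Span lM)) λ x → refl)

  combination-- : ∀ (ms : List (Vec ℕ n)) cs ds x →
    combination ms (Vec.zipWith _⊖_ cs ds) x ≡ combination ms cs x ⊖ combination ms ds x
  combination-- []       []       []       x = sym (a-a≡0 0#)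
  combination-- (α ∷ ms) (c ∷ cs) (d ∷ ds) x = trans (cong ((c ⊖ d) ⊗ x ^^ α ⊕_) (combination-- ms cs ds x))
    (solve 6 (λ c d m y u v → (c :+ m :* d) :* y :+ (u :+ m :* v) := c :* y :+ u :+ m :* (d :* y :+ v)) refl
      c d -1# (x ^^ α) (combination ms cs x) (combination ms ds x))

  zipWith--≡0 : ∀ {m} (cs ds : Vec 𝔽 m) → Vec.zipWith _⊖_ cs ds ≡ Vec.replicate m 0# → cs ≡ ds
  zipWith--≡0 []       []       _  = refl
  zipWith--≡0 (c ∷ cs) (d ∷ ds) eq = cong₂ _∷_ (a-b≡0⇒a≡b c d (proj₁ (Vec.∷-injective eq))) (zipWith--≡0 cs ds (proj₂ (Vec.∷-injective eq)))

  _⊑_ : Vec ℕ n → Vec ℕ n → Set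
  M ⊑ μ = ∃ λ C → M ⊞ C ≡ μ

  ∷-⊑ : ∀ {a c : ℕ} {M μ : Vec ℕ n} → M ⊑ μ → (a ∷ M) ⊑ (a + c ∷ μ)
  ∷-⊑ {c = c} (C , refl) = c ∷ C , refl

  ⊑-Reduced : ∀ {M μ : Vec ℕ n} → M ⊑ μ → Reduced μ → Reduced M
  ⊑-Reduced {M = M} (C , refl) red l = ≤-<-trans (m≤m+n (lookup M l) (lookup C l))
    (subst (_< q) (Vec.lookup-zipWith _+_ l M C) (red l))

  ⊞-comm : ∀ (α β : Vec ℕ n) → α ⊞ β ≡ β ⊞ α
  ⊞-comm = Vec.zipWith-comm ℕ.+-comm

  fill : ℕ → Vec ℕ n → Vec ℕ n
  fill a []      = []
  fill a (b ∷ μ) = a ⊓ b ∷ fill (a ∸ b) μ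

  fill-⊑ : ∀ a (μ : Vec ℕ n) → fill a μ ⊑ μ
  fill-⊑ a []      = [] , refl
  fill-⊑ a (b ∷ μ) with C , eq ← fill-⊑ (a ∸ b) μ = b ∸ a ∷ C , cong₂ _∷_ (ℕ.m⊓n+n∸m≡n a b) eq

  sum-fill : ∀ a (μ : Vec ℕ n) → a ≤ Vec.sum μ → Vec.sum (fill a μ) ≡ a
  sum-fill a []      a≤0 = sym (ℕ.n≤0⇒n≡0 a≤0)
  sum-fill a (b ∷ μ) a≤b+μ = trans (cong (λ z → a ⊓ b + z) (sum-fill (a ∸ b) μ (ℕ.m≤n+o⇒m∸n≤o a b a≤b+μ)))
    (trans (cong (_+ (a ∸ b)) (ℕ.⊓-comm a b)) (ℕ.m⊓n+n∸m≡n b a))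

  -- Degree-a divisors of μ: subsets of the first v variables of μ, completed
  -- to degree a by a fixed chain of divisors in the remaining variables.
  divisors : (v a : ℕ) → Vec ℕ n → List (Vec ℕ n)
  divisors zero    a μ           = fill a μ ∷ []
  divisors (suc v) a []          = []
  divisors (suc v) a (zero  ∷ μ) = List.map (0 ∷_) (divisors (suc v) a μ)
  divisors (suc v) a (suc b ∷ μ) = List.map (0 ∷_) (divisors v a μ) ++ List.map (1 ∷_) (divisors v (a ∸ 1) μ)

  divisors-unique : ∀ v a (μ : Vec ℕ n) → Unique (divisors v a μ)
  divisors-unique zero    a μ           = [] ∷ []
  divisors-unique (suc v) a []          = []
  divisors-unique (suc v) a (zero  ∷ μ) = Unique.map⁺ Vec.∷-injectiveʳ (divisors-unique (suc v) a μ)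
  divisors-unique (suc v) a (suc b ∷ μ) = Unique.++⁺
    (Unique.map⁺ Vec.∷-injectiveʳ (divisors-unique v a μ)) (Unique.map⁺ Vec.∷-injectiveʳ (divisors-unique v (a ∸ 1) μ))
    λ (∈₀ , ∈₁) → disjoint (∈-map⁻ (0 ∷_) ∈₀) (∈-map⁻ (1 ∷_) ∈₁)
    where
    disjoint : ∀ {α} {xs ys : List (Vec ℕ _)} → (∃ λ β → β ∈ₗ xs × α ≡ 0 ∷ β) → (∃ λ β → β ∈ₗ ys × α ≡ 1 ∷ β) → ⊥
    disjoint (_ , _ , refl) (_ , _ , ())

  -- A variable in which 0 or 1 is chosen is lost with its whole exponent, at most p. The reserve of
  -- v·p leaves enough degree for `fill`.
  divisors-spec : ∀ v a (μ : Vec ℕ n) → Reduced μ → v ≤ a → a + v * p ≤ Vec.sum μ →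
    length (divisors v a μ) ≡ 2 ^ v × All (λ M → M ⊑ μ × Vec.sum M ≡ a) (divisors v a μ)
  divisors-spec zero    a μ  _ _ a≤μ = refl , (fill-⊑ a μ , sum-fill a μ (subst (_≤ Vec.sum μ) (ℕ.+-identityʳ a) a≤μ)) ∷ []
  divisors-spec (suc v) zero    []  _ () _
  divisors-spec (suc v) (suc a) []  _ _ ()
  divisors-spec (suc v) a (zero ∷ μ) red v<a a≤μ with len , all ← divisors-spec (suc v) a μ (red ∘ suc) v<a a≤μ =
    trans (List.length-map (0 ∷_) (divisors (suc v) a μ)) len , All.map⁺ (All.map (λ (M⊑μ , sM) → ∷-⊑ M⊑μ , sM) all)
  divisors-spec (suc v) (suc a) (suc b ∷ μ) red (s≤s v≤a) a≤μ =
    trans (List.length-++ (List.map (0 ∷_) (divisors v (suc a) μ)))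
      (trans (cong₂ _+_ (trans (List.length-map (0 ∷_) (divisors v (suc a) μ)) (proj₁ ih₀))
                        (trans (List.length-map (1 ∷_) (divisors v a μ)) (proj₁ ih₁)))
             (cong (λ z → 2 ^ v + z) (sym (ℕ.+-identityʳ (2 ^ v))))) ,
    All.++⁺ (All.map⁺ (All.map (λ (M⊑μ , sM) → ∷-⊑ M⊑μ , sM) (proj₂ ih₀)))
            (All.map⁺ (All.map (λ (M⊑μ , sM) → ∷-⊑ M⊑μ , cong suc sM) (proj₂ ih₁)))
    where
    a+vp≤μ : suc a + v * p ≤ Vec.sum μ
    a+vp≤μ = ℕ.+-cancelˡ-≤ p _ _ (≤-trans (≤-reflexive
        (solveℕ 3 (λ p a z → p ∔ (a ∔ z) ≐ a ∔ (p ∔ z)) refl p (suc a) (v * p)))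
      (≤-trans a≤μ (+-monoˡ-≤ (Vec.sum μ) (s≤s⁻¹ (red zero)))))
    ih₀ = divisors-spec v (suc a) μ (red ∘ suc) (≤-trans v≤a (n≤1+n a)) a+vp≤μ
    ih₁ = divisors-spec v a μ (red ∘ suc) v≤a (≤-trans (n≤1+n _) a+vp≤μ)

  module ∑ℕ = Sums ℕ.+-*-commutativeSemiring

  length≡∑ : ∀ {A : Set} (xs : List A) → length xs ≡ ∑ℕ.∑ xs (λ _ → 1)
  length≡∑ []       = refl
  length≡∑ (x ∷ xs) = cong suc (length≡∑ xs)

  ∑ℕ-mono-∈ : ∀ {A : Set} (xs : List A) {φ ψ : A → ℕ} → (∀ {x} → x ∈ₗ xs → φ x ≤ ψ x) → ∑ℕ.∑ xs φ ≤ ∑ℕ.∑ xs ψ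
  ∑ℕ-mono-∈ []       φ≤ψ = z≤n
  ∑ℕ-mono-∈ (x ∷ xs) φ≤ψ = +-mono-≤ (φ≤ψ (here refl)) (∑ℕ-mono-∈ xs (φ≤ψ ∘ there))

  ∑ℕ-mono : ∀ {A : Set} (xs : List A) {φ ψ : A → ℕ} → (∀ x → φ x ≤ ψ x) → ∑ℕ.∑ xs φ ≤ ∑ℕ.∑ xs ψ
  ∑ℕ-mono xs φ≤ψ = ∑ℕ-mono-∈ xs (λ {x} _ → φ≤ψ x)

  ⟦⟧≤1 : {P : Set} (d : Dec P) → ∑ℕ.⟦ d ⟧ ≤ 1
  ⟦⟧≤1 (yes _) = s≤s z≤n
  ⟦⟧≤1 (no _)  = z≤n

  ⟦⟧≡0 : {P : Set} (d : Dec P) → ¬ P → ∑ℕ.⟦ d ⟧ ≡ 0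
  ⟦⟧≡0 (yes p) ¬p = contradiction p ¬p
  ⟦⟧≡0 (no _)  ¬p = refl

  ⟦⟧-mono : {P Q : Set} (d : Dec P) (d′ : Dec Q) → (P → Q) → ∑ℕ.⟦ d ⟧ ≤ ∑ℕ.⟦ d′ ⟧
  ⟦⟧-mono (no _)  d′       f = z≤n
  ⟦⟧-mono (yes p) (yes _)  f = ≤-refl
  ⟦⟧-mono (yes p) (no ¬q)  f = contradiction (f p) ¬q

  ⟦⟧-*-mono : {P Q R : Set} (d : Dec P) (d′ : Dec Q) (d″ : Dec R) → (P → Q → R) → ∑ℕ.⟦ d ⟧ * ∑ℕ.⟦ d′ ⟧ ≤ ∑ℕ.⟦ d″ ⟧
  ⟦⟧-*-mono (no _)  d′ d″ f = z≤n
  ⟦⟧-*-mono (yes p) d′ d″ f = ≤-trans (≤-reflexive (ℕ.*-identityˡ ∑ℕ.⟦ d′ ⟧)) (⟦⟧-mono d′ d″ (f p))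

  ∑ℕ-const : ∀ {A : Set} (xs : List A) c → ∑ℕ.∑ xs (λ _ → c) ≡ length xs * c
  ∑ℕ-const []       c = refl
  ∑ℕ-const (x ∷ xs) c = cong (λ z → c + z) (∑ℕ-const xs c)

  length-points : ∀ n → length (points n) ≡ q ^ n
  length-points n = let open ≡-Reasoning in begin
    length (points n)                              ≡⟨ length≡∑ (points n) ⟩
    ∑ℕ.∑ (points n) (λ _ → 1)  ≡⟨ ∑ℕ.∑-cong (points n) (λ v → sym (∑ℕ.∏-1 n (λ _ → refl))) ⟩
    ∑ℕ.∑ (points n) (λ v → ∑ℕ.∏ n (λ _ → 1))       ≡⟨ ∑ℕ.∑-vectors-∏ (allFin q) n (λ _ _ → 1) ⟩
    ∑ℕ.∏ n (λ _ → ∑ℕ.∑ (allFin q) (λ _ → 1))  ≡⟨ ∑ℕ.∏-cong n (λ _ → trans (sym (length≡∑ (allFin q))) (List.length-tabulate id)) ⟩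
    ∑ℕ.∏ n (λ _ → q)                               ≡⟨ power n ⟩
    q ^ n                                          ∎
    where
    power : ∀ n → ∑ℕ.∏ n (λ _ → q) ≡ q ^ n
    power zero    = refl
    power (suc n) = cong (q *_) (power n)

  -- The factor k! c ∏ⱼ (wⱼ − wⱼ′) left by k finite differences of a polynomial
  -- with leading coefficient c has degree above D for all choices of wⱼ ≢ wⱼ′.
  data Thick {n} (size D e : ℕ) : ℕ → Function n → Set where
    base : ∀ {c} → ¬ Deg D c → Thick size D e 0 c
    step : ∀ {k c N} (Λ : List (Vec 𝔽 N)) (w : Vec 𝔽 N → Function n) → size ≤ length Λ →
           (∀ γ → ∑ℕ.∑ Λ (λ γ′ → ∑ℕ.⟦ γ′ ≟ᵛ γ ⟧) ≤ 1) →
           (∀ γ → Deg e (w γ)) →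
           (∀ {γ γ′} → γ ∈ₗ Λ → γ′ ∈ₗ Λ → γ ≢ γ′ → Thick size D e k (λ x → [ suc k ] ⊗ ((w γ x ⊖ w γ′ x) ⊗ c x))) →
           Thick size D e (suc k) c

  -- If the q^s fibres all had fewer elements than the required number, which is at most q^t,
  -- together they would have fewer than q^N.
  pigeonhole : ∀ {N s t X} (key : Vec 𝔽 N → Vec 𝔽 s) → s + t ≡ N → X ≤ q ^ t →
               ∃ λ κ → X ≤ length (filter (λ γ → key γ ≟ᵛ κ) (points N))
  pigeonhole {N} {s} {t} {zero}  key _ _ = Vec.replicate s 0# , z≤n
  pigeonhole {N} {s} {t} {suc X} key s+t≡N X<q^t with ∃Vec? s (λ κ → suc X ℕ.≤? length (filter (λ γ → key γ ≟ᵛ κ) (points N)))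
  ... | yes found = found
  ... | no  none  = contradiction (<-≤-trans q^N< (≤-reflexive (trans (cong (λ z → q ^ z) (sym s+t≡N)) (^-distribˡ-+-* q s t)))) (ℕ.≤⇒≯ q^N≤)
    where
    open ℕ.≤-Reasoning
    q^N< : q ^ s * X < q ^ N
    q^N< = begin-strict
      q ^ s * X         <⟨ ℕ.*-monoʳ-< (q ^ s) {{ℕ.m^n≢0 q s}} X<q^t ⟩
      q ^ s * q ^ t     ≡⟨ ^-distribˡ-+-* q s t ⟨
      q ^ (s + t)       ≡⟨ cong (λ z → q ^ z) s+t≡N ⟩
      q ^ N             ∎
    q^N≤ : q ^ s * q ^ t ≤ q ^ s * X
    q^N≤ = begin
      q ^ s * q ^ t
        ≡⟨ trans (sym (^-distribˡ-+-* q s t)) (cong (λ z → q ^ z) s+t≡N) ⟩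
      q ^ N
        ≡⟨ trans (sym (length-points N)) (length≡∑ (points N)) ⟩
      ∑ℕ.∑ (points N) (λ _ → 1)
        ≡⟨ ∑ℕ.∑-cong (points N) (λ γ → sym (∑ℕ.∑-vectors-δ (key γ) (λ _ → 1))) ⟩
      ∑ℕ.∑ (points N) (λ γ → ∑ℕ.∑ (points s) (λ κ → ∑ℕ.⟦ κ ≟ᵛ key γ ⟧ * 1))
        ≡⟨ ∑ℕ.∑-swap (points N) (points s) ⟩
      ∑ℕ.∑ (points s) (λ κ → ∑ℕ.∑ (points N) (λ γ → ∑ℕ.⟦ κ ≟ᵛ key γ ⟧ * 1))
        ≡⟨ ∑ℕ.∑-cong (points s) (λ κ → trans (∑ℕ.∑-cong (points N) λ γ → cong (_* 1)
             (∑ℕ.⟦⟧-cong {d = κ ≟ᵛ key γ} {d′ = key γ ≟ᵛ κ} sym sym))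
             (trans (sym (∑ℕ.∑-filter (λ γ → key γ ≟ᵛ κ) (points N))) (sym (length≡∑ (filter (λ γ → key γ ≟ᵛ κ) (points N)))))) ⟩
      ∑ℕ.∑ (points s) (λ κ → length (filter (λ γ → key γ ≟ᵛ κ) (points N)))
        ≤⟨ ∑ℕ-mono (points s) (λ κ → s≤s⁻¹ (≰⇒> λ X< → none (κ , X<))) ⟩
      ∑ℕ.∑ (points s) (λ _ → X)
        ≡⟨ trans (∑ℕ-const (points s) X) (cong (_* X) (length-points s)) ⟩
      q ^ s * X ∎

  module _ {n : ℕ} (Z : List (Vec 𝔽 n)) (size t v : ℕ) (size≤ : size ≤ q ^ t) (|Z|+t≡2^v : length Z + t ≡ 2 ^ v) where

    -- The coefficient vectors are taken from one fibre of the values on Z, so differences of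
    -- directions vanish on Z. Such a difference is a nonzero combination of divisors of ν, so its
    -- leading monomial M divides ν.
    thick-step : ∀ {D e a k} {c : Function n} (ν : Vec ℕ n) → Reduced ν → v ≤ a → a ≤ e → a + v * p ≤ Vec.sum ν →
      (∀ {M C u} → M ⊞ C ≡ ν → Vec.sum M ≡ a → Lead M u → All (λ z → u z ≡ 0#) Z →
         Thick size D e k (λ x → [ suc k ] ⊗ (u x ⊗ c x))) →
      Thick size D e (suc k) c
    thick-step {D} {e} {a} {k} {c} ν red v≤a a≤e large next = step Λ w size≤Λ once
        (λ γ → combination⇒Deg ms γ (All.map (λ (_ , sM) → ≤-trans (≤-reflexive sM) a≤e) spec)) next′
      where
      ms = divisors v a ν
      len = proj₁ (divisors-spec v a ν red v≤a large)
      spec = proj₂ (divisors-spec v a ν red v≤a large)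
      w : Vec 𝔽 (length ms) → Function n
      w = combination ms
      key : Vec 𝔽 (length ms) → Vec 𝔽 (length Z)
      key γ = Vec.map (w γ) (fromList Z)
      found = pigeonhole {t = t} key (trans |Z|+t≡2^v (sym len)) size≤
      keyed : Decidable (λ γ → key γ ≡ proj₁ found)
      keyed γ = key γ ≟ᵛ proj₁ found
      Λ = filter keyed (points (length ms))
      size≤Λ : size ≤ length Λ
      size≤Λ = proj₂ found
      once : ∀ γ → ∑ℕ.∑ Λ (λ γ′ → ∑ℕ.⟦ γ′ ≟ᵛ γ ⟧) ≤ 1
      once γ = ≤-trans (≤-reflexive (trans (∑ℕ.∑-filter keyed (points (length ms)))
          (∑ℕ.∑-cong (points (length ms)) λ γ′ → ℕ.*-comm ∑ℕ.⟦ keyed γ′ ⟧ ∑ℕ.⟦ γ′ ≟ᵛ γ ⟧)))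
        (≤-trans (≤-reflexive (∑ℕ.∑-vectors-δ γ (λ γ′ → ∑ℕ.⟦ keyed γ′ ⟧))) (⟦⟧≤1 (keyed γ)))
      map-≡⇒All : ∀ {F G : Function n} (Z : List (Vec 𝔽 n)) → Vec.map F (fromList Z) ≡ Vec.map G (fromList Z) → All (λ z → F z ≡ G z) Z
      map-≡⇒All []      _  = []
      map-≡⇒All (z ∷ Z) eq = proj₁ (Vec.∷-injective eq) ∷ map-≡⇒All Z (proj₂ (Vec.∷-injective eq))
      next′ : ∀ {γ γ′} → γ ∈ₗ Λ → γ′ ∈ₗ Λ → γ ≢ γ′ → Thick size D e k (λ x → [ suc k ] ⊗ ((w γ x ⊖ w γ′ x) ⊗ c x))
      next′ {γ} {γ′} γ∈ γ′∈ γ≢γ′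
        with combination-0⊎Lead a ms (All.map (λ (M⊑ν , _) → ⊑-Reduced M⊑ν red) spec) (All.map proj₂ spec) (divisors-unique v a ν) (Vec.zipWith _⊖_ γ γ′)
      ... | inj₁ (eq , _) = contradiction (zipWith--≡0 γ γ′ eq) γ≢γ′
      ... | inj₂ (M , M∈ , lM) with (C , M⊞C≡ν) , sM ← All.lookup spec M∈ = next M⊞C≡ν sM
            (Lead-cong (combination-- ms γ γ′) lM)
            (All.map (λ {z} wz≡ → trans (cong (_⊖ w γ′ z) wz≡) (a-a≡0 (w γ′ z)))
              (map-≡⇒All Z (trans (proj₂ (∈-filter⁻ keyed {xs = points (length ms)} γ∈)) (sym (proj₂ (∈-filter⁻ keyed {xs = points (length ms)} γ′∈))))))

  module _ {n : ℕ} (size v : ℕ) (size≤ : size ≤ q ^ (2 ^ v)) {D e a m : ℕ} (v≤a : v ≤ a) (a≤e : a ≤ e) where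

    Regular : Vec ℕ n → Function n → Set
    Regular ν c = ∀ {Y} → Lead ν Y → ¬ Orth m (c ·ᶠ Y)

    Regular-step : ∀ k {M C ν u c} → suc k ≤ p → M ⊞ C ≡ ν → Lead M u →
                   (∀ {Y} → Lead C Y → ¬ Orth m (c ·ᶠ (u ·ᶠ Y))) → Regular C (λ x → [ suc k ] ⊗ (u x ⊗ c x))
    Regular-step k {u = u} {c} k<p _ lu reg {Y} lY orth = reg (Lead-scale [ suc k ] ([m]≢0 (s≤s z≤n) (s≤s k<p)) lY)
      (Orth-cong (λ x → solve 4 (λ s u c y → s :* (u :* c) :* y := c :* (u :* (s :* y))) refl [ suc k ] (u x) (c x) (Y x)) orth)

    -- If u leads with M and Y with the cofactor C, then uY leads with ν; so multiplying c by u
    -- keeps it regular, now at C. The degree of ν and k·a both drop by a, which preserves the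
    -- degree condition. After k steps, degree at most D would make the product with x^ν orthogonal
    -- to degree m.
    thick : ∀ k {ν c} → k ≤ p → Reduced ν → k * a + v * p ≤ Vec.sum ν → D + Vec.sum ν + m < n * p + k * a →
            Regular ν c → Thick size D e k c
    thick zero {ν} {c} _ _ _ small reg = base λ dc → reg (Lead-^^ ν) (Deg⇒Orth {t = m}
      (Deg-* dc (Deg-^^ ν)) (subst (D + Vec.sum ν + m <_) (ℕ.+-identityʳ (n * p)) small))
    thick (suc k) {ν} {c} k<p red large small reg =
      thick-step [] size (2 ^ v) v size≤ refl ν red v≤a a≤e
        (≤-trans (+-monoˡ-≤ (v * p) (m≤m+n a (k * a))) large)
        λ {M} {C} {u} eq sM lu _ → thick k (<⇒≤ k<p) (⊑-Reduced (M , trans (⊞-comm C M) eq) red)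
          (large′ eq sM) (small′ eq sM)
          (Regular-step k k<p eq lu λ {Y} lY orth → reg (subst (λ ν → Lead ν (u ·ᶠ Y)) eq (Lead-* lu lY)) orth)
      where
      |ν| : ∀ {M C} → M ⊞ C ≡ ν → Vec.sum M ≡ a → Vec.sum ν ≡ a + Vec.sum C
      |ν| {M} {C} refl refl = sum-⊞ M C
      large′ : ∀ {M C} → M ⊞ C ≡ ν → Vec.sum M ≡ a → k * a + v * p ≤ Vec.sum C
      large′ eq sM = ℕ.+-cancelˡ-≤ a _ _ (subst₂ _≤_ (ℕ.+-assoc a (k * a) (v * p)) (|ν| eq sM) large)
      small′ : ∀ {M C} → M ⊞ C ≡ ν → Vec.sum M ≡ a → D + Vec.sum C + m < n * p + k * a
      small′ {M} {C} eq sM = ℕ.+-cancelˡ-< a _ _ (subst₂ _<_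
        (trans (cong (λ z → D + z + m) (|ν| eq sM)) (solveℕ 4 (λ D a C m →
          D ∔ (a ∔ C) ∔ m ≐ a ∔ (D ∔ C ∔ m)) refl D a (Vec.sum C) m))
        (solveℕ 3 (λ x a y → x ∔ (a ∔ y) ≐ a ∔ (x ∔ y)) refl (n * p) a (k * a))
        small)

-- Counting in the code: translation invariance, Cauchy-Schwarz and iterated differences.

module Counting {p : ℕ} (K : FiniteField p) where

  open FiniteField K
  open FieldTheory K
  open Polynomials K
  open Pairing K
  open LeadingTerms K
  open ∑ℕ
  open +-*-Solver using (solve; con; _:=_; _:+_; _:*_)
  open ℕ.≤-Reasoning

  private variable n : ℕ

  monomials : (n d : ℕ) → List (Vec ℕ n)
  monomials n d = ReedMuller.monomials q n d

  private
    ∈-vectors : ∀ d (α : Vec ℕ n) → Vec.sum α ≤ d → α ∈ₗ vectors (upTo (suc d)) n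
    ∈-vectors d []      _   = here refl
    ∈-vectors d (a ∷ α) a≤d = ∈-cartesianProductWith⁺ _∷_ (∈-upTo⁺ (s≤s (ℕ.m+n≤o⇒m≤o a a≤d)))
      (∈-vectors d α (ℕ.m+n≤o⇒n≤o a a≤d))

  ∈-monomials : ∀ {d} {α : Vec ℕ n} → Vec.sum α ≤ d → α ∈ₗ monomials n d
  ∈-monomials {d = d} {α} α≤d = ∈-filter⁺ (λ α → Vec.sum α ℕ.≤? d) (∈-vectors d α α≤d) α≤d

  monomials-≤ : ∀ n d → All (λ α → Vec.sum α ≤ d) (monomials n d)
  monomials-≤ n d = All.all-filter (λ α → Vec.sum α ℕ.≤? d) (vectors (upTo (suc d)) n)

  IsEval : ∀ {n} → ℕ → Function n → Set
  IsEval {n} d F = ∃ λ cs → ∀ x → combination (monomials n d) cs x ≡ F x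

  IsEval? : ∀ d (F : Function n) → Dec (IsEval d F)
  IsEval? {n} d F = ∃Vec? _ λ cs → ∀Vec? n λ x → combination (monomials n d) cs x Fin.≟ F x

  IsEval⇒Deg : ∀ {d} {F : Function n} → IsEval d F → Deg d F
  IsEval⇒Deg {n} {d} (cs , eq) = Deg-cong eq (combination⇒Deg (monomials n d) cs (monomials-≤ n d))

  Deg⇒IsEval : ∀ {d} {F : Function n} → Deg d F → IsEval d F
  Deg⇒IsEval dF = Span⇒combination (monomials _ _) ∈-monomials (Deg⇒Span dF)

  Deg? : ∀ d (F : Function n) → Dec (Deg d F)
  Deg? d F = map′ IsEval⇒Deg Deg⇒IsEval (IsEval? d F)

  code : (n e : ℕ) → List (Function n)
  code n e = filter (Deg? e) (functions n)

  Respects : (Function n → ℕ) → Set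
  Respects ψ = ∀ {F G} → F ≗ G → ψ F ≡ ψ G

  ∑-functions-δ : ∀ (ψ : Function n → ℕ) → Respects ψ → ∀ F → ∑ (functions n) (λ Q → ⟦ Q ≗? F ⟧ * ψ Q) ≡ ψ F
  ∑-functions-δ {n} ψ resp F = begin-equality
    ∑ (functions n) (λ Q → ⟦ Q ≗? F ⟧ * ψ Q)  ≡⟨ ∑-cong (functions n) (λ Q → ⟦⟧-*-cong (Q ≗? F) (resp {Q} {F})) ⟩
    ∑ (functions n) (λ Q → ⟦ Q ≗? F ⟧ * ψ F)    ≡⟨ ∑-*ʳ (functions n) (ψ F) ⟩
    ∑ (functions n) (λ Q → ⟦ Q ≗? F ⟧) * ψ F    ≡⟨ cong (_* ψ F) (∑-functions-once n F) ⟩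
    1 * ψ F                                     ≡⟨ ℕ.*-identityˡ (ψ F) ⟩
    ψ F                                         ∎

  _⊕ᶠ_ : Function n → Function n → Function n
  (P ⊕ᶠ w) x = P x ⊕ w x

  ⟦≗⊕⟧ : ∀ (P Q w : Function n) → ⟦ Q ≗? (P ⊕ᶠ w) ⟧ ≡ ⟦ P ≗? (λ x → Q x ⊖ w x) ⟧
  ⟦≗⊕⟧ P Q w = ⟦⟧-cong {d = Q ≗? (P ⊕ᶠ w)} {d′ = P ≗? (λ x → Q x ⊖ w x)}
    (λ eq x → sym (trans (cong (_⊖ w x) (eq x)) ([a+b]-b≡a (P x) (w x))))
    (λ eq x → sym (trans (cong (_⊕ w x) (eq x)) ([a-b]+b≡a (Q x) (w x))))

  ∑-functions-shift : ∀ (ψ : Function n → ℕ) → Respects ψ → ∀ w → ∑ (functions n) (λ P → ψ (P ⊕ᶠ w)) ≡ ∑ (functions n) ψ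
  ∑-functions-shift {n} ψ resp w = begin-equality
    ∑ (functions n) (λ P → ψ (P ⊕ᶠ w))
      ≡⟨ ∑-cong (functions n) (λ P → sym (∑-functions-δ ψ resp (P ⊕ᶠ w))) ⟩
    ∑ (functions n) (λ P → ∑ (functions n) (λ Q → ⟦ Q ≗? (P ⊕ᶠ w) ⟧ * ψ Q))
      ≡⟨ ∑-swap (functions n) (functions n) {λ P Q → ⟦ Q ≗? (P ⊕ᶠ w) ⟧ * ψ Q} ⟩
    ∑ (functions n) (λ Q → ∑ (functions n) (λ P → ⟦ Q ≗? (P ⊕ᶠ w) ⟧ * ψ Q))
      ≡⟨ ∑-cong (functions n) (λ Q → ∑-*ʳ (functions n) (ψ Q) {λ P → ⟦ Q ≗? (P ⊕ᶠ w) ⟧}) ⟩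
    ∑ (functions n) (λ Q → ∑ (functions n) (λ P → ⟦ Q ≗? (P ⊕ᶠ w) ⟧) * ψ Q)
      ≡⟨ ∑-cong (functions n) (λ Q → cong (_* ψ Q) (trans (∑-cong (functions n) (λ P → ⟦≗⊕⟧ P Q w)) (∑-functions-once n (λ x → Q x ⊖ w x)))) ⟩
    ∑ (functions n) (λ Q → 1 * ψ Q)
      ≡⟨ ∑-cong (functions n) (λ Q → ℕ.*-identityˡ (ψ Q)) ⟩
    ∑ (functions n) ψ ∎

  -- The code is closed under adding and subtracting w. The shifted function is listed only up to
  -- `≗`, hence `Respects`.
  ∑-code-shift : ∀ {e} (ψ : Function n → ℕ) → Respects ψ → ∀ {w} → Deg e w → ∑ (code n e) (λ P → ψ (λ x → P x ⊕ w x)) ≡ ∑ (code n e) ψ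
  ∑-code-shift {n} {e} ψ resp {w} dw = begin-equality
    ∑ (code n e) (λ P → ψ (λ x → P x ⊕ w x))
      ≡⟨ ∑-filter (Deg? e) (functions n) ⟩
    ∑ (functions n) (λ P → ⟦ Deg? e P ⟧ * ψ (λ x → P x ⊕ w x))
      ≡⟨ ∑-cong (functions n) (λ P → cong (_* ψ (λ x → P x ⊕ w x)) (⟦⟧-cong {d = Deg? e P} {d′ = Deg? e (λ x → P x ⊕ w x)}
           (λ dP → Deg-+ dP dw) (λ dP+w → Deg-cong (λ x → [a+b]-b≡a (P x) (w x)) (Deg-- dP+w dw)))) ⟩
    ∑ (functions n) (λ P → ⟦ Deg? e (λ x → P x ⊕ w x) ⟧ * ψ (λ x → P x ⊕ w x))
      ≡⟨ ∑-functions-shift (λ P → ⟦ Deg? e P ⟧ * ψ P)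
           (λ {F} {G} F≗G → cong₂ _*_ (⟦⟧-cong {d = Deg? e F} {d′ = Deg? e G} (Deg-cong F≗G) (Deg-cong (sym ∘ F≗G))) (resp F≗G)) w ⟩
    ∑ (functions n) (λ P → ⟦ Deg? e P ⟧ * ψ P)
      ≡⟨ ∑-filter (Deg? e) (functions n) ⟨
    ∑ (code n e) ψ ∎

  2ab≤a²+b² : ∀ a b → 2 * (a * b) ≤ a * a + b * b
  2ab≤a²+b² a b with ℕ.≤-total a b
  ... | inj₁ a≤b with d , refl ← ℕ.m≤n⇒∃[o]m+o≡n a≤b = ≤-trans (m≤m+n _ (d * d))
    (≤-reflexive (solve 2 (λ a d → con 2 :* (a :* (a :+ d)) :+ d :* d := a :* a :+ (a :+ d) :* (a :+ d)) refl a d))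
  ... | inj₂ b≤a with d , refl ← ℕ.m≤n⇒∃[o]m+o≡n b≤a = ≤-trans (m≤m+n _ (d * d))
    (≤-reflexive (solve 2 (λ b d → con 2 :* ((b :+ d) :* b) :+ d :* d := (b :+ d) :* (b :+ d) :+ b :* b) refl b d))

  cauchy-schwarz : ∀ {A : Set} (xs : List A) (φ : A → ℕ) → ∑ xs φ * ∑ xs φ ≤ length xs * ∑ xs (λ x → φ x * φ x)
  cauchy-schwarz []       φ = z≤n
  cauchy-schwarz (x ∷ xs) φ = begin
    (a + S) * (a + S)  ≡⟨ solve 2 (λ a S → (a :+ S) :* (a :+ S) := a :* a :+ con 2 :* (a :* S) :+ S :* S) refl a S ⟩
    a * a + 2 * (a * S) + S * S  ≤⟨ +-mono-≤ (+-monoʳ-≤ (a * a) (cross xs)) (cauchy-schwarz xs φ) ⟩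
    a * a + (N * (a * a) + T) + N * T  ≡⟨ solve 3 (λ a N T → a :* a :+ (N :* (a :* a) :+ T) :+ N :* T := (con 1 :+ N) :* (a :* a :+ T)) refl a N T ⟩
    suc N * (a * a + T)                      ∎
    where
    a = φ x
    S = ∑ xs φ
    N = length xs
    T = ∑ xs (λ x → φ x * φ x)
    cross : ∀ xs → 2 * (a * ∑ xs φ) ≤ length xs * (a * a) + ∑ xs (λ x → φ x * φ x)
    cross []       = ≤-reflexive (cong (2 *_) (ℕ.*-zeroʳ a))
    cross (y ∷ ys) = begin
      2 * (a * (φ y + ∑ ys φ))  ≡⟨ solve 3 (λ a b S → con 2 :* (a :* (b :+ S)) := con 2 :* (a :* b) :+ con 2 :* (a :* S)) refl a (φ y) (∑ ys φ) ⟩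
      2 * (a * φ y) + 2 * (a * ∑ ys φ)  ≤⟨ +-mono-≤ (2ab≤a²+b² a (φ y)) (cross ys) ⟩
      a * a + φ y * φ y + (length ys * (a * a) + ∑ ys (λ x → φ x * φ x))  ≡⟨ solve 4 (λ a b c d → a :+ b :+ (c :+ d) := a :+ c :+ (b :+ d)) refl (a * a) (φ y * φ y) (length ys * (a * a)) _ ⟩
      a * a + length ys * (a * a) + (φ y * φ y + ∑ ys (λ x → φ x * φ x))    ∎

  uniformBound : ∀ {A : Set} (xs : List A) (φ : A → ℕ) {P : ℕ → Set} → P 0 → (∀ {x} → x ∈ₗ xs → P (φ x)) →
                 ∃ λ β → P β × (∀ {x} → x ∈ₗ xs → φ x ≤ β)
  uniformBound []       φ p0 _  = 0 , p0 , λ ()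
  uniformBound (x ∷ xs) φ p0 pφ with β , pβ , ≤β ← uniformBound xs φ p0 (pφ ∘ there) with ℕ.≤-total (φ x) β
  ... | inj₁ x≤β = β , pβ , λ { (here refl) → x≤β ; (there y∈) → ≤β y∈ }
  ... | inj₂ β≤x = φ x , pφ (here refl) , λ { (here refl) → ≤-refl ; (there y∈) → ≤-trans (≤β y∈) β≤x }

  [a+b]^k≤ : ∀ a b k → (a + b) ^ k ≤ 2 ^ k * (a ^ k + b ^ k)
  [a+b]^k≤ a b k with ℕ.≤-total a b
  ... | inj₁ a≤b = begin
    (a + b) ^ k                  ≤⟨ ^-monoˡ-≤ k (+-monoˡ-≤ b a≤b) ⟩
    (b + b) ^ k                  ≡⟨ cong (_^ k) (solve 1 (λ b → b :+ b := con 2 :* b) refl b) ⟩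
    (2 * b) ^ k                  ≡⟨ ^-distribʳ-* 2 b k ⟩
    2 ^ k * b ^ k                ≤⟨ *-monoʳ-≤ (2 ^ k) (m≤n+m (b ^ k) (a ^ k)) ⟩
    2 ^ k * (a ^ k + b ^ k)      ∎
  ... | inj₂ b≤a = begin
    (a + b) ^ k                  ≤⟨ ^-monoˡ-≤ k (+-monoʳ-≤ a b≤a) ⟩
    (a + a) ^ k                  ≡⟨ cong (_^ k) (solve 1 (λ b → b :+ b := con 2 :* b) refl a) ⟩
    (2 * a) ^ k                  ≡⟨ ^-distribʳ-* 2 a k ⟩
    2 ^ k * a ^ k                ≤⟨ *-monoʳ-≤ (2 ^ k) (m≤m+n (a ^ k) (b ^ k)) ⟩
    2 ^ k * (a ^ k + b ^ k)      ∎

  -- Raising the sum to the power L costs a factor 2^L. In (sβ)^L the hypothesis on β absorbs one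
  -- factor s, and the remaining s^(L-1) cancels.
  power-bound : ∀ L s E g β B → .{{_ : NonZero L}} → .{{_ : NonZero s}} →
                s * (E * E) ≤ g * (g + s * β) → β ^ L * s ≤ B * g ^ L →
                (E * E) ^ L * s ≤ 2 ^ L * (1 + B) * (g * g) ^ L
  power-bound (suc K) s E g β B sE²≤ β≤ = ℕ.*-cancelˡ-≤ (s ^ K) {{ℕ.m^n≢0 s K}} (begin
    s ^ K * ((E * E) ^ suc K * s)
      ≡⟨ solve 3 (λ a b c → a :* (b :* c) := c :* a :* b) refl (s ^ K) ((E * E) ^ suc K) s ⟩
    s ^ suc K * (E * E) ^ suc K
      ≡⟨ ^-distribʳ-* s (E * E) (suc K) ⟨
    (s * (E * E)) ^ suc K
      ≤⟨ ^-monoˡ-≤ (suc K) sE²≤ ⟩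
    (g * (g + s * β)) ^ suc K
      ≡⟨ ^-distribʳ-* g (g + s * β) (suc K) ⟩
    g ^ suc K * (g + s * β) ^ suc K
      ≤⟨ *-monoʳ-≤ (g ^ suc K) ([a+b]^k≤ g (s * β) (suc K)) ⟩
    g ^ suc K * (2 ^ suc K * (g ^ suc K + (s * β) ^ suc K))
      ≤⟨ *-monoʳ-≤ (g ^ suc K) (*-monoʳ-≤ (2 ^ suc K) (+-mono-≤ (m≤n*m (g ^ suc K) (s ^ K) {{ℕ.m^n≢0 s K}}) sβ≤)) ⟩
    g ^ suc K * (2 ^ suc K * (s ^ K * g ^ suc K + s ^ K * (B * g ^ suc K)))
      ≡⟨ solve 4 (λ G t S B → G :* (t :* (S :* G :+ S :* (B :* G))) := S :* (t :* (con 1 :+ B) :* (G :* G))) refl (g ^ suc K) (2 ^ suc K) (s ^ K) B ⟩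
    s ^ K * (2 ^ suc K * (1 + B) * (g ^ suc K * g ^ suc K))
      ≡⟨ cong (λ z → s ^ K * (2 ^ suc K * (1 + B) * z)) (sym (^-distribʳ-* g g (suc K))) ⟩
    s ^ K * (2 ^ suc K * (1 + B) * (g * g) ^ suc K) ∎)
    where
    sβ≤ : (s * β) ^ suc K ≤ s ^ K * (B * g ^ suc K)
    sβ≤ = begin
      (s * β) ^ suc K             ≡⟨ ^-distribʳ-* s β (suc K) ⟩
      s * s ^ K * β ^ suc K  ≡⟨ solve 3 (λ a b c → a :* b :* c := b :* (c :* a)) refl s (s ^ K) (β ^ suc K) ⟩
      s ^ K * (β ^ suc K * s)     ≤⟨ *-monoʳ-≤ (s ^ K) β≤ ⟩
      s ^ K * (B * g ^ suc K)     ∎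

  -- The coefficients of h depend on the point, since they absorb the factor f and, after
  -- differences, the directions.
  Good : ∀ {n k} → ℕ → (Vec 𝔽 n → Vec 𝔽 (suc k)) → Function n → Set
  Good D h P = Deg D (λ x → eval₁ (h x) (P x))

  good? : ∀ {n k} D (h : Vec 𝔽 n → Vec 𝔽 (suc k)) P → Dec (Good D h P)
  good? D h P = Deg? D (λ x → eval₁ (h x) (P x))

  #good : ∀ {n k} (D e : ℕ) → (Vec 𝔽 n → Vec 𝔽 (suc k)) → ℕ
  #good {n} D e h = ∑ (code n e) (λ P → ⟦ good? D h P ⟧)

  good-resp : ∀ {n k} D (h : Vec 𝔽 n → Vec 𝔽 (suc k)) → Respects (λ P → ⟦ good? D h P ⟧)
  good-resp D h {F} {G} F≗G = ⟦⟧-cong {d = good? D h F} {d′ = good? D h G}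
    (Deg-cong λ x → cong (eval₁ (h x)) (F≗G x)) (Deg-cong λ x → cong (eval₁ (h x)) (sym (F≗G x)))

  -- The recurrence that `power-bound` produces with L = 2^k.
  Bound : ℕ → ℕ
  Bound zero    = 1
  Bound (suc k) = 2 ^ (2 ^ k) * (1 + Bound k)

  module _ {n k : ℕ} (D e : ℕ) (h : Vec 𝔽 n → Vec 𝔽 (suc (suc k))) {N : ℕ} (Λ : List (Vec 𝔽 N)) (w : Vec 𝔽 N → Function n)
           (once : ∀ γ → ∑ Λ (λ γ′ → ⟦ γ′ ≟ᵛ γ ⟧) ≤ 1) (dw : ∀ γ → Deg e (w γ)) where

    private
      g M E : ℕ
      g = length (code n e)
      M = length Λ
      E = #good D e h

      δh : Vec 𝔽 N → Vec 𝔽 N → Vec 𝔽 n → Vec 𝔽 (suc k)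
      δh γ γ′ x = diff (h x) (w γ x ⊖ w γ′ x)

      I : Vec 𝔽 N → Function n → ℕ
      I γ P = ⟦ good? D h (λ x → P x ⊕ w γ x) ⟧

      I≤1 : ∀ γ P → I γ P ≤ 1
      I≤1 γ P = ⟦⟧≤1 (good? D h (λ x → P x ⊕ w γ x))

      ∑-I : ∀ γ → ∑ (code n e) (I γ) ≡ E
      ∑-I γ = ∑-code-shift {e = e} (λ P → ⟦ good? D h P ⟧) (good-resp D h) (dw γ)

      I*I≤ : ∀ γ γ′ P → I γ P * I γ′ P ≤ ⟦ good? D (δh γ γ′) (λ x → P x ⊕ w γ′ x) ⟧
      I*I≤ γ γ′ P = ⟦⟧-*-mono (good? D h (λ x → P x ⊕ w γ x)) (good? D h (λ x → P x ⊕ w γ′ x))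
        (good? D (δh γ γ′) (λ x → P x ⊕ w γ′ x)) λ d d′ → Deg-cong eq (Deg-- d d′)
        where
        eq : ∀ x → eval₁ (h x) (P x ⊕ w γ x) ⊖ eval₁ (h x) (P x ⊕ w γ′ x) ≡ eval₁ (δh γ γ′ x) (P x ⊕ w γ′ x)
        eq x = trans (cong (λ t → eval₁ (h x) t ⊖ eval₁ (h x) s) s+u)
            (trans (cong (_⊖ eval₁ (h x) s) (trans (eval₁-diff (h x) u s) (⊕-comm _ _))) ([a+b]-b≡a _ _))
          where
          s = P x ⊕ w γ′ x
          u = w γ x ⊖ w γ′ x
          s+u : P x ⊕ w γ x ≡ s ⊕ u
          s+u = trans (cong (P x ⊕_) (trans (sym ([a-b]+b≡a (w γ x) (w γ′ x))) (⊕-comm u _))) (sym (⊕-assoc (P x) (w γ′ x) u))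

      pair-bound : ∀ γ γ′ → ∑ (code n e) (λ P → I γ P * I γ′ P) ≤ #good D e (δh γ γ′)
      pair-bound γ γ′ = ≤-trans (∑ℕ-mono (code n e) (I*I≤ γ γ′))
        (≤-reflexive (∑-code-shift {e = e} (λ P → ⟦ good? D (δh γ γ′) P ⟧) (good-resp D (δh γ γ′)) (dw γ′)))

    -- `A P` counts the γ for which P + `w γ` is good, and by translation invariance its sum is M·E.
    -- In the sum of its squares, a pair γ ≠ γ′ contributes only if the difference of the two values
    -- is good for `δh`, hence at most β; each diagonal pair contributes at most g.
    second-moment : ∀ β → (∀ {γ γ′} → γ ∈ₗ Λ → γ′ ∈ₗ Λ → γ ≢ γ′ → #good D e (δh γ γ′) ≤ β) → .{{_ : NonZero M}} →
                    M * (E * E) ≤ g * (g + M * β)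
    second-moment β ≤β = ℕ.*-cancelˡ-≤ M (begin
      M * (M * (E * E))
        ≡⟨ solve 2 (λ M E → M :* (M :* (E :* E)) := (M :* E) :* (M :* E)) refl M E ⟩
      (M * E) * (M * E)
        ≡⟨ cong (λ z → z * z) (trans (sym (∑ℕ-const Λ E)) (trans (∑-cong Λ (λ γ → sym (∑-I γ))) (∑-swap Λ (code n e)))) ⟩
      ∑ (code n e) A * ∑ (code n e) A
        ≤⟨ cauchy-schwarz (code n e) A ⟩
      g * ∑ (code n e) (λ P → A P * A P)
        ≡⟨ cong (g *_) (trans (∑-cong (code n e) λ P → trans (sym (∑-*ʳ Λ (A P))) (∑-cong Λ λ γ → sym (∑-*ˡ Λ (I γ P))))
             (trans (∑-swap (code n e) Λ) (∑-cong Λ λ γ → ∑-swap (code n e) Λ))) ⟩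
      g * ∑ Λ (λ γ → ∑ Λ (λ γ′ → ∑ (code n e) (λ P → I γ P * I γ′ P)))
        ≤⟨ *-monoʳ-≤ g (∑ℕ-mono-∈ Λ λ {γ} γ∈ → ≤-trans (∑ℕ-mono-∈ Λ (λ {γ′} γ′∈ → entry γ∈ γ′∈))
             (≤-trans (≤-reflexive (trans (∑-+ Λ) (cong₂ _+_ (∑-*ʳ Λ g) (∑ℕ-const Λ β))))
               (+-monoˡ-≤ (M * β) (*-monoˡ-≤ g (once γ))))) ⟩
      g * ∑ Λ (λ γ → 1 * g + M * β)
        ≡⟨ cong (g *_) (∑ℕ-const Λ (1 * g + M * β)) ⟩
      g * (M * (1 * g + M * β))
        ≡⟨ solve 3 (λ g M b → g :* (M :* (con 1 :* g :+ M :* b)) := M :* (g :* (g :+ M :* b))) refl g M β ⟩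
      M * (g * (g + M * β)) ∎)
      where
      A : Function n → ℕ
      A P = ∑ Λ (λ γ → I γ P)
      entry : ∀ {γ γ′} → γ ∈ₗ Λ → γ′ ∈ₗ Λ → ∑ (code n e) (λ P → I γ P * I γ′ P) ≤ ⟦ γ′ ≟ᵛ γ ⟧ * g + β
      entry {γ} {γ′} γ∈ γ′∈ with γ′ ≟ᵛ γ
      ... | yes _    = ≤-trans (≤-trans (∑ℕ-mono (code n e) λ P → *-mono-≤ (I≤1 γ P) (I≤1 γ′ P))
                         (≤-reflexive (trans (sym (length≡∑ (code n e))) (sym (ℕ.*-identityˡ g))))) (m≤m+n _ β)
      ... | no γ′≢γ = ≤-trans (pair-bound γ γ′) (≤β γ∈ γ′∈ (γ′≢γ ∘ sym))

  2^k≡suc : ∀ k → ∃ λ m → 2 ^ k ≡ suc m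
  2^k≡suc k with 2 ^ k | ℕ.m^n≢0 2 k
  ... | suc m | _ = m , refl

  -- A difference changes the leading coefficient exactly as the constructor `step` does. At k = 0
  -- the value of h is that coefficient, whose degree exceeds D, so no P is good.
  thick-bound : ∀ {n size D e k} {c : Function n} → Thick size D e k c → (h : Vec 𝔽 n → Vec 𝔽 (suc k)) → (∀ x → last (h x) ≡ c x) →
                #good D e h ^ (2 ^ k) * size ≤ Bound k * length (code n e) ^ (2 ^ k)
  thick-bound {n} {size} {D} {e} (base {c} ¬dc) h last≡ = ≤-trans (≤-reflexive (cong (λ z → z ^ 1 * size) (∑-0 (code n e) none))) z≤n
    where
    eval-const : ∀ (h : Vec 𝔽 1) t → eval₁ h t ≡ last h
    eval-const (a ∷ []) t = trans (cong (a ⊕_) (⊗-zeroʳ t)) (⊕-identityʳ a)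
    none : ∀ P → ⟦ good? D h P ⟧ ≡ 0
    none P = ⟦⟧≡0 (good? D h P) λ d → ¬dc (Deg-cong (λ x → trans (eval-const (h x) (P x)) (last≡ x)) d)
  thick-bound {size = zero}  {k = suc k} (step _ _ _ _ _ _) h last≡ =
    ≤-trans (≤-reflexive (ℕ.*-zeroʳ (#good _ _ h ^ (2 ^ suc k)))) z≤n
  thick-bound {n} {s@(suc _)} {D} {e} {suc k} {c} (step Λ w s≤M once dw next) h last≡ = begin
      E ^ (2 * 2 ^ k) * s
        ≡⟨ cong (_* s) (square E) ⟩
      (E * E) ^ (2 ^ k) * s
        ≤⟨ powers ⟩
      2 ^ (2 ^ k) * (1 + Bound k) * (g * g) ^ (2 ^ k)
        ≡⟨ cong (2 ^ (2 ^ k) * (1 + Bound k) *_) (square g) ⟨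
      Bound (suc k) * g ^ (2 * 2 ^ k) ∎
    where
    E = #good D e h
    g = length (code n e)
    M = length Λ
    instance
      M≢0 : NonZero M
      M≢0 = >-nonZero (<-≤-trans (s≤s z≤n) s≤M)
    square : ∀ a → a ^ (2 * 2 ^ k) ≡ (a * a) ^ (2 ^ k)
    square a = trans (sym (^-*-assoc a 2 (2 ^ k))) (cong (λ z → (a * z) ^ (2 ^ k)) (ℕ.*-identityʳ a))
    δh : Vec 𝔽 _ → Vec 𝔽 _ → Vec 𝔽 n → Vec 𝔽 (suc k)
    δh γ γ′ x = diff (h x) (w γ x ⊖ w γ′ x)
    φ : Vec 𝔽 _ × Vec 𝔽 _ → ℕ
    -- Diagonal pairs, outside the induction hypothesis, get the harmless value 0.
    φ (γ , γ′) = if does (γ ≟ᵛ γ′) then 0 else #good D e (δh γ γ′)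
    Fine : ℕ → Set
    Fine β = β ^ (2 ^ k) * s ≤ Bound k * g ^ (2 ^ k)
    fine0 : Fine 0
    fine0 with m , eq ← 2^k≡suc k rewrite eq = z≤n
    pairs = cartesianProductWith _,_ Λ Λ
    fine : ∀ {γγ′} → γγ′ ∈ₗ pairs → Fine (φ γγ′)
    fine {γ , γ′} γγ′∈ with γ ≟ᵛ γ′
    ... | yes _    = fine0
    ... | no  γ≢γ′ with _ , _ , γ∈ , γ′∈ , refl ← ∈-cartesianProductWith⁻ _,_ Λ Λ γγ′∈ =
      thick-bound (next γ∈ γ′∈ γ≢γ′) (δh γ γ′) λ x → trans (last-diff (h x) (w γ x ⊖ w γ′ x))
        (cong (λ z → [ suc k ] ⊗ ((w γ x ⊖ w γ′ x) ⊗ z)) (last≡ x))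
    uniform = uniformBound pairs φ {Fine} fine0 fine
    β = proj₁ uniform
    ≤β : ∀ {γ γ′} → γ ∈ₗ Λ → γ′ ∈ₗ Λ → γ ≢ γ′ → #good D e (δh γ γ′) ≤ β
    ≤β {γ} {γ′} γ∈ γ′∈ γ≢γ′ = subst (_≤ β) (cong (λ b → if b then 0 else #good D e (δh γ γ′)) (dec-false (γ ≟ᵛ γ′) γ≢γ′))
      (proj₂ (proj₂ uniform) (∈-cartesianProductWith⁺ _,_ γ∈ γ′∈))
    -- The bound g(g/M + β) on E² only grows when M is replaced by the smaller s.
    sE²≤ : s * (E * E) ≤ g * (g + s * β)
    sE²≤ = ℕ.*-cancelˡ-≤ M (begin
      M * (s * (E * E))  ≡⟨ solve 3 (λ M s E → M :* (s :* E) := s :* (M :* E)) refl M s (E * E) ⟩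
      s * (M * (E * E))          ≤⟨ *-monoʳ-≤ s (second-moment D e h Λ w once dw β ≤β) ⟩
      s * (g * (g + M * β))  ≡⟨ solve 4 (λ s g M b → s :* (g :* (g :+ M :* b)) := g :* (s :* g :+ s :* M :* b)) refl s g M β ⟩
      g * (s * g + s * M * β)    ≤⟨ *-monoʳ-≤ g (+-monoˡ-≤ (s * M * β) (*-monoˡ-≤ g s≤M)) ⟩
      g * (M * g + s * M * β)  ≡⟨ solve 4 (λ s g M b → g :* (M :* g :+ s :* M :* b) := M :* (g :* (g :+ s :* b))) refl s g M β ⟩
      M * (g * (g + s * β))      ∎)
    powers : (E * E) ^ (2 ^ k) * s ≤ 2 ^ (2 ^ k) * (1 + Bound k) * (g * g) ^ (2 ^ k)
    powers = power-bound (2 ^ k) s E g β (Bound k) {{m^n≢0 2 k}} sE²≤ (proj₁ (proj₂ uniform))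

-- Irreducible monomials, many points and few points.

module Core {p : ℕ} (K : FiniteField p) where

  open FiniteField K
  open FieldTheory K
  open Polynomials K
  open Pairing K
  open LeadingTerms K
  open Counting K
  open ∑ℕ using (⟦_⟧)
  open 𝔽-Solver using () renaming (solve to solve𝔽; _:=_ to _≐_; _:+_ to _∔_; _:*_ to _∙_)

  lookup-injective : ∀ {A : Set} {xs : List A} → Unique xs → ∀ i j → List.lookup xs i ≡ List.lookup xs j → i ≡ j
  lookup-injective {xs = _ ∷ _} (_ ∷ _)      zero    zero    _  = refl
  lookup-injective {xs = _ ∷ _} (x∉xs ∷ _)   zero    (suc j) eq = contradiction eq (All.lookup x∉xs (∈-lookup j))
  lookup-injective {xs = _ ∷ _} (x∉xs ∷ _)   (suc i) zero    eq = contradiction (sym eq) (All.lookup x∉xs (∈-lookup i))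
  lookup-injective {xs = _ ∷ _} (_ ∷ unique) (suc i) (suc j) eq = cong suc (lookup-injective unique i j eq)

  points-unique : ∀ n → Unique (points n)
  points-unique zero    = [] ∷ []
  points-unique (suc n) = Unique.cartesianProductWith⁺ _∷_ Vec.∷-injective (Unique.allFin⁺ q) (points-unique n)

  #roots : ∀ {m} → Vec 𝔽 m → 𝔽 → ℕ
  #roots h b = ∑ℕ.∑ (allFin q) (λ a → ⟦ eval₁ h (b ⊕ a) Fin.≟ 0# ⟧)

  -- A polynomial of degree below q with nonzero leading coefficient has a value t that is not a
  -- root, and a = t - b is excluded. Saving one value in q at each point is enough when there are
  -- many points.
  #roots≤p : ∀ {k} (h : Vec 𝔽 (suc k)) → k < q → last h ≢ 0# → ∀ b → #roots h b ≤ p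
  #roots≤p h k<q lh≢0 b with Fin.any? (λ t → ¬? (eval₁ h t Fin.≟ 0#))
  ... | no  none     = contradiction (eval₁≗0⇒last≡0 h k<q λ t → decidable-stable (eval₁ h t Fin.≟ 0#) λ ht≢0 → none (t , ht≢0)) lh≢0
  ... | yes (t , ht≢0) = ℕ.+-cancelʳ-≤ 1 _ _ (begin
    #roots h b + 1
      ≡⟨ cong (λ z → #roots h b + z) (trans (∑ℕ.∑-cong (allFin q) (λ a → sym (ℕ.*-identityʳ ⟦ a Fin.≟ s ⟧))) (∑ℕ.∑-allFin-δ s (λ _ → 1))) ⟨
    #roots h b + ∑ℕ.∑ (allFin q) (λ a → ⟦ a Fin.≟ s ⟧)
      ≡⟨ ∑ℕ.∑-+ (allFin q) {λ a → ⟦ eval₁ h (b ⊕ a) Fin.≟ 0# ⟧} {λ a → ⟦ a Fin.≟ s ⟧} ⟨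
    ∑ℕ.∑ (allFin q) (λ a → ⟦ eval₁ h (b ⊕ a) Fin.≟ 0# ⟧ + ⟦ a Fin.≟ s ⟧)
      ≤⟨ ∑ℕ-mono (allFin q) disjoint ⟩
    ∑ℕ.∑ (allFin q) (λ _ → 1)
      ≡⟨ trans (sym (length≡∑ (allFin q))) (List.length-tabulate id) ⟩
    suc p
      ≡⟨ ℕ.+-comm 1 p ⟩
    p + 1 ∎)
    where
    open ℕ.≤-Reasoning
    s = t ⊖ b
    disjoint : ∀ a → ⟦ eval₁ h (b ⊕ a) Fin.≟ 0# ⟧ + ⟦ a Fin.≟ s ⟧ ≤ 1
    disjoint a with a Fin.≟ s | eval₁ h (b ⊕ a) Fin.≟ 0#
    ... | no _     | yes _   = ≤-refl
    ... | no _     | no  _   = z≤n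
    ... | yes _    | no  _   = ≤-refl
    ... | yes refl | yes h≡0 = contradiction (trans (cong (eval₁ h) (sym (trans (⊕-comm b s) ([a-b]+b≡a t b)))) h≡0) ht≢0

  Deg-eval₁ : ∀ {n e k} (h : Vec 𝔽 (suc k)) {P : Function n} → Deg e P → Deg (k * e) (λ x → eval₁ h (P x))
  Deg-eval₁ (a ∷ [])        {P} dP = const a λ x → trans (cong (a ⊕_) (⊗-zeroʳ (P x))) (⊕-identityʳ a)
  Deg-eval₁ (a ∷ h@(_ ∷ _)) dP = Deg-+ (Deg-const a) (Deg-* dP (Deg-eval₁ h dP))

  ¬¬All : ∀ {A : Set} {P : A → Set} (xs : List A) → (∀ {x} → x ∈ₗ xs → ¬ ¬ P x) → ¬ ¬ All P xs
  ¬¬All []       _   ¬all = ¬all []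
  ¬¬All (x ∷ xs) ¬¬p ¬all = ¬¬p (here refl) λ px → ¬¬All xs (¬¬p ∘ there) λ pxs → ¬all (px ∷ pxs)

  Bound≢0 : ∀ k → NonZero (Bound k)
  Bound≢0 zero    = _
  Bound≢0 (suc k) = m*n≢0 (2 ^ (2 ^ k)) (1 + Bound k) {{m^n≢0 2 (2 ^ k)}}

  #differ : ∀ {n} → Function n → Function n → ℕ
  #differ {n} f g = ∑ℕ.∑ (points n) (λ x → ⟦ ¬? (f x Fin.≟ g x) ⟧)

  -- `suc j` is the degree that `thick` requires for k directions of degree v; m is the precision of
  -- reductions from that degree; M is the degree up to which f acts through point evaluations;
  -- `2 ^ v′` separates few points from many; A is the exponent of q gained.
  module _ {n : ℕ} (k′ d r e v′ A j m M : ℕ) (f : Function n) (h : Vec 𝔽 (suc (suc k′)))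
    (r+d≡np : r + d ≡ n * p) (k≤p : suc k′ ≤ p) (lh≢0 : last h ≢ 0#)
    (far : ∀ {g} → Deg d g → 2 ^ v′ ≤ #differ f g)
    (1+j≡ : suc j ≡ suc k′ * suc v′ + suc v′ * p) (1+j≤e : suc j ≤ e)
    (<r : m + suc j + e * suc k′ < r) (small : suc j + p + M ≤ m) (j≤M : j ≤ M) (ke+vp≤M : suc k′ * e + suc v′ * p ≤ suc M)
    (Bound≤ : Bound (suc k′) * q ^ A ≤ q ^ (2 ^ v′)) (roots≤ : ∀ s → 2 ^ v′ ≤ s → q ^ A * p ^ s ≤ q ^ s)
    where

    k v D : ℕ
    k = suc k′
    v = suc v′
    D = d + e * k

    hf : Vec 𝔽 n → Vec 𝔽 (suc k)
    hf x = Vec.map (f x ⊗_) h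

    Conclusion : Set
    Conclusion = #good D e hf ^ (2 ^ k) * q ^ A ≤ length (code n e) ^ (2 ^ k)

    private
      E g size : ℕ
      E = #good D e hf
      g = length (code n e)
      size = q ^ (2 ^ v′)

      c : Function n
      c x = last h ⊗ f x

      open +-*-Solver using (solve; con; _:=_; _:+_; _:*_)

      np≡d+r : n * p ≡ d + r
      np≡d+r = trans (sym r+d≡np) (ℕ.+-comm r d)

      v≤j : v ≤ suc j
      v≤j = ≤-trans (m≤m+n v (k′ * v)) (≤-trans (m≤m+n (k * v) (v * p)) (≤-reflexive (sym 1+j≡)))

      v≤e : v ≤ e
      v≤e = ≤-trans v≤j 1+j≤e

      thick⇒conclusion : Thick size D e k c → Conclusion
      thick⇒conclusion th = ℕ.*-cancelˡ-≤ (Bound k) {{Bound≢0 k}} (begin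
        Bound k * (E ^ (2 ^ k) * q ^ A)  ≡⟨ solve 3 (λ b x y → b :* (x :* y) := x :* (b :* y)) refl (Bound k) (E ^ (2 ^ k)) (q ^ A) ⟩
        E ^ (2 ^ k) * (Bound k * q ^ A)   ≤⟨ *-monoʳ-≤ (E ^ (2 ^ k)) Bound≤ ⟩
        E ^ (2 ^ k) * size  ≤⟨ thick-bound th hf (λ x → trans (last-map (f x) h) (⊗-comm (f x) (last h))) ⟩
        Bound k * g ^ (2 ^ k)             ∎)
        where open ℕ.≤-Reasoning

      ⟪c⟫⇒⟪f⟫ : ∀ {F : Function n} → ⟪ c ·ᶠ F ⟫ ≡ 0# → ⟪ f ·ᶠ F ⟫ ≡ 0#
      ⟪c⟫⇒⟪f⟫ {F} eq = ab≡0⇒b≡0 (last h) lh≢0 (trans (sym (trans (⟪⟫-cong λ x → ⊗-assoc (last h) (f x) (F x)) (⟪⟫-scale (last h) (f ·ᶠ F)))) eq)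

      size≤ : size ≤ q ^ (2 ^ v)
      size≤ = ^-monoʳ-≤ q (^-monoʳ-≤ 2 (n≤1+n v′))

      reduced? : ∀ (μ : Vec ℕ n) → Dec (Reduced μ)
      reduced? μ = Fin.all? λ l → lookup μ l ℕ.<? q

      Lowers : Function n → Set
      Lowers T = ∃ λ Q → Deg j Q × (T ≈[ f , m ] Q)

      Lowers-0 : ∀ {T} → (∀ x → T x ≡ 0#) → Lowers T
      Lowers-0 T≡0 = _ , const 0# T≡0 , λ _ → refl

      Lowers-+ : ∀ a {T U V : Function n} → Lowers T → Lowers U → (∀ x → V x ≡ a ⊗ T x ⊕ U x) → Lowers V
      Lowers-+ a {T} {U} {V} (Q , dQ , T≈Q) (Q′ , dQ′ , U≈Q′) V≡ = (λ x → a ⊗ Q x ⊕ Q′ x) , Deg-+ (Deg-scale a dQ) dQ′ , λ {R} dR → begin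
        ⟪ f ·ᶠ (V ·ᶠ R) ⟫  ≡⟨ ⟪⟫-cong (λ x → cong (λ z → f x ⊗ (z ⊗ R x)) (V≡ x)) ⟩
        ⟪ f ·ᶠ ((λ x → a ⊗ T x ⊕ U x) ·ᶠ R) ⟫                  ≡⟨ split T U R ⟩
        a ⊗ ⟪ f ·ᶠ (T ·ᶠ R) ⟫ ⊕ ⟪ f ·ᶠ (U ·ᶠ R) ⟫  ≡⟨ cong₂ (λ y z → a ⊗ y ⊕ z) (T≈Q dR) (U≈Q′ dR) ⟩
        a ⊗ ⟪ f ·ᶠ (Q ·ᶠ R) ⟫ ⊕ ⟪ f ·ᶠ (Q′ ·ᶠ R) ⟫             ≡⟨ split Q Q′ R ⟨
        ⟪ f ·ᶠ ((λ x → a ⊗ Q x ⊕ Q′ x) ·ᶠ R) ⟫                 ∎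
        where
        open ≡-Reasoning
        split : ∀ T U R → ⟪ f ·ᶠ ((λ x → a ⊗ T x ⊕ U x) ·ᶠ R) ⟫ ≡ a ⊗ ⟪ f ·ᶠ (T ·ᶠ R) ⟫ ⊕ ⟪ f ·ᶠ (U ·ᶠ R) ⟫
        split T U R = trans (⟪⟫-cong λ x → solve𝔽 5 (λ f a t u r → f ∙ ((a ∙ t ∔ u) ∙ r)
              ≐ a ∙ (f ∙ (t ∙ r)) ∔ f ∙ (u ∙ r)) refl (f x) a (T x) (U x) (R x))
          (trans (⟪⟫-+ (λ x → a ⊗ (f x ⊗ (T x ⊗ R x))) (f ·ᶠ (U ·ᶠ R))) (cong (_⊕ ⟪ f ·ᶠ (U ·ᶠ R) ⟫) (⟪⟫-scale a (f ·ᶠ (T ·ᶠ R)))))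

      -- Reducibility of single monomials is available only doubly negated, which passes through the
      -- finitely many terms of a span.
      ¬¬Lowers-Span : ∀ {S : Vec ℕ n → Set} {T} → (∀ {α} → S α → ¬ ¬ Lowers (_^^ α)) → Span S T → ¬ ¬ Lowers T
      ¬¬Lowers-Span red (nil T≡0)         ¬l = ¬l (Lowers-0 T≡0)
      ¬¬Lowers-Span red (cons a Sα sT T≡) ¬l = red Sα λ lα → ¬¬Lowers-Span red sT λ lT → ¬l (Lowers-+ a lα lT T≡)

      Lowers-Span : ∀ {S : Vec ℕ n → Set} {T} → (∀ {α} → S α → Lowers (_^^ α)) → Span S T → Lowers T
      Lowers-Span red (nil T≡0)         = Lowers-0 T≡0
      Lowers-Span red (cons a Sα sT T≡) = Lowers-+ a (red Sα) (Lowers-Span red sT) T≡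

      module _ (¬conclusion : ¬ Conclusion) where

        -- If c·Y were orthogonal for some Y leading with μ, then x^μ would be congruent to a
        -- combination of the lower terms of Y. These reduce to degree j by the induction
        -- hypothesis, and so would x^μ.
        irreducible⇒regular : ∀ μ → (∀ {ν} → Lower μ ν → ¬ ¬ Lowers (_^^ ν)) → ¬ Lowers (_^^ μ) → Regular size v size≤ {D} {e} {v} {m} ≤-refl v≤e μ c
        irreducible⇒regular μ ih ¬lμ {Y} (lead {a} a≢0 {T} low Y≡) orth =
          ¬¬Lowers-Span ih low λ lT → ¬lμ (Lowers-+ (-1# ⊗ a⁻¹) lT (Q0 , Q0-deg , Y≈0) solveμ)
          where
          a⁻¹ = proj₁ (inverse a a≢0)
          Q0 : Function n
          Q0 _ = 0#
          Q0-deg : Deg j Q0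
          Q0-deg = Deg-const 0#
          Y≈0 : (λ x → a⁻¹ ⊗ Y x) ≈[ f , m ] Q0
          Y≈0 {R} dR = trans (⟪⟫-cong λ x → solve𝔽 4 (λ f b y r → f ∙ (b ∙ y ∙ r)
                ≐ b ∙ (f ∙ (y ∙ r))) refl (f x) a⁻¹ (Y x) (R x))
            (trans (⟪⟫-scale a⁻¹ (f ·ᶠ (Y ·ᶠ R))) (trans (cong (a⁻¹ ⊗_) (⟪c⟫⇒⟪f⟫
              (trans (⟪⟫-cong λ x → sym (⊗-assoc (c x) (Y x) (R x))) (orth dR))))
            (trans (⊗-zeroʳ a⁻¹) (sym (∑𝔽.∑-0 (points n) λ x → trans (cong (f x ⊗_) (⊗-zeroˡ (R x))) (⊗-zeroʳ (f x)))))))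
          solveμ : ∀ x → x ^^ μ ≡ -1# ⊗ a⁻¹ ⊗ T x ⊕ a⁻¹ ⊗ Y x
          solveμ x = sym (begin
            -1# ⊗ a⁻¹ ⊗ T x ⊕ a⁻¹ ⊗ Y x
              ≡⟨ cong (λ z → -1# ⊗ a⁻¹ ⊗ T x ⊕ a⁻¹ ⊗ z) (Y≡ x) ⟩
            -1# ⊗ a⁻¹ ⊗ T x ⊕ a⁻¹ ⊗ (a ⊗ x ^^ μ ⊕ T x)
              ≡⟨ solve𝔽 5 (λ m b t a y → m ∙ b ∙ t ∔ b ∙ (a ∙ y ∔ t)
                   ≐ b ∙ a ∙ y ∔ (b ∙ t ∔ m ∙ (b ∙ t))) refl -1# a⁻¹ (T x) a (x ^^ μ) ⟩
            a⁻¹ ⊗ a ⊗ x ^^ μ ⊕ (a⁻¹ ⊗ T x ⊖ a⁻¹ ⊗ T x)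
              ≡⟨ cong₂ (λ y z → y ⊗ x ^^ μ ⊕ z) (proj₂ (inverse a a≢0)) (a-a≡0 _) ⟩
            1# ⊗ x ^^ μ ⊕ 0#
              ≡⟨ trans (⊕-identityʳ _) (⊗-identityˡ _) ⟩
            x ^^ μ ∎)
            where open ≡-Reasoning

        -- Induction on the weight within degree `suc j`. A monomial that is not reduced already has
        -- degree at most j as a function; an irreducible one would make c thick, against the
        -- negated conclusion.
        ¬¬Lowers-top : ∀ μ → Vec.sum μ ≡ suc j → ¬ ¬ Lowers (_^^ μ)
        ¬¬Lowers-top μ |μ|≡ = <-rec (λ w → ∀ μ → weightℕ μ ≡ w → Vec.sum μ ≡ suc j → ¬ ¬ Lowers (_^^ μ)) go (weightℕ μ) μ refl |μ|≡
          where
          go : ∀ w → (∀ {w′} → w′ < w → ∀ ν → weightℕ ν ≡ w′ → Vec.sum ν ≡ suc j → ¬ ¬ Lowers (_^^ ν)) →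
               ∀ μ → weightℕ μ ≡ w → Vec.sum μ ≡ suc j → ¬ ¬ Lowers (_^^ μ)
          go w ih μ refl |μ|≡ ¬lμ with reduced? μ
          ... | no  ¬red = ¬lμ (_ , subst (λ s → Deg< s (_^^ μ)) |μ|≡ (Deg<-^^ μ ¬red) , λ _ → refl)
          ... | yes red  = ¬conclusion (thick⇒conclusion (thick size v size≤ {m = m} ≤-refl v≤e k k≤p red
                (≤-reflexive (trans (sym 1+j≡) (sym |μ|≡))) D+μ+m<
                (irreducible⇒regular μ (λ {ν} (s , w<) → ih w< ν refl (trans s |μ|≡)) ¬lμ)))
            where
            D+μ+m< : D + Vec.sum μ + m < n * p + k * v
            D+μ+m< = <-≤-trans (subst₂ _<_
                (trans (solve 4 (λ d m j x → d :+ (m :+ j :+ x) := d :+ x :+ j :+ m) refl d m (suc j) (e * k)) (cong (λ z → D + z + m) (sym |μ|≡)))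
                (sym np≡d+r) (ℕ.+-monoʳ-< d <r)) (m≤m+n (n * p) (k * v))

        module _ (decomp : Decomposition f j M) where

          open Decomposition decomp

          support? : ∀ u → Dec (weight u ≢ 0#)
          support? u = ¬? (weight u Fin.≟ 0#)

          Z : List (Vec 𝔽 n)
          Z = filter support? (points n)

          Z-unique : Unique Z
          Z-unique = Unique.filter⁺ support? (points-unique n)

          s : ℕ
          s = length Z

          z : Fin s → Vec 𝔽 n
          z = List.lookup Z

          wz≢0 : ∀ i → weight (z i) ≢ 0#
          wz≢0 i = proj₂ (∈-filter⁻ support? {xs = points n} (∈-lookup {xs = Z} i))

          -- Lagrange interpolation on Z, with the atoms as basis.
          w : Vec 𝔽 s → Function n
          w γ x = ∑𝔽.∑ (allFin s) (λ i → lookup γ i ⊗ atom (z i) x)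

          Deg-w : ∀ γ → Deg e (w γ)
          Deg-w γ = Deg-∑ (allFin s) λ i → Deg-scale (lookup γ i) (Deg-≤ (≤-trans (n≤1+n j) 1+j≤e) (Deg-atom (z i)))

          w-z : ∀ γ i → w γ (z i) ≡ lookup γ i
          w-z γ i = trans (∑𝔽.∑-cong (allFin s) diagonal) (∑𝔽.∑-allFin-δ i (lookup γ))
            where
            diagonal : ∀ i′ → lookup γ i′ ⊗ atom (z i′) (z i) ≡ ∑𝔽.⟦ i′ Fin.≟ i ⟧ ⊗ lookup γ i′
            diagonal i′ with i′ Fin.≟ i
            ... | yes refl = trans (cong (lookup γ i ⊗_) (atom-≡ j≤M decomp {z i} (wz≢0 i))) (⊗-comm _ 1#)
            ... | no  i′≢i = trans (cong (lookup γ i′ ⊗_) (atom-≢ j≤M decomp {z i} {z i′} (wz≢0 i) λ eq → i′≢i (sym (lookup-injective Z-unique i i′ eq))))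
                                   (trans (⊗-zeroʳ _) (sym (⊗-zeroˡ _)))

          -- A good product f·h(P) is orthogonal to the atom, since D + j < np. The same pairing is
          -- h(P(z)) times the weight, as h(P) has degree at most ke, within reach of `evaluate`.
          good⇒root : ∀ {P} → Deg e P → Good D hf P → ∀ i → eval₁ h (P (z i)) ≡ 0#
          good⇒root {P} dP good i = ab≡0⇒b≡0 (weight (z i)) (wz≢0 i) (trans (⊗-comm _ _) (begin
            eval₁ h (P (z i)) ⊗ weight (z i)
              ≡⟨ evaluate (Deg-≤ (≤-trans (m≤m+n (k * e) (v * p)) ke+vp≤M) (Deg-eval₁ h dP)) (z i) ⟨
            ⟪ f ·ᶠ ((λ x → eval₁ h (P x)) ·ᶠ atom (z i)) ⟫
              ≡⟨ ⟪⟫-cong (λ x → trans (sym (⊗-assoc (f x) (eval₁ h (P x)) (atom (z i) x))) (cong (_⊗ atom (z i) x) (sym (eval₁-* (f x) h (P x))))) ⟩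
            ⟪ (λ x → eval₁ (hf x) (P x)) ·ᶠ atom (z i) ⟫
              ≡⟨ Deg⇒Orth good D+j< (Deg-atom (z i)) ⟩
            0# ∎))
            where
            open ≡-Reasoning
            D+j< : D + j < n * p
            D+j< = ≤-<-trans (≤-trans (≤-reflexive (solve 3 (λ d x j → d :+ x :+ j := d :+ (j :+ x)) refl d (e * k) j))
                     (+-monoʳ-≤ d (+-monoˡ-≤ (e * k) (≤-trans (n≤1+n j) (m≤n+m (suc j) m)))))
                   (subst (d + (m + suc j + e * k) <_) (sym np≡d+r) (ℕ.+-monoʳ-< d <r))

          -- Averaging over the shifts by `w γ` makes the values on Z independent and uniform, so
          -- they are all roots with probability at most (p/q)^s, which `roots≤` bounds by q^(-A).
          many-points : 2 ^ v′ ≤ s → Conclusion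
          many-points 2^v′≤s with K′ , eq ← 2^k≡suc k = subst (λ K → E ^ K * q ^ A ≤ g ^ K) (sym eq) (begin
              E * E ^ K′ * q ^ A  ≡⟨ solve 3 (λ a b c → a :* b :* c := b :* (a :* c)) refl E (E ^ K′) (q ^ A) ⟩
              -- One factor E carries the whole gain; E ≤ g suffices for the others.
              E ^ K′ * (E * q ^ A)  ≤⟨ *-mono-≤ (^-monoˡ-≤ K′ (≤-trans (m≤m*n E (q ^ A) {{m^n≢0 q A}}) Eq^A≤g)) Eq^A≤g ⟩
              g ^ K′ * g              ≡⟨ ℕ.*-comm (g ^ K′) g ⟩
              g * g ^ K′              ∎)
            where
            open ℕ.≤-Reasoning
            shifted : Vec 𝔽 s → Function n → Function n
            shifted γ P x = P x ⊕ w γ x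
            root? : ∀ (P : Function n) i a → Dec (eval₁ h (P (z i) ⊕ a) ≡ 0#)
            root? P i a = eval₁ h (P (z i) ⊕ a) Fin.≟ 0#
            roots? : ∀ P (γ : Vec 𝔽 s) → Dec (∀ i → eval₁ h (P (z i) ⊕ lookup γ i) ≡ 0#)
            roots? P γ = Fin.all? λ i → root? P i (lookup γ i)
            good≤roots : ∀ {P} → Deg e P → ∀ γ → ⟦ good? D hf (shifted γ P) ⟧ ≤ ⟦ roots? P γ ⟧
            good≤roots {P} dP γ = ⟦⟧-mono (good? D hf (shifted γ P)) (roots? P γ) λ good i →
              trans (cong (λ t → eval₁ h (P (z i) ⊕ t)) (sym (w-z γ i))) (good⇒root (Deg-+ dP (Deg-w γ)) good i)
            ∏≤ : ∀ m {φ : Fin m → ℕ} → (∀ i → φ i ≤ p) → ∑ℕ.∏ m φ ≤ p ^ m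
            ∏≤ zero    φ≤p = ≤-refl
            ∏≤ (suc m) φ≤p = *-mono-≤ (φ≤p zero) (∏≤ m (φ≤p ∘ suc))
            few : ∀ {P} → P ∈ₗ code n e → ∑ℕ.∑ (points s) (λ γ → ⟦ good? D hf (shifted γ P) ⟧) ≤ p ^ s
            few {P} P∈ = begin
              ∑ℕ.∑ (points s) (λ γ → ⟦ good? D hf (shifted γ P) ⟧)
                ≤⟨ ∑ℕ-mono (points s) (good≤roots (proj₂ (∈-filter⁻ (Deg? e) {xs = functions n} P∈))) ⟩
              ∑ℕ.∑ (points s) (λ γ → ⟦ roots? P γ ⟧)
                ≡⟨ ∑ℕ.∑-cong (points s) (λ γ → ∑ℕ.⟦⟧-∏ s (roots? P γ) (λ i → root? P i (lookup γ i)) id id) ⟩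
              ∑ℕ.∑ (points s) (λ γ → ∑ℕ.∏ s (λ i → ⟦ root? P i (lookup γ i) ⟧))
                ≡⟨ ∑ℕ.∑-vectors-∏ (allFin q) s (λ i a → ⟦ root? P i a ⟧) ⟩
              ∑ℕ.∏ s (λ i → #roots h (P (z i)))
                ≤⟨ ∏≤ s (λ i → #roots≤p h (s≤s k≤p) lh≢0 (P (z i))) ⟩
              p ^ s ∎
            q^sE≤ : q ^ s * E ≤ p ^ s * g
            q^sE≤ = begin
              q ^ s * E
                ≡⟨ trans (cong (_* E) (sym (length-points s))) (sym (∑ℕ-const (points s) E)) ⟩
              ∑ℕ.∑ (points s) (λ _ → E)
                ≡⟨ ∑ℕ.∑-cong (points s) (λ γ → sym (∑-code-shift {e = e} (λ P → ⟦ good? D hf P ⟧) (good-resp D hf) (Deg-w γ))) ⟩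
              ∑ℕ.∑ (points s) (λ γ → ∑ℕ.∑ (code n e) (λ P → ⟦ good? D hf (shifted γ P) ⟧))
                ≡⟨ ∑ℕ.∑-swap (points s) (code n e) ⟩
              ∑ℕ.∑ (code n e) (λ P → ∑ℕ.∑ (points s) (λ γ → ⟦ good? D hf (shifted γ P) ⟧))
                ≤⟨ ∑ℕ-mono-∈ (code n e) few ⟩
              ∑ℕ.∑ (code n e) (λ _ → p ^ s)
                ≡⟨ trans (∑ℕ-const (code n e) (p ^ s)) (ℕ.*-comm g (p ^ s)) ⟩
              p ^ s * g ∎
            Eq^A≤g : E * q ^ A ≤ g
            Eq^A≤g = ℕ.*-cancelˡ-≤ (q ^ s) {{m^n≢0 q s}} (begin
              q ^ s * (E * q ^ A)     ≡⟨ ℕ.*-assoc (q ^ s) E (q ^ A) ⟨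
              q ^ s * E * q ^ A       ≤⟨ *-monoˡ-≤ (q ^ A) q^sE≤ ⟩
              p ^ s * g * q ^ A  ≡⟨ solve 3 (λ a b c → a :* b :* c := c :* a :* b) refl (p ^ s) g (q ^ A) ⟩
              q ^ A * p ^ s * g       ≤⟨ *-monoˡ-≤ g (roots≤ s 2^v′≤s) ⟩
              q ^ s * g               ∎)

          G : Function n
          G x = f x ⊖ weight x

          ⟪f⟫≡⟪G⟫+⟪weight⟫ : ∀ F → ⟪ f ·ᶠ F ⟫ ≡ ⟪ G ·ᶠ F ⟫ ⊕ ⟪ F ·ᶠ weight ⟫
          ⟪f⟫≡⟪G⟫+⟪weight⟫ F = trans (⟪⟫-cong λ x → trans (cong (_⊗ F x) (sym ([a-b]+b≡a (f x) (weight x))))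
              (solve𝔽 3 (λ g w F → (g ∔ w) ∙ F ≐ g ∙ F ∔ F ∙ w) refl (G x) (weight x) (F x)))
            (⟪⟫-+ (G ·ᶠ F) (F ·ᶠ weight))

          G⊥Deg : ∀ {F} → Deg M F → ⟪ G ·ᶠ F ⟫ ≡ 0#
          G⊥Deg {F} dF = ⊕-cancelʳ _ _ ⟪ F ·ᶠ weight ⟫ (trans (sym (⟪f⟫≡⟪G⟫+⟪weight⟫ F)) (trans (expand dF) (sym (⊕-identityˡ _))))

          ⟪G⟫-Span : ∀ {S : Vec ℕ n → Set} {F} → (∀ {α} → S α → ⟪ G ·ᶠ (_^^ α) ⟫ ≡ 0#) → Span S F → ⟪ G ·ᶠ F ⟫ ≡ 0#
          ⟪G⟫-Span zeros (nil F≡0) = ∑𝔽.∑-0 (points n) λ x → trans (cong (G x ⊗_) (F≡0 x)) (⊗-zeroʳ (G x))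
          ⟪G⟫-Span zeros (cons {F = F} {H} a {α} Sα sF H≡) = begin
            ⟪ G ·ᶠ H ⟫  ≡⟨ ⟪⟫-cong (λ x → trans (cong (G x ⊗_) (H≡ x)) (solve𝔽 4 (λ g a y f →
                                                                      g ∙ (a ∙ y ∔ f) ≐ a ∙ (g ∙ y) ∔ g ∙ f) refl (G x) a (x ^^ α) (F x))) ⟩
            ⟪ (λ x → a ⊗ (G x ⊗ x ^^ α) ⊕ G x ⊗ F x) ⟫  ≡⟨ ⟪⟫-+ (λ x → a ⊗ (G x ⊗ x ^^ α)) (G ·ᶠ F) ⟩
            ⟪ (λ x → a ⊗ (G x ⊗ x ^^ α)) ⟫ ⊕ ⟪ G ·ᶠ F ⟫  ≡⟨ cong₂ _⊕_ (trans (⟪⟫-scale a (G ·ᶠ (_^^ α))) (trans (cong (a ⊗_) (zeros Sα)) (⊗-zeroʳ a))) (⟪G⟫-Span zeros sF) ⟩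
            0# ⊕ 0#                                             ≡⟨ ⊕-identityˡ 0# ⟩
            0#                                                   ∎
            where open ≡-Reasoning

          -- G differs from f only on Z, so it is too close to f to have degree d. Yet the negated
          -- conclusion makes it orthogonal to all degrees below r.
          few-points : s < 2 ^ v′ → ⊥
          few-points s<2^v′ = <⇒≱ s<2^v′ (≤-trans (far (⊥⇒Deg r d G r+d≡np G⊥)) differ≤s)
            where
            -- The coefficients of a family that stay free once s values on Z are prescribed.
            t = 2 ^ v ∸ s

            2^v′≤t : 2 ^ v′ ≤ t
            2^v′≤t = ℕ.m+n≤o⇒m≤o∸n (2 ^ v′) (+-monoʳ-≤ (2 ^ v′) (≤-trans (<⇒≤ s<2^v′) (m≤m+n (2 ^ v′) 0)))

            s+t≡2^v : s + t ≡ 2 ^ v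
            s+t≡2^v = ℕ.m+[n∸m]≡n (≤-trans (<⇒≤ s<2^v′) (^-monoʳ-≤ 2 (n≤1+n v′)))

            vanishes : ∀ {u : Function n} → All (λ z → u z ≡ 0#) Z → ∀ x → u x ⊗ weight x ≡ 0#
            vanishes {u} uZ x with weight x Fin.≟ 0#
            ... | yes wx≡0 = trans (cong (u x ⊗_) wx≡0) (⊗-zeroʳ (u x))
            ... | no  wx≢0 = trans (cong (_⊗ weight x) (All.lookup uZ (∈-filter⁺ support? (∈-points x) wx≢0))) (⊗-zeroˡ _)
              where
              ∈-points : ∀ {n} (x : Vec 𝔽 n) → x ∈ₗ points n
              ∈-points []      = here refl
              ∈-points (a ∷ x) = ∈-cartesianProductWith⁺ _∷_ (∈-allFin a) (∈-points x)

            -- Only one direction has to vanish on Z: the full product contains it, so the weight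
            -- part drops out and f may stand for G in the pairing. Directions of degree e give D +
            -- |μ| < np + ke from |μ| < r. Testing against constants suffices, hence precision 0.
            thick-μ : ∀ μ → Reduced μ → M < Vec.sum μ → Vec.sum μ < r →
                      (∀ {ν} → Lower μ ν → ⟪ G ·ᶠ (_^^ ν) ⟫ ≡ 0#) → ⟪ G ·ᶠ (_^^ μ) ⟫ ≢ 0# → Thick size D e k c
            thick-μ μ red M<μ μ<r ih Gμ≢0 = thick-step Z size t v (^-monoʳ-≤ q 2^v′≤t) s+t≡2^v μ red v≤e ≤-refl
                (≤-trans (+-monoˡ-≤ (v * p) (m≤m+n e (k′ * e))) (≤-trans ke+vp≤M M<μ))
                λ {N} {C} {u} N⊞C≡μ |N|≡e lu uZ → thick size v size≤ {D} {e} {e} {0} v≤e ≤-refl k′ (<⇒≤ k≤p)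
                  (⊑-Reduced (N , trans (⊞-comm C N) N⊞C≡μ) red)
                  (ℕ.+-cancelˡ-≤ e _ _ (subst₂ _≤_ (ℕ.+-assoc e (k′ * e) (v * p)) (|μ| N⊞C≡μ |N|≡e) (≤-trans ke+vp≤M M<μ)))
                  (ℕ.+-cancelˡ-< e _ _ (subst₂ _<_
                    (trans (cong (λ y → d + e * k + y) (|μ| N⊞C≡μ |N|≡e)) (solve 4 (λ d x e C → d :+ x :+ (e :+ C) := e :+ (d :+ x :+ C :+ con 0)) refl d (e * k) e (Vec.sum C)))
                    (trans (solve 4 (λ d e k r → d :+ e :* (con 1 :+ k) :+ r := e :+ (d :+ r :+ k :* e)) refl d e k′ r) (cong (λ z → e + (z + k′ * e)) (sym np≡d+r)))
                    (ℕ.+-monoʳ-< (d + e * k) μ<r)))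
                  (Regular-step size v size≤ {D} {e} {e} {0} v≤e ≤-refl k′ k≤p N⊞C≡μ lu
                    λ {Y} lY orth → nonzero (subst (λ μ → Lead μ (u ·ᶠ Y)) N⊞C≡μ (Lead-* lu lY))
                      (λ x → trans (solve𝔽 3 (λ u y w → u ∙ y ∙ w ≐ y ∙ (u ∙ w)) refl (u x) (Y x) (weight x))
                        (trans (cong (Y x ⊗_) (vanishes uZ x)) (⊗-zeroʳ (Y x))))
                      (trans (⟪⟫-cong {F = c ·ᶠ (u ·ᶠ Y)} λ x → sym (⊗-identityʳ _)) (orth (Deg-const 1#))))
              where
              |μ| : ∀ {N C : Vec ℕ n} → N ⊞ C ≡ μ → Vec.sum N ≡ e → Vec.sum μ ≡ e + Vec.sum C
              |μ| {N} {C} refl refl = sum-⊞ N C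
              nonzero : ∀ {F} → Lead μ F → (∀ x → F x ⊗ weight x ≡ 0#) → ⟪ c ·ᶠ F ⟫ ≢ 0#
              nonzero {F} (lead {a} a≢0 {T} low F≡) Fw≡0 cF≡0 = Gμ≢0 (ab≡0⇒b≡0 a a≢0 (begin
                a ⊗ ⟪ G ·ᶠ (_^^ μ) ⟫
                  ≡⟨ ⊕-identityʳ _ ⟨
                a ⊗ ⟪ G ·ᶠ (_^^ μ) ⟫ ⊕ 0#
                  ≡⟨ cong₂ _⊕_ (⟪⟫-scale a (G ·ᶠ (_^^ μ))) (⟪G⟫-Span ih low) ⟨
                ⟪ (λ x → a ⊗ (G x ⊗ x ^^ μ)) ⟫ ⊕ ⟪ G ·ᶠ T ⟫
                  ≡⟨ ⟪⟫-+ (λ x → a ⊗ (G x ⊗ x ^^ μ)) (G ·ᶠ T) ⟨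
                ⟪ (λ x → a ⊗ (G x ⊗ x ^^ μ) ⊕ G x ⊗ T x) ⟫
                  ≡⟨ ⟪⟫-cong (λ x → trans (solve𝔽 4 (λ g a y t → a ∙ (g ∙ y) ∔ g ∙ t
                       ≐ g ∙ (a ∙ y ∔ t)) refl (G x) a (x ^^ μ) (T x)) (cong (G x ⊗_) (sym (F≡ x)))) ⟩
                ⟪ G ·ᶠ F ⟫
                  ≡⟨ trans (cong (⟪ G ·ᶠ F ⟫ ⊕_) (∑𝔽.∑-0 (points n) Fw≡0)) (⊕-identityʳ _) ⟨
                ⟪ G ·ᶠ F ⟫ ⊕ ⟪ F ·ᶠ weight ⟫
                  ≡⟨ ⟪f⟫≡⟪G⟫+⟪weight⟫ F ⟨
                ⟪ f ·ᶠ F ⟫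
                  ≡⟨ ⟪c⟫⇒⟪f⟫ cF≡0 ⟩
                0# ∎))
                where open ≡-Reasoning

            -- Induction on the degree and, within a degree, on the weight: a minimal counterexample
            -- is reduced and has degree above M, as `thick-μ` requires.
            ⟪G·^^⟫≡0 : ∀ μ → Vec.sum μ < r → ⟪ G ·ᶠ (_^^ μ) ⟫ ≡ 0#
            ⟪G·^^⟫≡0 μ μ<r = <-rec (λ s → ∀ μ → Vec.sum μ ≡ s → s < r → ⟪ G ·ᶠ (_^^ μ) ⟫ ≡ 0#) byDegree (Vec.sum μ) μ refl μ<r
              where
              byDegree : ∀ s → (∀ {s′} → s′ < s → ∀ ν → Vec.sum ν ≡ s′ → s′ < r → ⟪ G ·ᶠ (_^^ ν) ⟫ ≡ 0#) →
                         ∀ μ → Vec.sum μ ≡ s → s < r → ⟪ G ·ᶠ (_^^ μ) ⟫ ≡ 0#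
              byDegree s ih μ |μ|≡s s<r = <-rec (λ w → ∀ μ → weightℕ μ ≡ w → Vec.sum μ ≡ s → ⟪ G ·ᶠ (_^^ μ) ⟫ ≡ 0#) byWeight (weightℕ μ) μ refl |μ|≡s
                where
                byWeight : ∀ w → (∀ {w′} → w′ < w → ∀ ν → weightℕ ν ≡ w′ → Vec.sum ν ≡ s → ⟪ G ·ᶠ (_^^ ν) ⟫ ≡ 0#) →
                           ∀ μ → weightℕ μ ≡ w → Vec.sum μ ≡ s → ⟪ G ·ᶠ (_^^ μ) ⟫ ≡ 0#
                byWeight w ih′ μ refl refl with s ℕ.≤? M | reduced? μ
                ... | yes s≤M | _        = G⊥Deg (Deg-≤ s≤M (Deg-^^ μ))
                ... | no  s≰M | no  ¬red = lowerDegree s (Deg<-^^ μ ¬red) ≤-refl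
                  where
                  lowerDegree : ∀ t {F} → Deg< t F → t ≤ s → ⟪ G ·ᶠ F ⟫ ≡ 0#
                  lowerDegree zero    F≡0 _   = ∑𝔽.∑-0 (points n) λ x → trans (cong (G x ⊗_) (F≡0 x)) (⊗-zeroʳ (G x))
                  lowerDegree (suc t) dF  t<s = ⟪G⟫-Span (λ {ν} ν≤t → ih (≤-<-trans ν≤t t<s) ν refl (<-trans (≤-<-trans ν≤t t<s) s<r)) (Deg⇒Span dF)
                ... | no  s≰M | yes red  = decidable-stable (_ Fin.≟ 0#) λ Gμ≢0 → ¬conclusion (thick⇒conclusion
                      (thick-μ μ red (≰⇒> s≰M) s<r (λ {ν} (|ν| , w<) → ih′ w< ν refl |ν|) Gμ≢0))

            G⊥ : ∀ {R} → Deg< r R → ⟪ G ·ᶠ R ⟫ ≡ 0#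
            G⊥ = go r ≤-refl
              where
              go : ∀ t → t ≤ r → ∀ {R} → Deg< t R → ⟪ G ·ᶠ R ⟫ ≡ 0#
              go zero    _   R≡0 = ∑𝔽.∑-0 (points n) λ x → trans (cong (G x ⊗_) (R≡0 x)) (⊗-zeroʳ (G x))
              go (suc t) t<r dR  = ⟪G⟫-Span (λ {ν} ν≤t → ⟪G·^^⟫≡0 ν (≤-<-trans ν≤t t<r)) (Deg⇒Span dR)

            differ≤s : #differ f G ≤ s
            differ≤s = ≤-trans (∑ℕ-mono (points n) λ x → ⟦⟧-mono (¬? (f x Fin.≟ G x)) (support? x) λ fx≢Gx wx≡0 →
                fx≢Gx (sym (trans (cong (f x ⊖_) wx≡0) (trans (cong (f x ⊕_) (⊗-zeroʳ -1#)) (⊕-identityʳ (f x))))))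
              (≤-reflexive (trans (∑ℕ.∑-cong (points n) λ u → sym (ℕ.*-identityʳ ⟦ support? u ⟧))
                (trans (sym (∑ℕ.∑-filter support? (points n))) (sym (length≡∑ Z)))))

    conclusion : Conclusion
    conclusion = decidable-stable (_ ℕ.≤? _) λ ¬con → ¬¬All (monomials n (suc j)) (lowers ¬con) λ all →
        ¬con (finish ¬con (Flat.decomposition f j m M small (flat all)))
      where
      flat : All (λ α → Lowers (_^^ α)) (monomials n (suc j)) → ∀ {Q : Function n} → Deg (suc j) Q → Lowers Q
      flat all dQ = Lowers-Span (λ α≤ → All.lookup all (∈-monomials α≤)) (Deg⇒Span dQ)
      finish : ¬ Conclusion → Decomposition f j M → Conclusion
      finish ¬con decomp with 2 ^ v′ ℕ.≤? s ¬con decomp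
      ... | yes 2^v′≤s = many-points ¬con decomp 2^v′≤s
      ... | no  2^v′≰s = contradiction (≰⇒> 2^v′≰s) (few-points ¬con decomp)
      lowers : ¬ Conclusion → ∀ {α} → α ∈ₗ monomials n (suc j) → ¬ ¬ Lowers (_^^ α)
      lowers ¬con {α} α∈ with ℕ.m≤n⇒m<n∨m≡n (All.lookup (monomials-≤ n (suc j)) α∈)
      ... | inj₁ (s≤s |α|≤j) = λ ¬l → ¬l (_ , Deg-≤ |α|≤j (Deg-^^ α) , λ _ → refl)
      ... | inj₂ |α|≡        = ¬¬Lowers-top ¬con α |α|≡

-- From inequalities between cuts to inequalities of natural numbers.

module Reals where

  open +-*-Solver using (solve; _:=_; _:+_; _:*_)

  ^-cancelʳ-≤ : ∀ k .{{_ : NonZero k}} {a b} → a ^ k ≤ b ^ k → a ≤ b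
  ^-cancelʳ-≤ k a^k≤b^k = ≮⇒≥ λ b<a → <⇒≱ (ℕ.^-monoˡ-< k b<a) a^k≤b^k

  +≤+⁻ : ∀ {a b c d} → + a ℤ.* + b ℤ.≤ + c ℤ.* + d → a * b ≤ c * d
  +≤+⁻ {a} {b} {c} {d} le = ℤ.drop‿+≤+ (subst₂ ℤ._≤_ (sym (ℤ.pos-* a b)) (sym (ℤ.pos-* c d)) le)

  +≤+⁺ : ∀ {a b c d} → a * b ≤ c * d → + a ℤ.* + b ℤ.≤ + c ℤ.* + d
  +≤+⁺ {a} {b} {c} {d} le = subst₂ ℤ._≤_ (ℤ.pos-* a b) (ℤ.pos-* c d) (ℤ.+≤+ le)

  +<+⁻ : ∀ {a b c d} → + a ℤ.* + b ℤ.< + c ℤ.* + d → a * b < c * d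
  +<+⁻ {a} {b} {c} {d} lt = ℤ.drop‿+<+ (subst₂ ℤ._<_ (sym (ℤ.pos-* a b)) (sym (ℤ.pos-* c d)) lt)

  +<+⁺ : ∀ {a b c d} → a * b < c * d → + a ℤ.* + b ℤ.< + c ℤ.* + d
  +<+⁺ {a} {b} {c} {d} lt = subst₂ ℤ._<_ (ℤ.pos-* a b) (ℤ.pos-* c d) (ℤ.+<+ lt)

  /1-< : ∀ {a b} → a < b → + a / 1 ℚ.< + b / 1
  /1-< {a} {b} a<b = ℚ.*<* (+<+⁺ {a} {1} {b} {1} (ℕ.*-monoˡ-< 1 a<b))

  /1-<⁻ : ∀ {a b} → + a / 1 ℚ.< + b / 1 → a < b
  /1-<⁻ {a} {b} (ℚ.*<* lt) = ℕ.*-cancelʳ-< 1 a b (+<+⁻ {a} {1} {b} {1} lt)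

  ↥-* : ∀ p q → ℚ.↥ (p ℚ.* q) ≡ ℚ.↥ p ℤ.* ℚ.↥ q
  ↥-* (ℚ.mkℚᵘ _ _) (ℚ.mkℚᵘ _ _) = refl

  ↧-* : ∀ p q → ℚ.↧ₙ (p ℚ.* q) ≡ ℚ.↧ₙ p * ℚ.↧ₙ q
  ↧-* (ℚ.mkℚᵘ _ _) (ℚ.mkℚᵘ _ _) = refl

  ↥-^ℚ : ∀ a b n → ℚ.↥ (ℚ.mkℚᵘ (+ a) b ^ℚ n) ≡ + (a ^ n)
  ↥-^ℚ a b zero    = refl
  ↥-^ℚ a b (suc n) = trans (↥-* (ℚ.mkℚᵘ (+ a) b) (ℚ.mkℚᵘ (+ a) b ^ℚ n)) (trans (cong (+ a ℤ.*_) (↥-^ℚ a b n)) (sym (ℤ.pos-* a (a ^ n))))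

  ↧-^ℚ : ∀ a b n → ℚ.↧ₙ (ℚ.mkℚᵘ (+ a) b ^ℚ n) ≡ suc b ^ n
  ↧-^ℚ a b zero    = refl
  ↧-^ℚ a b (suc n) = trans (↧-* (ℚ.mkℚᵘ (+ a) b) (ℚ.mkℚᵘ (+ a) b ^ℚ n)) (cong (suc b *_) (↧-^ℚ a b n))

  1/≤1 : ∀ m .{{_ : NonZero m}} → + 1 / m ℚ.≤ 1ℚᵘ
  1/≤1 (suc m) = ℚ.*≤* (+≤+⁺ {1} {1} {1} {suc m} (s≤s z≤n))

  -- For z = a/(b + 1), the passage from z ≤ q^(i/B) to z ≤ q^(A/K) when i/B ≤ A/K. Comparing B-th
  -- powers of both sides avoids roots.
  ^ℚ-≤ : ∀ q .{{_ : NonZero q}} i {K A B a b} .{{_ : NonZero K}} .{{_ : NonZero B}} → i ℤ.* + K ℤ.≤ + (A * B) →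
         ℚ.mkℚᵘ (+ a) b ^ℚ B ℚ.≤ q ^ℤ i → a ^ K ≤ q ^ A * suc b ^ K
  ^ℚ-≤ q (+ n) {K} {A} {B} {a} {b} nK≤AB (ℚ.*≤* z^B≤) = ^-cancelʳ-≤ B (begin
      (a ^ K) ^ B                    ≡⟨ flipExp a ⟩
      (a ^ B) ^ K                    ≤⟨ ^-monoˡ-≤ K a^B≤ ⟩
      (q ^ n * suc b ^ B) ^ K        ≡⟨ ^-distribʳ-* (q ^ n) (suc b ^ B) K ⟩
      (q ^ n) ^ K * (suc b ^ B) ^ K  ≡⟨ cong₂ _*_ (^-*-assoc q n K) (sym (flipExp (suc b))) ⟩
      q ^ (n * K) * (suc b ^ K) ^ B  ≤⟨ *-monoˡ-≤ ((suc b ^ K) ^ B) (^-monoʳ-≤ q (ℤ.drop‿+≤+ (subst (ℤ._≤ + (A * B)) (sym (ℤ.pos-* n K)) nK≤AB))) ⟩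
      q ^ (A * B) * (suc b ^ K) ^ B  ≡⟨ cong (_* (suc b ^ K) ^ B) (^-*-assoc q A B) ⟨
      (q ^ A) ^ B * (suc b ^ K) ^ B  ≡⟨ ^-distribʳ-* (q ^ A) (suc b ^ K) B ⟨
      (q ^ A * suc b ^ K) ^ B        ∎)
    where
    open ℕ.≤-Reasoning
    flipExp : ∀ x → (x ^ K) ^ B ≡ (x ^ B) ^ K
    flipExp x = trans (^-*-assoc x K B) (trans (cong (x ^_) (ℕ.*-comm K B)) (sym (^-*-assoc x B K)))
    a^B≤ : a ^ B ≤ q ^ n * suc b ^ B
    a^B≤ = ≤-trans (≤-reflexive (sym (ℕ.*-identityʳ (a ^ B)))) (+≤+⁻ {a ^ B} {1} {q ^ n} {suc b ^ B}
      (subst₂ (λ x y → x ℤ.* + 1 ℤ.≤ + (q ^ n) ℤ.* + y) (↥-^ℚ a b B) (↧-^ℚ a b B) z^B≤))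
  -- A negative exponent forces z ≤ 1, and q^A is at least 1.
  ^ℚ-≤ q -[1+ n ] {K} {A} {B} {a} {b} _ z^B≤ with ℚ.≤-trans z^B≤ (1/≤1 (q ^ suc n) {{m^n≢0 q (suc n)}})
  ... | ℚ.*≤* z^B≤1 = ≤-trans (^-monoˡ-≤ K (^-cancelʳ-≤ B {a} {suc b} (subst₂ _≤_ (ℕ.*-identityʳ (a ^ B)) (ℕ.*-identityˡ (suc b ^ B))
      (+≤+⁻ {a ^ B} {1} {1} {suc b ^ B} (subst₂ (λ x y → x ℤ.* + 1 ℤ.≤ + 1 ℤ.* + y) (↥-^ℚ a b B) (↧-^ℚ a b B) z^B≤1)))))
    (m≤n*m (suc b ^ K) (q ^ A) {{m^n≢0 q A}})

  unitFraction : ∀ (x : ℝ) → 0ᴿ <ᴿ x → ∃ λ K → (+ 1 / suc K) ∈ x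
  unitFraction x (p₀ , p₀∈x , p₀≮0) with ℝ.rounded x p₀∈x
  ... | p , p₀<p , p∈x = positive p (ℚ.≤-<-trans (ℚ.≮⇒≥ p₀≮0) p₀<p) p∈x
    where
    positive : ∀ p → 0ℚᵘ ℚ.< p → p ∈ x → ∃ λ K → (+ 1 / suc K) ∈ x
    positive (ℚ.mkℚᵘ (+ zero) b)    (ℚ.*<* lt) _ = contradiction (+<+⁻ {0} {suc b} {0} {1} lt) λ ()
    -- The fraction 1/(b + 2) lies strictly below (a + 1)/(b + 1).
    positive (ℚ.mkℚᵘ (+ (suc a)) b) _ p∈x = suc b , ℝ.closed x
      (ℚ.*<* (+<+⁺ {1} {suc b} {suc a} {suc (suc b)} (≤-trans (s≤s (≤-reflexive (cong suc (ℕ.+-identityʳ b)))) (m≤n*m (suc (suc b)) (suc a))))) p∈x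
    positive (ℚ.mkℚᵘ -[1+ a ] b)    (ℚ.*<* ()) _

  ∈-· : ∀ (x : ℝ) K j r → (+ 1 / suc K) ∈ x → j * suc K < r → (+ j / 1) ∈ (r · x)
  ∈-· x K j r 1/K∈x jK<r = + 1 / suc K , 1/K∈x , ℚ.*<*
    (subst (λ z → + j ℤ.* + suc (K + 0) ℤ.< z ℤ.* + 1) (sym (ℤ.*-identityʳ (+ r)))
      (+<+⁺ {j} {suc (K + 0)} {r} {1} (subst₂ _<_ (cong (λ z → j * suc z) (sym (ℕ.+-identityʳ K))) (sym (ℕ.*-identityʳ r)) jK<r)))

  -- A cut omits its own endpoint, so the integer to test is q^j - 1: it lies in the cut of q^x,
  -- hence below Δ.
  q^j≤ : ∀ q .{{_ : NonZero q}} (x : ℝ) j Δ → (+ j / 1) ∈ x → q ^ᴿ x ≤ᴿ fromℕ Δ → q ^ j ≤ Δ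
  q^j≤ q x j Δ j∈x q^x≤Δ with q ^ j in eq
  ... | zero  = z≤n
  ... | suc w = /1-<⁻ (q^x≤Δ (+ w / 1) (+ j / 1 , j∈x , + suc w / 1 , ℚ.*≤* (+≤+⁺ {0} {1} {suc w} {1} z≤n) , /1-< (n<1+n w) ,
                  ℚ.≤-reflexive (ℚ.≃-trans (ℚ.*-identityʳ (+ suc w / 1)) (ℚ.≃-reflexive (cong (λ z → + z / 1) (sym eq))))))

  fromℕ≤fromℚ⁻ : ∀ e r m .{{_ : NonZero m}} → fromℕ e ≤ᴿ fromℚ (+ r / m) → e * m ≤ r
  fromℕ≤fromℚ⁻ e r m@(suc _) e≤r/m with ℚ.≮⇒≥ (λ r/m<e → ℚ.<-irrefl ℚ.≃-refl (e≤r/m (+ r / m) r/m<e))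
  ... | ℚ.*≤* le = subst (e * m ≤_) (ℕ.*-identityʳ r) (+≤+⁻ {e} {m} {r} {1} le)

  -- Any natural number j ≥ r c gives q^(r c) ≤ q^j, so no root has to be extracted.
  upper-bound : ∀ q .{{_ : NonZero q}} r C K j N M .{{_ : NonZero K}} → r ≤ j * suc C →
    q ^ (q ^ j) * suc M ^ K ≤ N ^ K → ℚ.mkℚᵘ (+ N) M ∉ q ^ᴿ (q ^ᴿ (r · fromℚ (+ 1 / suc C)) ∕ K)
  upper-bound q r C K j N M r≤jC N^K≥ (a , (a′ , (p , p<1/C , a′<rp) , z′ , 0≤z′ , Ka<z′ , z′^≤) , z , 0≤z , N/M<z , z^≤) =
    contradict z 0≤z N/M<z z^≤
    where
    a′≤j : ∀ a′ → a′ ℚ.< (+ r / 1) ℚ.* p → ℚ.↥ a′ ℤ.* + 1 ℤ.≤ + (j * ℚ.↧ₙ a′)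
    a′≤j a′ a′<rp with ℚ.≤-trans (ℚ.<⇒≤ a′<rp) (ℚ.≤-trans (ℚ.*-monoʳ-≤-nonNeg (+ r / 1) (ℚ.<⇒≤ p<1/C)) r/C≤j)
      where
      r/C≤j : (+ r / 1) ℚ.* (+ 1 / suc C) ℚ.≤ + j / 1
      r/C≤j = ℚ.*≤* (subst (λ z → z ℤ.* + 1 ℤ.≤ + j ℤ.* + suc (C + 0)) (sym (ℤ.*-identityʳ (+ r)))
        (+≤+⁺ {r} {1} {j} {suc (C + 0)} (subst₂ _≤_ (sym (ℕ.*-identityʳ r)) (cong (λ z → j * suc z) (sym (ℕ.+-identityʳ C))) r≤jC)))
    ... | ℚ.*≤* le = subst (ℚ.↥ a′ ℤ.* + 1 ℤ.≤_) (sym (ℤ.pos-* j (ℚ.↧ₙ a′))) le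
    z′≤q^j : ∀ z′ → 0ℚᵘ ℚ.≤ z′ → z′ ^ℚ (ℚ.↧ₙ a′) ℚ.≤ q ^ℤ (ℚ.↥ a′) → z′ ℚ.≤ + (q ^ j) / 1
    z′≤q^j (ℚ.mkℚᵘ (+ n) b) _ le = ℚ.*≤* (+≤+⁺ {n} {1} {q ^ j} {suc b} (subst₂ _≤_ (trans (ℕ.^-identityʳ n) (sym (ℕ.*-identityʳ n)))
      (cong (q ^ j *_) (ℕ.^-identityʳ (suc b))) (^ℚ-≤ q (ℚ.↥ a′) {1} {j} {ℚ.↧ₙ a′} {n} {b} (a′≤j a′ a′<rp) le)))
    z′≤q^j (ℚ.mkℚᵘ -[1+ n ] b) (ℚ.*≤* ()) _
    Ka≤q^j : ∀ a → (+ K / 1) ℚ.* a ℚ.≤ + (q ^ j) / 1 → ℚ.↥ a ℤ.* + K ℤ.≤ + (q ^ j * ℚ.↧ₙ a)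
    Ka≤q^j (ℚ.mkℚᵘ i b) (ℚ.*≤* le) = subst₂ ℤ._≤_ (trans (ℤ.*-identityʳ (+ K ℤ.* i)) (ℤ.*-comm (+ K) i))
      (trans (sym (ℤ.pos-* (q ^ j) (suc (b + 0)))) (cong (λ z → + (q ^ j * suc z)) (ℕ.+-identityʳ b))) le
    contradict : ∀ z → 0ℚᵘ ℚ.≤ z → ℚ.mkℚᵘ (+ N) M ℚ.< z → z ^ℚ (ℚ.↧ₙ a) ℚ.≤ q ^ℤ (ℚ.↥ a) → ⊥
    contradict (ℚ.mkℚᵘ (+ n) b) _ (ℚ.*<* lt) le = ℕ.<-irrefl refl (begin-strict
      N ^ K * suc b ^ K                       ≡⟨ ^-distribʳ-* N (suc b) K ⟨
      (N * suc b) ^ K                         <⟨ ℕ.^-monoˡ-< K (+<+⁻ {N} {suc b} {n} {suc M} lt) ⟩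
      (n * suc M) ^ K                         ≡⟨ ^-distribʳ-* n (suc M) K ⟩
      n ^ K * suc M ^ K  ≤⟨ *-monoˡ-≤ (suc M ^ K) (^ℚ-≤ q (ℚ.↥ a) {K} {q ^ j} {ℚ.↧ₙ a} {n} {b}
                                                   (Ka≤q^j a (ℚ.≤-trans (ℚ.<⇒≤ Ka<z′) (z′≤q^j z′ 0≤z′ z′^≤))) le) ⟩
      q ^ (q ^ j) * suc b ^ K * suc M ^ K  ≡⟨ solve 3 (λ x y z → x :* y :* z := x :* z :* y) refl (q ^ (q ^ j)) (suc b ^ K) (suc M ^ K) ⟩
      q ^ (q ^ j) * suc M ^ K * suc b ^ K     ≤⟨ *-monoˡ-≤ (suc b ^ K) N^K≥ ⟩
      N ^ K * suc b ^ K                       ∎)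
      where open ℕ.≤-Reasoning
    contradict (ℚ.mkℚᵘ -[1+ n ] b) (ℚ.*≤* ()) _ _

  -- The cut of the reciprocal asks for a rational upper bound of q^X, and g/E is one by the
  -- inequality on K-th powers.
  fromℚ≤recip : ∀ q .{{_ : NonZero q}} r C K j E g .{{_ : NonZero K}} .{{_ : NonZero g}} → r ≤ j * suc C → E ^ K * q ^ (q ^ j) ≤ g ^ K →
    let X = q ^ᴿ (r · fromℚ (+ 1 / suc C)) ∕ K in fromℚ (+ E / g) ≤ᴿ recip (q ^ᴿ X) (^ᴿ-positive q X)
  fromℚ≤recip q r C K j zero g@(suc _) r≤jC _ y y<0 =
    -- With E = 0 any positive upper bound of q^X serves.
    + (q ^ A) / 1 , /1-< (>-nonZero⁻¹ (q ^ A) {{m^n≢0 q A}}) ,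
    upper-bound q r C K j (q ^ A) 0 r≤jC (≤-trans (≤-reflexive (trans (cong (q ^ A *_) (ℕ.^-zeroˡ K)) (ℕ.*-identityʳ (q ^ A))))
      (≤-trans (≤-reflexive (sym (ℕ.^-identityʳ (q ^ A)))) (^-monoʳ-≤ (q ^ A) {{m^n≢0 q A}} (>-nonZero⁻¹ K)))) ,
    ℚ.≤-<-trans (ℚ.*-monoˡ-≤-nonNeg (+ (q ^ A) / 1) {{_}} {y} {0ℚᵘ} y≤0)
      (ℚ.≤-<-trans (ℚ.≤-reflexive (ℚ.*-zeroˡ (+ (q ^ A) / 1))) (/1-< {0} {1} (s≤s z≤n)))
    where
    A = q ^ j
    y≤0 : y ℚ.≤ 0ℚᵘ
    y≤0 = ℚ.≤-trans (ℚ.<⇒≤ y<0) (ℚ.≤-reflexive (ℚ.*≡* refl))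
  fromℚ≤recip q r C K j E@(suc E′) g@(suc _) r≤jC E^K≤ y y<E/g =
    + g / E , ℚ.*<* (+<+⁺ {0} {E} {g} {1} (s≤s z≤n)) ,
    upper-bound q r C K j g E′ r≤jC (≤-trans (≤-reflexive (ℕ.*-comm (q ^ (q ^ j)) (E ^ K))) E^K≤) ,
    ℚ.<-≤-trans (ℚ.*-monoˡ-<-pos (+ g / E) y<E/g) (ℚ.≤-reflexive (ℚ.*-inverseˡ (+ g / E)))

  Pr≤recip : ∀ q .{{_ : NonZero q}} r C K .{{_ : NonZero K}} j {A : Set} {P : Pred A 0ℓ} (xs : List A) (P? : Decidable P) → r ≤ j * suc C →
    count P? xs ^ K * q ^ (q ^ j) ≤ length xs ^ K →
    let X = q ^ᴿ (r · fromℚ (+ 1 / suc C)) ∕ K in fromℚ (Pr xs P?) ≤ᴿ recip (q ^ᴿ X) (^ᴿ-positive q X)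
  -- The conventional value 0 on the empty list is treated as 0/1.
  Pr≤recip q r C K j []         P? r≤jC le = fromℚ≤recip q r C K j 0 1 r≤jC (≤-trans le (^-monoˡ-≤ K z≤n))
  Pr≤recip q r C K j xs@(_ ∷ _) P? r≤jC le = fromℚ≤recip q r C K j (count P? xs) (length xs) r≤jC le

-- Choice of the constants and of the parameters for given r.

-- A choice, for given r, of the parameters v = 1 + v′ and A = q^j for which
-- Core.conclusion applies; 1 / E₁ and 1 / E₂ are lower bounds of ε and δ.
record Choice (p k B E₁ E₂ scale r : ℕ) : Set where
  field
    j v′      : ℕ
    r≤j*scale : r ≤ j * scale
    roots≤    : ∀ s → 2 ^ v′ ≤ s → suc p ^ (suc p ^ j) * p ^ s ≤ suc p ^ s
    Bound≤    : B * suc p ^ (suc p ^ j) ≤ suc p ^ (2 ^ v′)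
    2^v′≤q^v  : 2 ^ v′ ≤ suc p ^ suc v′
    v*E₁<r    : suc v′ * E₁ < r
    i*E₂<r    : (k * suc v′ + suc v′ * p) * E₂ < r
    slack     : ∀ e → e * (4 * k) ≤ r → 3 * (k * suc v′ + suc v′ * p) + p + suc v′ * p + 2 * (k * e) ≤ r

module Parameters (p k′ B E₁ E₂ : ℕ) (p≢0 : NonZero p) where

  open +-*-Solver using (solve; con; _:=_; _:+_; _:*_)
  open ℕ.≤-Reasoning

  -- T adds up the factors by which v is multiplied in the conditions from ε, from δ and from
  -- `slack`, so v·T < r implies all three. In 2vT, `scale` is the coefficient of the quotient of r,
  -- and r₀ exceeds the constant part.
  q k b c T C scale r₀ : ℕ
  q     = suc p
  k     = suc k′
  b     = (k + p) * suc E₂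
  c     = 2 * (3 * (k + p) + 2 * p)
  T     = suc E₁ + b + c
  C     = 2 * q + B + 1
  scale = 2 * (q * T)
  r₀    = suc (2 * ((q + C) * T))

  n<2^n : ∀ n → n < 2 ^ n
  n<2^n zero    = s≤s z≤n
  n<2^n (suc n) = begin-strict
    suc n          ≤⟨ n<2^n n ⟩
    2 ^ n          <⟨ ℕ.m<m+n (2 ^ n) (ℕ.m^n>0 2 n) ⟩
    2 ^ n + 2 ^ n  ≡⟨ cong (λ z → 2 ^ n + z) (ℕ.+-identityʳ (2 ^ n)) ⟨
    2 * 2 ^ n      ∎

  2≤q : 2 ≤ q
  2≤q = s≤s (>-nonZero⁻¹ p {{p≢0}})

  -- Bernoulli's inequality for (1 + 1/p)^m, cleared of denominators.
  bernoulli : ∀ m → p ^ m * (p + m) ≤ q ^ m * p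
  bernoulli zero    = ≤-reflexive (cong (1 *_) (ℕ.+-identityʳ p))
  bernoulli (suc m) = begin
    p ^ suc m * (p + suc m)                     ≤⟨ m≤m+n _ (p ^ m * m) ⟩
    p * p ^ m * (p + suc m) + p ^ m * m  ≡⟨ solve 3 (λ p x m → p :* x :* (p :+ (con 1 :+ m)) :+ x :* m := (con 1 :+ p) :* (x :* (p :+ m))) refl p (p ^ m) m ⟩
    q * (p ^ m * (p + m))                       ≤⟨ *-monoʳ-≤ q (bernoulli m) ⟩
    q * (q ^ m * p)                             ≡⟨ ℕ.*-assoc q (q ^ m) p ⟨
    q ^ suc m * p                               ∎

  2p^p≤q^p : 2 * p ^ p ≤ q ^ p
  2p^p≤q^p = ℕ.*-cancelʳ-≤ _ _ p {{p≢0}} (begin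
    2 * p ^ p * p       ≡⟨ solve 2 (λ x p → con 2 :* x :* p := x :* (p :+ p)) refl (p ^ p) p ⟩
    p ^ p * (p + p)     ≤⟨ bernoulli p ⟩
    q ^ p * p           ∎)

  -- By `2p^p≤q^p`, every p factors q/p gain a factor 2, and q·A such gains reach q^A because q <
  -- 2^q.
  q^A*p^s≤q^s : ∀ A s → p * (q * A) ≤ s → q ^ A * p ^ s ≤ q ^ s
  q^A*p^s≤q^s A s large with o , refl ← ℕ.m≤n⇒∃[o]m+o≡n large = begin
    q ^ A * p ^ (p * t + o)            ≡⟨ cong (q ^ A *_) (^-distribˡ-+-* p (p * t) o) ⟩
    q ^ A * (p ^ (p * t) * p ^ o)  ≤⟨ *-mono-≤ q^A≤2^t (*-monoʳ-≤ (p ^ (p * t)) (^-monoˡ-≤ o (n≤1+n p))) ⟩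
    2 ^ t * (p ^ (p * t) * q ^ o)      ≡⟨ cong (λ z → 2 ^ t * (z * q ^ o)) (^-*-assoc p p t) ⟨
    2 ^ t * ((p ^ p) ^ t * q ^ o)      ≡⟨ ℕ.*-assoc (2 ^ t) ((p ^ p) ^ t) (q ^ o) ⟨
    2 ^ t * (p ^ p) ^ t * q ^ o        ≡⟨ cong (_* q ^ o) (^-distribʳ-* 2 (p ^ p) t) ⟨
    (2 * p ^ p) ^ t * q ^ o            ≤⟨ *-monoˡ-≤ (q ^ o) (^-monoˡ-≤ t 2p^p≤q^p) ⟩
    (q ^ p) ^ t * q ^ o                ≡⟨ cong (_* q ^ o) (^-*-assoc q p t) ⟩
    q ^ (p * t) * q ^ o                ≡⟨ ^-distribˡ-+-* q (p * t) o ⟨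
    q ^ (p * t + o)                    ∎
    where
    t = q * A
    q^A≤2^t : q ^ A ≤ 2 ^ t
    q^A≤2^t = ≤-trans (^-monoˡ-≤ A (<⇒≤ (n<2^n q))) (≤-reflexive (^-*-assoc 2 q A))

  module _ (r : ℕ) (r₀≤r : r₀ ≤ r) where

    j v′ v A i : ℕ
    -- Rounded up, so that r/(1 + scale) ≤ j.
    j  = suc (r div suc scale)
    -- The part q(j + 2) makes 2^v′ exceed q·q·A, as `roots≤` requires; the summand B absorbs the
    -- factor B in `Bound≤`.
    v′ = q * (j + 2) + B
    v  = suc v′
    A  = q ^ j
    i  = k * v + v * p

    r≤j*scale : r ≤ j * suc scale
    r≤j*scale = begin
      r                                              ≡⟨ m≡m%n+[m/n]*n r (suc scale) ⟩
      r % suc scale + (r div suc scale) * suc scale  ≤⟨ +-monoˡ-≤ ((r div suc scale) * suc scale) (<⇒≤ (m%n<n r (suc scale))) ⟩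
      j * suc scale                                  ∎

    v*T<r : v * T < r
    v*T<r = ℕ.*-cancelˡ-< 2 (v * T) r (begin-strict
      2 * (v * T)
        ≡⟨ solve 4 (λ q t b T → con 2 :* ((con 1 :+ (q :* (con 1 :+ t :+ con 2) :+ b)) :* T)
             := t :* (con 2 :* (q :* T)) :+ con 2 :* ((q :+ (con 2 :* q :+ b :+ con 1)) :* T)) refl q t B T ⟩
      t * scale + 2 * ((q + C) * T)
        <⟨ ℕ.+-mono-≤-< (≤-trans (*-monoʳ-≤ t (n≤1+n scale)) (m/n*n≤m r (suc scale))) r₀≤r ⟩
      r + r
        ≡⟨ cong (λ z → r + z) (ℕ.+-identityʳ r) ⟨
      2 * r ∎)
      where t = (r div suc scale)

    A*q*q≤ : q * (q * A) ≤ 2 ^ (q * (j + 2))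
    A*q*q≤ = begin
      q * (q * q ^ j)      ≡⟨ cong (q ^_) (ℕ.+-comm 2 j) ⟩
      q ^ (j + 2)          ≤⟨ ^-monoˡ-≤ (j + 2) (<⇒≤ (n<2^n q)) ⟩
      (2 ^ q) ^ (j + 2)    ≡⟨ ^-*-assoc 2 q (j + 2) ⟩
      2 ^ (q * (j + 2))    ∎

    2^v′≡ : 2 ^ v′ ≡ 2 ^ (q * (j + 2)) * 2 ^ B
    2^v′≡ = ^-distribˡ-+-* 2 (q * (j + 2)) B

    roots≤ : ∀ s → 2 ^ v′ ≤ s → q ^ A * p ^ s ≤ q ^ s
    roots≤ s 2^v′≤s = q^A*p^s≤q^s A s (begin
      p * (q * A)                     ≤⟨ *-monoˡ-≤ (q * A) (n≤1+n p) ⟩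
      q * (q * A)                     ≤⟨ A*q*q≤ ⟩
      2 ^ (q * (j + 2))               ≤⟨ m≤m*n (2 ^ (q * (j + 2))) (2 ^ B) {{m^n≢0 2 B}} ⟩
      2 ^ (q * (j + 2)) * 2 ^ B       ≡⟨ 2^v′≡ ⟨
      2 ^ v′                          ≤⟨ 2^v′≤s ⟩
      s                               ∎)

    A+B≤2^v′ : B + A ≤ 2 ^ v′
    A+B≤2^v′ = begin
      B + A                           ≡⟨ ℕ.+-comm B A ⟩
      A + B                           ≤⟨ +-monoʳ-≤ A (m≤n*m B A {{m^n≢0 q j}}) ⟩
      A + A * B                       ≡⟨ ℕ.*-suc A B ⟨
      A * suc B  ≤⟨ *-mono-≤ (≤-trans (≤-trans (m≤n*m A q) (m≤n*m (q * A) q)) A*q*q≤) (n<2^n B) ⟩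
      2 ^ (q * (j + 2)) * 2 ^ B       ≡⟨ 2^v′≡ ⟨
      2 ^ v′                          ∎

    Bound≤ : B * q ^ A ≤ q ^ (2 ^ v′)
    Bound≤ = begin
      B * q ^ A          ≤⟨ *-monoˡ-≤ (q ^ A) (≤-trans (<⇒≤ (n<2^n B)) (^-monoˡ-≤ B 2≤q)) ⟩
      q ^ B * q ^ A      ≡⟨ ^-distribˡ-+-* q B A ⟨
      q ^ (B + A)        ≤⟨ ^-monoʳ-≤ q A+B≤2^v′ ⟩
      q ^ (2 ^ v′)       ∎

    v*E₁<r : v * suc E₁ < r
    v*E₁<r = ≤-<-trans (*-monoʳ-≤ v (≤-trans (m≤m+n (suc E₁) b) (m≤m+n (suc E₁ + b) c))) v*T<r

    i*E₂<r : i * suc E₂ < r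
    i*E₂<r = begin-strict
      i * suc E₂  ≡⟨ solve 4 (λ k v p E → (k :* v :+ v :* p) :* E := v :* ((k :+ p) :* E)) refl k v p (suc E₂) ⟩
      v * ((k + p) * suc E₂)  ≤⟨ *-monoʳ-≤ v (≤-trans (m≤n+m b (suc E₁)) (m≤m+n (suc E₁ + b) c)) ⟩
      v * T                         <⟨ v*T<r ⟩
      r                             ∎

    2^v′≤q^v : 2 ^ v′ ≤ q ^ v
    2^v′≤q^v = ≤-trans (^-monoʳ-≤ 2 (n≤1+n v′)) (^-monoˡ-≤ v 2≤q)

    W : ℕ
    W = 3 * i + p + v * p

    2*W≤r : 2 * W ≤ r
    2*W≤r = begin
      2 * W  ≤⟨ *-monoʳ-≤ 2 (+-monoˡ-≤ (v * p) (+-monoʳ-≤ (3 * i) (m≤n*m p v))) ⟩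
      2 * (3 * i + v * p + v * p)  ≡⟨ solve 3 (λ k v p → con 2 :* (con 3 :* (k :* v :+ v :* p) :+ v :* p :+ v :* p)
                                                    := v :* (con 2 :* (con 3 :* (k :+ p) :+ con 2 :* p))) refl k v p ⟩
      v * (2 * (3 * (k + p) + 2 * p))          ≤⟨ *-monoʳ-≤ v (m≤n+m c (suc E₁ + b)) ⟩
      v * T                                    ≤⟨ <⇒≤ v*T<r ⟩
      r                                        ∎

    -- The hypothesis on e bounds 2ke by r/2, and W fits into the other half.
    slack : ∀ e → e * (4 * k) ≤ r → W + 2 * (k * e) ≤ r
    slack e 4ke≤r = ℕ.*-cancelˡ-≤ 2 (begin
      2 * (W + 2 * (k * e))  ≡⟨ solve 3 (λ w k e → con 2 :* (w :+ con 2 :* (k :* e)) := con 2 :* w :+ e :* (con 4 :* k)) refl W k e ⟩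
      2 * W + e * (4 * k)            ≤⟨ +-mono-≤ 2*W≤r 4ke≤r ⟩
      r + r                          ≡⟨ cong (λ z → r + z) (ℕ.+-identityʳ r) ⟨
      2 * r                          ∎)

    choice : Choice p k B (suc E₁) (suc E₂) (suc scale) r
    choice = record
      { j = j ; v′ = v′ ; r≤j*scale = r≤j*scale ; roots≤ = roots≤ ; Bound≤ = Bound≤ ; 2^v′≤q^v = 2^v′≤q^v
      ; v*E₁<r = v*E₁<r ; i*E₂<r = i*E₂<r ; slack = slack }

-- Transfer to the codes, distances and probabilities of the statement.

count≡∑ : ∀ {A : Set} {P : Pred A 0ℓ} (P? : Decidable P) xs →
          count P? xs ≡ Sums.∑ ℕ.+-*-commutativeSemiring xs (λ x → Sums.⟦_⟧ ℕ.+-*-commutativeSemiring (P? x))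
count≡∑ P? []       = refl
count≡∑ P? (x ∷ xs) with P? x
... | yes _ = cong suc (count≡∑ P? xs)
... | no  _ = count≡∑ P? xs

filter-does : ∀ {A : Set} {P Q : Pred A 0ℓ} (P? : Decidable P) (Q? : Decidable Q) → (∀ x → does (P? x) ≡ does (Q? x)) →
              ∀ xs → filter P? xs ≡ filter Q? xs
filter-does P? Q? eq []       = refl
filter-does P? Q? eq (x ∷ xs) with P? x | Q? x | eq x
... | yes _ | yes _ | _ = cong (x ∷_) (filter-does P? Q? eq xs)
... | no _  | no _  | _ = filter-does P? Q? eq xs

module Transfer (p : ℕ) (q-prime : Prime (suc p)) where

  open PrimeField p q-prime using (field-structure)
  open Polynomials field-structure using (Deg; Deg-cong; points)
  open LeadingTerms field-structure using (module ∑ℕ)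
  open Counting field-structure
  open Core field-structure using (#differ)
  open ReedMuller (suc p)
  open ∑ℕ

  ∈𝒫⇒Deg : ∀ {n d} {f : Function n} → f ∈𝒫 d → Deg d f
  ∈𝒫⇒Deg = IsEval⇒Deg

  Deg⇒∈𝒫 : ∀ {n d} {f : Function n} → Deg d f → f ∈𝒫 d
  Deg⇒∈𝒫 = Deg⇒IsEval

  -- `Deg?` runs the same search over coefficient vectors, so the two filters make the same boolean
  -- decisions.
  𝒫≡code : ∀ n e → 𝒫 n e ≡ code n e
  𝒫≡code n e = filter-does (_∈𝒫? e) (Deg? e) (λ _ → refl) (functions n)

  distance≡#differ : ∀ {n} (f g : Function n) → distance f g ≡ #differ f g
  distance≡#differ f g = count≡∑ (λ x → ¬? (f x Fin.≟ g x)) (points _)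

  ∃-function : ∀ {n} (g : Function n) → ∃ λ g′ → g′ ∈ₗ functions n × g′ ≗ g
  ∃-function {n} g = find (functions n) λ ∑≡0 → contradiction (trans (sym (∑-functions-once n g)) ∑≡0) λ ()
    where
    find : ∀ gs → ∑ gs (λ g′ → ⟦ g′ ≗? g ⟧) ≢ 0 → ∃ λ g′ → g′ ∈ₗ gs × g′ ≗ g
    find []        ∑≢0 = contradiction refl ∑≢0
    find (g′ ∷ gs) ∑≢0 with g′ ≗? g
    ... | yes g′≗g = g′ , here refl , g′≗g
    ... | no  _    with g″ , g″∈ , g″≗g ← find gs ∑≢0 = g″ , there g″∈ , g″≗g

  -- The list of codewords contains g only up to `≗`, so the minimum is compared with the distance
  -- to a listed representative.
  far⇒ : ∀ {n Δ d} {f g : Function n} → (Δ -FarFrom𝒫 d) f → Deg d g → Δ < #differ f g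
  far⇒ {n} {Δ} {d} {f} {g} far dg with g′ , g′∈ , g′≗g ← ∃-function g = <-≤-trans far (≤-trans
    (min≤v⁺ (distance f (λ _ → 0𝔽)) (List.map (distance f) (𝒫 n d)) (inj₂ (Any.map (≤-reflexive ∘ sym)
      (∈-map⁺ (distance f) (∈-filter⁺ (_∈𝒫? d) g′∈ (Deg⇒∈𝒫 (Deg-cong (sym ∘ g′≗g) dg)))))))
    (≤-reflexive (trans (distance≡#differ f g′) (∑-cong (points n) λ x →
      ⟦⟧-cong {d = ¬? (f x Fin.≟ g′ x)} {d′ = ¬? (f x Fin.≟ g x)} (λ ≢ eq → ≢ (trans eq (sym (g′≗g x)))) (λ ≢ eq → ≢ (trans eq (g′≗g x)))))))

module Assembly (p k′ : ℕ) (q-prime : Prime (suc p)) (k≤p : suc k′ ≤ p) where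

  open PrimeField p q-prime using (field-structure)
  open LeadingTerms field-structure using (module ∑ℕ)
  open Polynomials field-structure using (Deg-cong)
  open Counting field-structure using (Bound; code; good?; #good)
  open Core field-structure using (conclusion)
  open FieldTheory field-structure using (eval₁-*)
  open Transfer p q-prime
  open ReedMuller (suc p)
  open Reals
  open +-*-Solver using (solve; con; _:=_; _:+_; _:*_)

  q k : ℕ
  q = suc p
  k = suc k′

  Product∈ : ∀ {n} (d e : ℕ) (h : Vec 𝔽 (suc k)) (f : Function n) → Pred (Function n) 0ℓ
  Product∈ d e h f P = (λ x → f x *𝔽 eval₁ h (P x)) ∈𝒫 (d + e * k)

  product∈? : ∀ {n} d e h (f : Function n) → Decidable (Product∈ d e h f)
  product∈? d e h f P = (λ x → f x *𝔽 eval₁ h (P x)) ∈𝒫? (d + e * k)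

  count≡#good : ∀ n d e (h : Vec 𝔽 (suc k)) (f : Function n) →
    count (product∈? d e h f) (𝒫 n e) ≡ #good (d + e * k) e (λ x → Vec.map (f x *𝔽_) h)
  count≡#good n d e h f = trans (count≡∑ (product∈? d e h f) (𝒫 n e))
    (trans (cong (λ xs → ∑ℕ.∑ xs (λ P → ∑ℕ.⟦ product∈? d e h f P ⟧)) (𝒫≡code n e))
      (∑ℕ.∑-cong (code n e) λ P → ∑ℕ.⟦⟧-cong {d = product∈? d e h f P} {d′ = good? (d + e * k) (λ x → Vec.map (f x *𝔽_) h) P}
        (λ g∈ → Deg-cong (λ x → sym (eval₁-* (f x) h (P x))) (∈𝒫⇒Deg g∈))
        (λ dg → Deg⇒∈𝒫 (Deg-cong (λ x → eval₁-* (f x) h (P x)) dg))))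

  module _ {E₁ E₂ scale r : ℕ} (ch : Choice p k (Bound k) E₁ E₂ scale r) where

    open Choice ch

    private
      v i : ℕ
      v = suc v′
      i = k * v + v * p

    count-bound : ∀ n d Δ e → r + d ≡ p * n → q ^ v ≤ Δ → i ≤ e → e * (4 * k) ≤ r →
      (h : Vec 𝔽 (suc k)) → last h ≢ 0𝔽 → (f : Function n) → (Δ -FarFrom𝒫 d) f →
      count (product∈? d e h f) (𝒫 n e) ^ (2 ^ k) * q ^ (q ^ j) ≤ length (𝒫 n e) ^ (2 ^ k)
    count-bound n d Δ e r+d≡ q^v≤Δ i≤e 4ke≤r h lh≢0 f far =
      subst₂ (λ E g → E ^ (2 ^ k) * q ^ (q ^ j) ≤ g ^ (2 ^ k)) (sym (count≡#good n d e h f)) (cong length (sym (𝒫≡code n e)))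
        (conclusion k′ d r e v′ (q ^ j) j₀ m M f h
          (trans r+d≡ (ℕ.*-comm p n)) k≤p lh≢0 (λ dg → ≤-trans (≤-trans 2^v′≤q^v q^v≤Δ) (<⇒≤ (far⇒ far dg)))
          refl i≤e <r small j₀≤M ke+vp≤M Bound≤ roots≤)
      where
      -- The predecessor of i, written so that `suc j₀` and i agree by computation.
      j₀ = v′ + k′ * v + v * p
      rest = ℕ.m≤n⇒∃[o]m+o≡n (slack e 4ke≤r)
      o = proj₁ rest
      -- All of the slack o goes into M, so that m + i + ek is exactly r - 1.
      M = j₀ + v * p + k * e + o
      m = M + i + p
      <r : m + i + e * k < r
      <r = ≤-reflexive (trans (solve 6 (λ j vp k e o p → con 1 :+ (j :+ vp :+ k :* e :+ o :+ (con 1 :+ j) :+ p :+ (con 1 :+ j) :+ e :* k)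
        := con 3 :* (con 1 :+ j) :+ p :+ vp :+ con 2 :* (k :* e) :+ o) refl j₀ (v * p) k e o p) (proj₂ rest))
      small : i + p + M ≤ m
      small = ≤-reflexive (solve 3 (λ i p M → i :+ p :+ M := M :+ i :+ p) refl i p M)
      j₀≤M : j₀ ≤ M
      j₀≤M = ≤-trans (m≤m+n j₀ (v * p)) (≤-trans (m≤m+n (j₀ + v * p) (k * e)) (m≤m+n (j₀ + v * p + k * e) o))
      ke+vp≤M : k * e + v * p ≤ suc M
      ke+vp≤M = ≤-trans (m≤m+n (k * e + v * p) (suc (j₀ + o)))
        (≤-reflexive (solve 4 (λ ke vp j o → ke :+ vp :+ (con 1 :+ (j :+ o)) := con 1 :+ (j :+ vp :+ ke :+ o)) refl (k * e) (v * p) j₀ o))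

module Conclusion (p k′ : ℕ) (q-prime : Prime (suc p)) (k≤p : suc k′ ≤ p) (ε δ : ℝ) (E₁ E₂ scale r₀ : ℕ)
  (1/E₁∈ε : (+ 1 / suc E₁) ∈ ε) (1/E₂∈δ : (+ 1 / suc E₂) ∈ δ)
  (choose : ∀ r → r₀ ≤ r → Choice p (suc k′) (Counting.Bound (PrimeField.field-structure p q-prime) (suc k′)) (suc E₁) (suc E₂) (suc scale) r) where

  open Assembly p k′ q-prime k≤p
  open ReedMuller (suc p)
  open Reals

  bound : (n d r Δ e : ℕ) → r₀ ≤ r → r + d ≡ p * n →
    q ^ᴿ (r · ε) ≤ᴿ fromℕ Δ → r · δ ≤ᴿ fromℕ e → fromℕ e ≤ᴿ fromℚ (_/_ (+ r) (4 * k) {{m*n≢0 4 k}}) →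
    (h : Vec 𝔽 (suc k)) → last h ≢ 0𝔽 → (f : Function n) → (Δ -FarFrom𝒫 d) f →
    let X = _∕_ (q ^ᴿ (r · fromℚ (+ 1 / suc scale))) (2 ^ k) {{m^n≢0 2 k}} in
    fromℚ (Pr (𝒫 n e) (λ P → (λ x → f x *𝔽 eval₁ h (P x)) ∈𝒫? (d + e * k))) ≤ᴿ recip (q ^ᴿ X) (^ᴿ-positive q X)
  bound n d r Δ e r₀≤r r+d≡ q^εr≤Δ δr≤e e≤r/4k h lh≢0 f far =
    Pr≤recip q r scale (2 ^ k) {{m^n≢0 2 k}} j (𝒫 n e) (product∈? d e h f) r≤j*scale
      (count-bound ch n d Δ e r+d≡ (q^j≤ q (r · ε) v Δ (∈-· ε E₁ v r 1/E₁∈ε v*E₁<r) q^εr≤Δ)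
        (<⇒≤ (/1-<⁻ (δr≤e (+ i / 1) (∈-· δ E₂ i r 1/E₂∈δ i*E₂<r))))
        (fromℕ≤fromℚ⁻ e r (4 * k) {{m*n≢0 4 k}} e≤r/4k) h lh≢0 f far)
    where
    ch = choose r r₀≤r
    open Choice ch
    v = suc v′
    i = k * v + v * p

corollary1p8 : (q k : ℕ) .{{_ : NonZero q}} .{{_ : NonZero k}} (q-prime : Prime q) → k < q →
    (ε δ : ℝ) → 0ᴿ <ᴿ ε → ε <ᴿ 1ᴿ → 0ᴿ <ᴿ δ → δ <ᴿ 1ᴿ →
    let open ReedMuller q in
    ∃ λ (c : ℝ) → ∃ λ (r₀ : ℕ) → 0ᴿ <ᴿ c ×
    ((n d r Δ e : ℕ) .{{_ : NonZero n}} .{{_ : NonZero d}} .{{_ : NonZero r}}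
    .{{_ : NonZero Δ}} .{{_ : NonZero e}} →
    r₀ ≤ r → r + d ≡ (q ∸ 1) * n →
    q ^ᴿ (r · ε) ≤ᴿ fromℕ Δ →
    fromℕ Δ ≤ᴿ q ^ᴿ fromℚ (_/_ (+ r) (4 * (q ∸ 1)) {{4[q-1]≢0 q-prime}} ℚ.- (+ 2 / 1)) →
    r · δ ≤ᴿ fromℕ e →
    fromℕ e ≤ᴿ fromℚ (_/_ (+ r) (4 * k) {{m*n≢0 4 k}}) →
    (h : Vec 𝔽 (suc k)) → last h ≢ 0𝔽 →
    (f : Function n) → (Δ -FarFrom𝒫 d) f →
    let X = _∕_ (q ^ᴿ (r · c)) (2 ^ k) {{m^n≢0 2 k}} in
    fromℚ (Pr (𝒫 n e) (λ P → (λ x → f x *𝔽 eval₁ h (P x)) ∈𝒫? (d + e * k)))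
    ≤ᴿ recip (q ^ᴿ X) (^ᴿ-positive q X))
corollary1p8 zero    _        q-prime _ = contradiction q-prime ¬prime[0]
corollary1p8 (suc p) zero {{_}} {{k≢0}} _ _ = contradiction refl (≢-nonZero⁻¹ 0 {{k≢0}})
corollary1p8 (suc p) (suc k′) q-prime (s≤s k≤p) ε δ 0<ε _ 0<δ _ =
  -- The constants see ε and δ only through the unit fractions 1/(1 + E₁) and 1/(1 + E₂) below them.
  fromℚ (+ 1 / suc scale) , r₀ , (0ℚᵘ , ℚ.*<* (ℤ.+<+ (s≤s z≤n)) , ℚ.<-irrefl ℚ.≃-refl) ,
  λ n d r Δ e r₀≤r r+d≡ q^εr≤Δ _ → Conclusion.bound p k′ q-prime k≤p ε δ E₁ E₂ scale r₀ 1/E₁∈ε 1/E₂∈δ choice n d r Δ e r₀≤r r+d≡ q^εr≤Δ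
  where
  E₁ = proj₁ (Reals.unitFraction ε 0<ε)
  E₂ = proj₁ (Reals.unitFraction δ 0<δ)
  1/E₁∈ε = proj₂ (Reals.unitFraction ε 0<ε)
  1/E₂∈δ = proj₂ (Reals.unitFraction δ 0<δ)
  open Parameters p k′ (Counting.Bound (PrimeField.field-structure p q-prime) (suc k′)) E₁ E₂ (>-nonZero (<-≤-trans (s≤s z≤n) k≤p))
    using (scale; r₀; choice)
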